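{- Let $T$ be a tight $3$-tree with $t$ edges and $c(T)\leq 2$. If $t\geq 20$, then for every positive integer $n$, $$\mathrm{ex}_3(n,T)\leq \frac{t-1}{3}\binom{n}{2}.$$
   Context: All hypergraphs are finite. An $r$-graph is an $r$-uniform hypergraph (its edges form a set of $r$-element subsets of its vertex set). An $r$-graph $G$ contains an $r$-graph $H$ if there is an injection $f:V(H)\to V(G)$ such that $f(e)\in E(G)$ for every $e\in E(H)$. The Turán number $\mathrm{ex}_r(n,H)$ is the largest $m$ such that there exists an $n$-vertex $r$-graph with $m$ edges that does not contain $H$. A tight $r$-tree ($r\ge 2$) is an $r$-graph whose edges can be ordered so that each edge $e$ apart from the first one contains a vertex $v_e$ that does not belong to any preceding edge, while the set $e\setminus\{v_e\}$ is contained in some preceding edge. Such an ordering is called a proper ordering of the edges. (The vertex set of a tight tree is the union of its edges.) A vertex of a tight $r$-tree $T$ is a leaf if it lies in exactly one edge of $T$. A trunk of a tight $r$-tree $T$ is a tight subtree $T'$ of $T$ such that in some proper ordering of the edges of $T$ the edges of $T'$ are listed first, and all vertices in $V(T)\setminus V(T')$ are leaves of $T$. (Hence each $e\in E(T)\setminus E(T')$ consists of an $(r-1)$-subset of some $e'\in E(T')$ and a leaf of $T$ lying outside $V(T')$.) The size of a trunk is its number of edges, and $c(T)$ denotes the minimum size of a trunk of $T$. -}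

module Defs where

open import Data.Nat using (ℕ; _≤_)
open import Data.Fin using (Fin)
open import Data.Fin.Properties using (any?; _≟_)
open import Data.Fin.Subset using (Subset; _∈_; _∉_; _⊆_; _-_; ∣_∣; ⋃)
open import Data.Fin.Subset.Properties using (_∈?_)
open import Data.Vec using (tabulate)
open import Data.List using (List; []; _∷_; _++_; length)
open import Data.List.Membership.Propositional using () renaming (_∈_ to _∈ˡ_)
open import Data.List.Relation.Unary.All using (All)
open import Data.List.Relation.Unary.Any using (Any)
open import Data.List.Relation.Unary.Unique.Propositional using (Unique)
open import Data.List.Relation.Binary.Permutation.Propositional using (_↭_)
open import Data.Product using (∃; ∃-syntax; ∃!; _×_)
open import Data.Empty using (⊥)
open import Function.Definitions using (Injective)
open import Relation.Nullary using (¬_; does)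
open import Relation.Nullary.Decidable using (_×-dec_)
open import Relation.Binary.PropositionalEquality using (_≡_)

-- An r-graph with vertex set Fin n.  The edge set is a duplicate-free list;
-- nothing below depends on the order in which the edges are listed.
record RGraph (r n : ℕ) : Set where
  field
    edges   : List (Subset n)
    unique  : Unique edges
    uniform : All (λ e → ∣ e ∣ ≡ r) edges

open RGraph public

size : ∀ {r n} → RGraph r n → ℕ
size G = length (edges G)

IsLeast : (ℕ → Set) → ℕ → Set
IsLeast P m = P m × (∀ k → P k → m ≤ k)

IsGreatest : (ℕ → Set) → ℕ → Set
IsGreatest P m = P m × (∀ k → P k → k ≤ m)

image : ∀ {k n} → (Fin k → Fin n) → Subset k → Subset n
image f p = tabulate λ j → does (any? λ i → (i ∈? p) ×-dec (f i ≟ j))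

Contains : ∀ {r n k} → RGraph r n → RGraph r k → Set
Contains {n = n} {k} G H =
  ∃[ f ] Injective {A = Fin k} {B = Fin n} _≡_ _≡_ f
       × All (λ e → image f e ∈ˡ edges G) (edges H)

-- IsTuránNumber r n H m says that m = ex_r(n, H).
IsTuránNumber : ∀ (r n : ℕ) {k} → RGraph r k → ℕ → Set
IsTuránNumber r n H =
  IsGreatest λ m → ∃ λ (G : RGraph r n) → size G ≡ m × ¬ Contains G H

-- The edge e may be added after the edges in ps.
Attaches : ∀ {n} → List (Subset n) → Subset n → Set
Attaches ps e =
  ∃[ v ] v ∈ e × All (λ p → v ∉ p) ps × Any (λ p → e - v ⊆ p) ps

-- ProperAfter ps es: every edge in the list es attaches to the edges formed by
-- ps together with the edges preceding it in es.  (ps grows at its head, so it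
-- lists the preceding edges latest first.)
data ProperAfter {n} (ps : List (Subset n)) : List (Subset n) → Set where
  []  : ProperAfter ps []
  _∷_ : ∀ {e es} → Attaches ps e → ProperAfter (e ∷ ps) es →
        ProperAfter ps (e ∷ es)

-- A tight tree has at least one edge, so the empty list is excluded.
Proper : ∀ {n} → List (Subset n) → Set
Proper []       = ⊥
Proper (e ∷ es) = ProperAfter (e ∷ []) es

-- The edges of G are those of a tight tree.  Isolated elements of Fin n are
-- permitted here, so that a subtree of a tree on Fin n is again an r-graph on
-- Fin n; the vertex set of the tight tree itself is then V G.
HasTightTreeEdges : ∀ {r n} → RGraph r n → Set
HasTightTreeEdges G = ∃[ es ] es ↭ edges G × Proper es

V : ∀ {r n} → RGraph r n → Subset n
V G = ⋃ (edges G)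

-- A tight tree whose vertex set is exactly Fin n.
IsTightTree : ∀ {r n} → RGraph r n → Set
IsTightTree T = HasTightTreeEdges T × (∀ v → v ∈ V T)

IsLeaf : ∀ {r n} → RGraph r n → Fin n → Set
IsLeaf T v = ∃! _≡_ λ e → e ∈ˡ edges T × v ∈ e

-- The lists es and fs together form the proper ordering of the edges of T, with
-- the edges of T′ coming first.
IsTrunk : ∀ {r n} → RGraph r n → RGraph r n → Set
IsTrunk T T′ =
    HasTightTreeEdges T′
  × (∃[ es ] ∃[ fs ] es ↭ edges T′ × (es ++ fs) ↭ edges T × Proper (es ++ fs))
  × (∀ v → v ∈ V T → v ∉ V T′ → IsLeaf T v)

-- IsMinTrunkSize T c says that c = c(T).
IsMinTrunkSize : ∀ {r n} → RGraph r n → ℕ → Set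
IsMinTrunkSize {r} {n} T =
  IsLeast λ c → ∃ λ (T′ : RGraph r n) → IsTrunk T T′ × size T′ ≡ c

{-# OPTIONS --safe #-}

-- Let m = t - 1.  The leaf edges of T hang on the five pairs of its two trunk edges
-- xya and xyb; l₀ of them hang on the central pair xy.  Give a pair of degree d the
-- weight 1/d and an edge the sum w of the weights of its pairs, so that the edges of
-- a 3-graph weigh altogether at most C(n,2).  If there are more than (m/3) C(n,2)
-- edges, some edges are light, w < 3/m, and then have pair degrees s ≤ a₁ ≤ a₂ with
-- s > m/3, a₁ > 2m/3, a₂ > m.
--
-- Every light edge hands its deficit 3/m - w to one of its pairs, every other edge a
-- third of its excess w - 3/m to each of its pairs.  Some pair xy receives more
-- deficit than excess; it contains a light edge A = xya and a second edge B = xyb that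
-- is light up to a small error.  Where the leaves are chosen greedily, role by role in
-- order of increasing degree, T is found on A and B, with xy as its centre.  The pair
-- to which a light edge hands its deficit is the one with the largest degree if l₀ is
-- large, and otherwise that with the smallest degree, unless the degrees are too small
-- by a rounding error; in that case the largest degree is quadratic in m, and B can be
-- found outside the neighbourhood of one of the pairs xa, ya.

module Submission where

-- The difficulty is cumulative: a pair served late needs room for its own leaves and for all leaves
-- chosen before. If the centre is the largest pair, each of the two trunk edges has one side with
-- about m/3 places and one with about 2m/3. The smaller sides must take the lighter half of the m -
-- 1 - l₀ side leaves, which fits when l₀ is at least about m/3. If l₀ is smaller, the smallest pair
-- is the better centre: about m/3 places suffice for its l₀ leaves if it is served early, and the
-- next pair then holds l₀ plus half of the rest, at most (m + l₀)/2, about 2m/3. Both strategies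
-- are tight near l₀ = m/3, so the remainder r in m = 3q + r matters, and so do the one or two
-- places that the trunk itself takes on each pair. A vertex b for which xab (or yab) is not an edge
-- saves the one missing place on two pairs. Speaking of the lighter half is legitimate because the
-- tree may be read with x and y, or a and b, exchanged.

-- Integer arithmetic: degree bounds from the weights of light and nearly light edges.

module Arithmetic where

  open import Data.Nat using (ℕ; suc; _+_; _*_; _≤_; _<_; z≤n; s≤s)
  open import Data.Nat.Properties hiding (_≟_)
  open import Data.Nat.Tactic.RingSolver using (solve)
  open import Data.List using ([]; _∷_)
  open import Data.Empty using (⊥)
  open import Data.Product using (_,_; ∃-syntax)
  open import Relation.Binary.PropositionalEquality using (_≡_; refl; sym)

  infixr 6 _⊕_
  infixr 7 _⊗_

  _⊕_ : ∀ {a b c d} → a ≤ b → c ≤ d → a + c ≤ b + d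
  _⊕_ = +-mono-≤

  _⊗_ : ∀ c {a b} → a ≤ b → a * c ≤ b * c
  c ⊗ h = *-monoˡ-≤ c h

  -- A linear inequality is refuted by a certificate: a combination of the
  -- hypotheses with nonnegative coefficients whose left side exceeds its right
  -- side, as the ring solver confirms.  Numerals are kept on the right of products,
  -- where they do not unfold.
  refute : ∀ {a b} c → a ≤ b → a ≡ suc b + c → ⊥
  refute {b = b} c a≤b refl = <-irrefl refl (≤-trans (s≤s (m≤m+n b c)) a≤b)

  eq≤ : ∀ {a b : ℕ} → a ≡ b → a ≤ b
  eq≤ = ≤-reflexive

  eq≥ : ∀ {a b : ℕ} → a ≡ b → b ≤ a
  eq≥ e = ≤-reflexive (sym e)

  -- The weight 1/d of a pair of degree d is represented by the number W with
  -- d * W ≡ K.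

  -- Among j weights with sum below `3 * K / m`, the least is below `3 * K / (j * m)`, so its degree
  -- exceeds `j * m / 3`. This lemma and the next two are the cases j = 1, 2, 3.
  light⇒smallest : ∀ m {K b W W′} → b * W ≡ K → m * (W + W′) < 3 * K → m < 3 * b
  light⇒smallest m {K} {b} {W} {W′} eb g = ≰⇒> λ (h : 3 * b ≤ m) →
    refute (W′ * m) (3 ⊗ (eq≥ eb) ⊕ g ⊕ W ⊗ h) (solve (m ∷ K ∷ b ∷ W ∷ W′ ∷ []))

  light⇒middle : ∀ m {K b₁ b₂ W₁ W₂} → b₁ * W₁ ≡ K → b₂ * W₂ ≡ K → b₁ ≤ b₂ →
    m * (W₁ + W₂) < 3 * K → 2 * m < 3 * b₂
  light⇒middle m {K} {b₁} {b₂} {W₁} {W₂} e₁ e₂ b₁≤b₂ g = ≰⇒> λ (h : 3 * b₂ ≤ 2 * m) →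
    refute 1 (3 ⊗ (eq≥ e₁) ⊕ 3 ⊗ (eq≥ e₂) ⊕ 2 ⊗ g ⊕ W₁ ⊗ h ⊕ W₂ ⊗ h ⊕ (W₁ * 3) ⊗ b₁≤b₂)
          (solve (m ∷ K ∷ b₁ ∷ b₂ ∷ W₁ ∷ W₂ ∷ []))

  light⇒largest : ∀ m {K s a b S A B} → s * S ≡ K → a * A ≡ K → b * B ≡ K → s ≤ b → a ≤ b →
    m * (B + (S + A)) < 3 * K → m < b
  light⇒largest m {K} {s} {a} {b} {S} {A} {B} es ea eb s≤b a≤b g = ≰⇒> λ (h : b ≤ m) →
    refute 0 ((eq≥ es) ⊕ (eq≥ ea) ⊕ (eq≥ eb) ⊕ g ⊕ S ⊗ h ⊕ A ⊗ h ⊕ B ⊗ h ⊕ S ⊗ s≤b ⊕ A ⊗ a≤b)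
          (solve (m ∷ K ∷ s ∷ a ∷ b ∷ S ∷ A ∷ B ∷ []))

  -- Charging (near-partner) gives e (w B - 3 K) < 3 (3 K - w A) for two edges A and B
  -- on a pair of degree e + 1 and weight D.  As w A ≥ m D, the weights W₁ and W₂ of
  -- the two other pairs of B then satisfy:
  NearlyLight : (m e K D W₁ W₂ : ℕ) → Set
  NearlyLight m e K D W₁ W₂ = m * ((e + 3) * D + e * (W₁ + W₂)) < 3 * (e + 3) * K

  -- Otherwise the two sides of B account for `3 * e * K` of the right-hand side, and what remains
  -- is `m * (e + 3) * D < 9 * K`, where `K` is `(e + 1) * D`; this is impossible for m ≥ 19.
  near⇒good : ∀ {m e K D W₁ W₂} → 19 ≤ m → (e + 1) * D ≡ K →
    NearlyLight m e K D W₁ W₂ → m * (W₁ + W₂) < 3 * K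
  near⇒good {m} {e} {K} {D} {W₁} {W₂} 19≤m eD near = ≰⇒> λ (h : 3 * K ≤ m * (W₁ + W₂)) →
    refute (D * e * m * 10 + D * m * 48 + 18) (171 ⊗ (eq≥ eD) ⊕ 19 ⊗ near ⊕ (e * 19) ⊗ h ⊕ (D * 9) ⊗ 19≤m ⊕ (D * e * 9) ⊗ 19≤m)
          (solve (m ∷ e ∷ K ∷ D ∷ W₁ ∷ W₂ ∷ []))

  -- The hypothesis on `g` bounds `W₁ + W₂` below by `g * K / (m * c)`. Multiplying `near` by
  -- `c * (e + 1)` and writing `K` for `(e + 1) * D` makes `K` a common factor; cancelling it leaves
  -- an inequality between polynomials in m and e.
  near-bound : ∀ {m e K D W₁ W₂} c g → 1 ≤ c → (e + 1) * D ≡ K → NearlyLight m e K D W₁ W₂ →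
    g * K ≤ m * c * (W₁ + W₂) →
    m * (e + 3) * c + g * e * (e + 1) < (e + 1) * (e + 3) * c * 3
  near-bound {m} {e} {K} {D} {W₁} {W₂} c g 1≤c eD near =
    core m e (e + 1) (e + 3) c K D (W₁ + W₂) g eD near (*-mono-≤ (m≤n+m 1 e) 1≤c)
    where
    core : ∀ m e x y c K D W g → x * D ≡ K → m * (y * D + e * W) < 3 * y * K → 1 ≤ x * c →
      g * K ≤ m * c * W → m * y * c + g * e * x < x * y * c * 3
    core m e x y c K D W g eD near x*c gK = ≰⇒> λ (h : x * y * c * 3 ≤ m * y * c + g * e * x) →
      refute 0 (x*c ⊕ K ⊗ h ⊕ (c * m * y) ⊗ (eq≥ eD) ⊕ (c * x) ⊗ near ⊕ (e * x) ⊗ gK)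
            (solve (m ∷ e ∷ x ∷ y ∷ c ∷ K ∷ D ∷ W ∷ g ∷ []))

  -- Writing m as u + 19 builds the lower bound into the coefficients: differences such as m - 3
  -- become `u + 16`, and certificates with nonnegative coefficients exist.
  +19-view : ∀ {m} → 19 ≤ m → ∃[ u ] u + 19 ≡ m
  +19-view 19≤m = _ , m∸n+n≡m 19≤m

  weights-middle : ∀ m K W₁ W₂ b₁ b₂ c g → g ≤ m * 3 + c → 3 * b₁ ≤ c → b₁ * W₁ ≡ K → b₂ * W₂ ≡ K → b₂ ≤ m →
    g * K ≤ m * c * (W₁ + W₂)
  weights-middle m K W₁ W₂ b₁ b₂ c g g≤ h e₁ e₂ b₂≤m = ≮⇒≥ λ (f : m * c * (W₁ + W₂) < g * K) →
    refute 0 (f ⊕ (W₁ * m) ⊗ h ⊕ (W₂ * c) ⊗ b₂≤m ⊕ (m * 3) ⊗ (eq≥ e₁) ⊕ c ⊗ (eq≥ e₂) ⊕ K ⊗ g≤)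
          (solve (m ∷ K ∷ W₁ ∷ W₂ ∷ b₁ ∷ b₂ ∷ c ∷ g ∷ []))

  poly-middle : ∀ u e → e < u + 19 →
    (e + 1) * (e + 3) * (u * 2 + 40) * 3 ≤ (u + 19) * (e + 3) * (u * 2 + 40) + (u * 5 + 97) * e * (e + 1)
  poly-middle u e e<m = ≮⇒≥ λ (h : (u + 19) * (e + 3) * (u * 2 + 40) + (u * 5 + 97) * e * (e + 1) < (e + 1) * (e + 3) * (u * 2 + 40) * 3) →
    refute (e * u * u + e * u * 18 + u * u * 6 + u * 179 + 1254) (h ⊕ 37 ⊗ e<m ⊕ (e * 23) ⊗ e<m ⊕ (e * u) ⊗ e<m)
          (solve (u ∷ e ∷ []))

  near⇒middle : ∀ {m e K D W₁ W₂ b₁ b₂} → 19 ≤ m → (e + 1) * D ≡ K → b₁ * W₁ ≡ K → b₂ * W₂ ≡ K →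
    NearlyLight m e K D W₁ W₂ → e < m → b₂ ≤ m → 2 * m + 2 < 3 * b₁
  near⇒middle {m} {e} {K} {D} {W₁} {W₂} {b₁} {b₂} 19≤m eD e₁ e₂ near e<m b₂≤m =
    go {m} {e} {K} {D} {W₁} {W₂} {b₁} {b₂} (+19-view 19≤m) eD e₁ e₂ near e<m b₂≤m
    where
    bound : ∀ u b₁ → 3 * b₁ ≤ 2 * (u + 19) + 2 → 3 * b₁ ≤ u * 2 + 40
    bound u b₁ h = ≮⇒≥ λ (g : u * 2 + 40 < 3 * b₁) → refute 0 (g ⊕ h) (solve (u ∷ b₁ ∷ []))
    sum : ∀ u → u * 5 + 97 ≤ (u + 19) * 3 + (u * 2 + 40)
    sum u = ≮⇒≥ λ (g : (u + 19) * 3 + (u * 2 + 40) < u * 5 + 97) → refute 0 (g) (solve (u ∷ []))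
    go : ∀ {m e K D W₁ W₂ b₁ b₂} → ∃[ u ] u + 19 ≡ m → (e + 1) * D ≡ K → b₁ * W₁ ≡ K → b₂ * W₂ ≡ K →
      NearlyLight m e K D W₁ W₂ → e < m → b₂ ≤ m → 2 * m + 2 < 3 * b₁
    -- Here c = `u * 2 + 40` is 2m + 2, and g = `u * 5 + 97` is 3m + c: from 3 b₁ ≤ c and b₂ ≤ m,
    -- the side weights are at least 3K/c + K/m = (3m + c)K/(mc).
    go {_} {e} {K} {D} {W₁} {W₂} {b₁} {b₂} (u , refl) eD e₁ e₂ near e<m b₂≤m = ≰⇒> λ (h : 3 * b₁ ≤ 2 * (u + 19) + 2) →
      <⇒≱ (near-bound {u + 19} {e} {K} {D} {W₁} {W₂} (u * 2 + 40) (u * 5 + 97) (≤-trans (s≤s z≤n) (m≤n+m 40 (u * 2)))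
             eD near (weights-middle (u + 19) K W₁ W₂ b₁ b₂ (u * 2 + 40) (u * 5 + 97) (sum u) (bound u b₁ h) e₁ e₂ b₂≤m))
          (poly-middle u e e<m)

  weights-large : ∀ m K W₁ W₂ b₁ b₂ c → b₂ ≤ c → b₁ ≤ b₂ → b₁ * W₁ ≡ K → b₂ * W₂ ≡ K → m * 2 * K ≤ m * c * (W₁ + W₂)
  weights-large m K W₁ W₂ b₁ b₂ c h b₁≤b₂ e₁ e₂ = ≮⇒≥ λ (g : m * c * (W₁ + W₂) < m * 2 * K) →
      refute 0 (g ⊕ (W₁ * m) ⊗ h ⊕ (W₂ * m) ⊗ h ⊕ (W₁ * m) ⊗ b₁≤b₂ ⊕ m ⊗ (eq≥ e₁) ⊕ m ⊗ (eq≥ e₂))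
            (solve (m ∷ K ∷ W₁ ∷ W₂ ∷ b₁ ∷ b₂ ∷ c ∷ []))

  poly-large : ∀ {u e} → e < u + 19 → (u + 19) * (e + 3) * (u + 16) + (u + 19) * 2 * e * (e + 1) < (e + 1) * (e + 3) * (u + 16) * 3 → ⊥
  poly-large {u} {e} e<m h =
      refute (u * 12 + 228) (h ⊕ 30 ⊗ e<m ⊕ (e * 10) ⊗ e<m ⊕ (u * 3) ⊗ e<m ⊕ (e * u) ⊗ e<m)
        (solve (u ∷ e ∷ []))

  near⇒large : ∀ {m e K D W₁ W₂ b₁ b₂} → 19 ≤ m → (e + 1) * D ≡ K → b₁ * W₁ ≡ K → b₂ * W₂ ≡ K →
    NearlyLight m e K D W₁ W₂ → e < m → b₁ ≤ b₂ → m ≤ b₂ + 2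
  near⇒large {m} {e} {K} {D} {W₁} {W₂} {b₁} {b₂} 19≤m eD e₁ e₂ near e<m b₁≤b₂ =
    go {m} {e} {K} {D} {W₁} {W₂} {b₁} {b₂} (+19-view 19≤m) eD e₁ e₂ near e<m b₁≤b₂
    where
    bound : ∀ u b₂ → b₂ + 2 < u + 19 → b₂ ≤ u + 16
    bound u b₂ h = ≮⇒≥ λ (g : u + 16 < b₂) → refute 0 (g ⊕ h) (solve (u ∷ b₂ ∷ []))
    go : ∀ {m e K D W₁ W₂ b₁ b₂} → ∃[ u ] u + 19 ≡ m → (e + 1) * D ≡ K → b₁ * W₁ ≡ K → b₂ * W₂ ≡ K →
      NearlyLight m e K D W₁ W₂ → e < m → b₁ ≤ b₂ → m ≤ b₂ + 2
    -- Here c = `u + 16` is m - 3: two sides of degree at most m - 3 weigh at least 2K/(m - 3),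
    -- whence g = 2m.
    go {_} {e} {K} {D} {W₁} {W₂} {b₁} {b₂} (u , refl) eD e₁ e₂ near e<m b₁≤b₂ = ≮⇒≥ λ (h : b₂ + 2 < u + 19) →
      poly-large {u} {e} e<m (near-bound {u + 19} {e} {K} {D} {W₁} {W₂} (u + 16) ((u + 19) * 2)
        (≤-trans (s≤s z≤n) (m≤n+m 16 u)) eD near (weights-large (u + 19) K W₁ W₂ b₁ b₂ (u + 16) (bound u b₂ h) b₁≤b₂ e₁ e₂))

  weights-small : ∀ m K W₁ W₂ b₁ c → 2 * b₁ ≤ c → b₁ * W₁ ≡ K → m * 2 * K ≤ m * c * (W₁ + W₂)
  weights-small m K W₁ W₂ b₁ c h e₁ = ≮⇒≥ λ (g : m * c * (W₁ + W₂) < m * 2 * K) →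
    refute (W₂ * c * m) (g ⊕ (W₁ * m) ⊗ h ⊕ (m * 2) ⊗ (eq≥ e₁))
          (solve (m ∷ K ∷ W₁ ∷ W₂ ∷ b₁ ∷ c ∷ []))

  poly-small : ∀ u e → 2 * (e + 1) ≤ u + 21 →
    (e + 1) * (e + 3) * (u + 21) * 3 ≤ (u + 19) * (e + 3) * (u + 21) + (u + 19) * 2 * e * (e + 1)
  poly-small u e e≤ = ≮⇒≥ λ (h : (u + 19) * (e + 3) * (u + 21) + (u + 19) * 2 * e * (e + 1) < (e + 1) * (e + 3) * (u + 21) * 3) →
    refute (e * u * u * 2 + e * u * 32 + u * u * 12 + u * 339 + 2040) (4 ⊗ h ⊕ 105 ⊗ e≤ ⊕ (e * 50) ⊗ e≤ ⊕ (e * u * 2) ⊗ e≤)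
          (solve (u ∷ e ∷ []))

  -- Two pairs of degree at most (m + 2)/2 weigh at least 4K/(m + 2) together, which exceeds 3K/m by
  -- more than the error in `NearlyLight` permits.
  near⇒¬small : ∀ {m e K D W₁ W₂ b₁} → 19 ≤ m → (e + 1) * D ≡ K → b₁ * W₁ ≡ K →
    NearlyLight m e K D W₁ W₂ → 2 * (e + 1) ≤ m + 2 → m + 2 < 2 * b₁
  near⇒¬small {m} {e} {K} {D} {W₁} {W₂} {b₁} 19≤m eD e₁ near e≤ =
    go {m} {e} {K} {D} {W₁} {W₂} {b₁} (+19-view 19≤m) eD e₁ near e≤
    where
    bound : ∀ u x → x ≤ u + 19 + 2 → x ≤ u + 21
    bound u x h = ≮⇒≥ λ (g : u + 21 < x) → refute 0 (g ⊕ h) (solve (u ∷ x ∷ []))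
    go : ∀ {m e K D W₁ W₂ b₁} → ∃[ u ] u + 19 ≡ m → (e + 1) * D ≡ K → b₁ * W₁ ≡ K →
      NearlyLight m e K D W₁ W₂ → 2 * (e + 1) ≤ m + 2 → m + 2 < 2 * b₁
    go {_} {e} {K} {D} {W₁} {W₂} {b₁} (u , refl) eD e₁ near e≤ = ≰⇒> λ (h : 2 * b₁ ≤ u + 19 + 2) →
      <⇒≱ (near-bound {u + 19} {e} {K} {D} {W₁} {W₂} (u + 21) ((u + 19) * 2) (≤-trans (s≤s z≤n) (m≤n+m 21 u))
             eD near (weights-small (u + 19) K W₁ W₂ b₁ (u + 21) (bound u (2 * b₁) h) e₁))
          (poly-small u e (bound u (2 * (e + 1)) e≤))

-- Greedy orders for the leaves, given the capacities of the five pairs.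

module Scheduling where

  open import Data.Nat using (ℕ; suc; _+_; _*_; _≤_; _<_)
  open import Data.Nat.Properties hiding (_≟_)
  open import Data.Nat.Tactic.RingSolver using (solve)
  open import Data.Fin using (Fin; zero; suc)
  open import Data.Fin.Properties using (all?; _≟_)
  open import Data.List using (List; []; _∷_; map)
  open import Data.List.Properties using (map-∘; map-cong)
  open import Data.List.Membership.Propositional using (_∈_)
  open import Data.List.Membership.Propositional.Properties using (∈-map⁺)
  open import Data.List.Membership.DecPropositional using () renaming (_∈?_ to member?)
  open import Data.Product using (_×_; _,_)
  open import Data.Sum using (_⊎_; inj₁; inj₂)
  open import Data.Unit using (⊤; tt)
  open import Data.Empty using (⊥)
  open import Relation.Nullary using (¬_; yes; no)
  open import Relation.Nullary.Decidable using (from-yes; Dec)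
  open import Relation.Binary.PropositionalEquality using (_≡_; refl; sym; trans; cong; cong₂; subst; subst₂)
  open Arithmetic

  pattern xy = zero
  pattern xa = suc zero
  pattern ya = suc (suc zero)
  pattern xb = suc (suc (suc zero))
  pattern yb = suc (suc (suc (suc zero)))

  -- The roles are listed in the order in which their leaves are chosen; c bounds the
  -- number of available vertices from below, u counts the vertices already used.
  Feasible : ℕ → List (ℕ × ℕ) → Set
  Feasible u []             = ⊤
  Feasible u ((c , l) ∷ ps) = u + l ≤ c × Feasible (u + l) ps

  Covers : List (Fin 5) → Set
  Covers os = ∀ i → i ∈ os

  covers? : ∀ os → Dec (Covers os)
  covers? os = all? λ i → member? _≟_ i os

  assign : (a₀ a₁ a₂ a₃ a₄ : ℕ) → Fin 5 → ℕ
  assign a₀ a₁ a₂ a₃ a₄ xy = a₀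
  assign a₀ a₁ a₂ a₃ a₄ xa = a₁
  assign a₀ a₁ a₂ a₃ a₄ ya = a₂
  assign a₀ a₁ a₂ a₃ a₄ xb = a₃
  assign a₀ a₁ a₂ a₃ a₄ yb = a₄

  Blocked : (Fin 5 → ℕ) → (Fin 5 → ℕ) → Set
  Blocked cs ls = ∀ os → Covers os → ¬ Feasible 0 (map (λ i → cs i , ls i) os)

  -- Blocked for each of the four ways of naming the two middle and the two outer
  -- trunk vertices of the tree.
  record Stuck (m c₀ c₁ c₂ c₃ c₄ l₀ l₁ l₂ l₃ l₄ : ℕ) : Set where
    constructor stuck
    field
      total   : m ≡ suc (l₀ + (l₁ + l₂ + (l₃ + l₄)))
      none    : Blocked (assign c₀ c₁ c₂ c₃ c₄) (assign l₀ l₁ l₂ l₃ l₄)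
      swapˣʸ  : Blocked (assign c₀ c₁ c₂ c₃ c₄) (assign l₀ l₂ l₁ l₄ l₃)
      swapᵃᵇ  : Blocked (assign c₀ c₁ c₂ c₃ c₄) (assign l₀ l₃ l₄ l₁ l₂)
      both    : Blocked (assign c₀ c₁ c₂ c₃ c₄) (assign l₀ l₄ l₃ l₂ l₁)

  module _ {m c₀ c₁ c₂ c₃ c₄ l₀ l₁ l₂ l₃ l₄ : ℕ} where

    flipˣʸ : Stuck m c₀ c₁ c₂ c₃ c₄ l₀ l₁ l₂ l₃ l₄ → Stuck m c₀ c₁ c₂ c₃ c₄ l₀ l₂ l₁ l₄ l₃
    flipˣʸ (stuck t n s₁ s₂ b) =
      stuck (trans t (cong suc (cong₂ _+_ {l₀} refl (cong₂ _+_ (+-comm l₁ l₂) (+-comm l₃ l₄))))) s₁ n b s₂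

    flipᵃᵇ : Stuck m c₀ c₁ c₂ c₃ c₄ l₀ l₁ l₂ l₃ l₄ → Stuck m c₀ c₁ c₂ c₃ c₄ l₀ l₃ l₄ l₁ l₂
    flipᵃᵇ (stuck t n s₁ s₂ b) =
      stuck (trans t (cong suc (cong₂ _+_ {l₀} refl (+-comm (l₁ + l₂) (l₃ + l₄))))) s₂ b n s₁

  relabel : ∀ cs cs′ ls ls′ (σ : Fin 5 → Fin 5) → (∀ i → σ (σ i) ≡ i) →
    (∀ i → cs (σ i) ≡ cs′ i) → (∀ i → ls (σ i) ≡ ls′ i) →
    Blocked cs ls → Blocked cs′ ls′
  relabel cs cs′ ls ls′ σ invol cs≡ ls≡ blocked os covers feasible =
    blocked (map σ os) (λ i → subst (_∈ map σ os) (invol i) (∈-map⁺ σ (covers (σ i))))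
      (subst (Feasible 0) (trans (map-cong (λ i → sym (cong₂ _,_ (cs≡ i) (ls≡ i))) os) (map-∘ os)) feasible)

  transposeᵇ : Fin 5 → Fin 5
  transposeᵇ xb = yb
  transposeᵇ yb = xb
  transposeᵇ i  = i

  -- Exchanges the names of the roles xb and yb, so that the smaller of the two
  -- capacities may be called c₃.
  mirror : ∀ {m c₀ c₁ c₂ c₃ c₄ l₀ l₁ l₂ l₃ l₄} →
    Stuck m c₀ c₁ c₂ c₃ c₄ l₀ l₁ l₂ l₃ l₄ → Stuck m c₀ c₁ c₂ c₄ c₃ l₀ l₁ l₂ l₄ l₃
  mirror {m} {c₀} {c₁} {c₂} {c₃} {c₄} {l₀} {l₁} {l₂} {l₃} {l₄} (stuck t n s₁ s₂ b) =
    stuck (trans t (cong suc (cong₂ _+_ {l₀} refl (cong₂ _+_ {l₁ + l₂} refl (+-comm l₃ l₄)))))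
      (re n) (re s₁) (re b) (re s₂)
    where
    re : ∀ {k₀ k₁ k₂ k₃ k₄} →
      Blocked (assign c₀ c₁ c₂ c₃ c₄) (assign k₀ k₁ k₂ k₃ k₄) →
      Blocked (assign c₀ c₁ c₂ c₄ c₃) (assign k₀ k₁ k₂ k₄ k₃)
    re {k₀} {k₁} {k₂} {k₃} {k₄} = relabel
      (assign c₀ c₁ c₂ c₃ c₄) (assign c₀ c₁ c₂ c₄ c₃)
      (assign k₀ k₁ k₂ k₃ k₄) (assign k₀ k₁ k₂ k₄ k₃) transposeᵇ
      (λ { xy → refl ; xa → refl ; ya → refl ; xb → refl ; yb → refl })
      (λ { xy → refl ; xa → refl ; ya → refl ; xb → refl ; yb → refl })
      (λ { xy → refl ; xa → refl ; ya → refl ; xb → refl ; yb → refl })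

  module _ {m c₀ c₁ c₂ c₃ c₄ l₀ : ℕ} where

    private
      S : ℕ → ℕ → ℕ → ℕ → Set
      S = Stuck m c₀ c₁ c₂ c₃ c₄ l₀

    -- Reading the tree with x and y exchanged swaps l₁ with l₂ and l₃ with l₄, so the lighter side
    -- may be sent to `xa` and `xb`, the roles with the smaller guaranteed capacities.
    wlog : (∀ l₁ l₂ l₃ l₄ → S l₁ l₂ l₃ l₄ → l₁ + l₃ ≤ l₂ + l₄ → ⊥) →
      ∀ {l₁ l₂ l₃ l₄} → S l₁ l₂ l₃ l₄ → ⊥
    wlog rule {l₁} {l₂} {l₃} {l₄} s with ≤-total (l₁ + l₃) (l₂ + l₄)
    ... | inj₁ w = rule _ _ _ _ s w
    ... | inj₂ w = rule _ _ _ _ (flipˣʸ s) w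

    -- Exchanging a and b preserves `l₁ + l₃ ≤ l₂ + l₄`, which leaves one further comparison free:
    -- here between the first pair of roles, in `wlog₂₄` between the second.
    wlog₁₃ : (∀ l₁ l₂ l₃ l₄ → S l₁ l₂ l₃ l₄ → l₁ + l₃ ≤ l₂ + l₄ → l₃ ≤ l₁ → ⊥) →
      ∀ {l₁ l₂ l₃ l₄} → S l₁ l₂ l₃ l₄ → ⊥
    wlog₁₃ rule = wlog λ l₁ l₂ l₃ l₄ s w → case s w (≤-total l₃ l₁)
      where
      case : ∀ {l₁ l₂ l₃ l₄} → S l₁ l₂ l₃ l₄ → l₁ + l₃ ≤ l₂ + l₄ → l₃ ≤ l₁ ⊎ l₁ ≤ l₃ → ⊥
      case s w (inj₁ v) = rule _ _ _ _ s w v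
      case {l₁} {l₂} {l₃} {l₄} s w (inj₂ v) =
        rule _ _ _ _ (flipᵃᵇ s) (subst₂ _≤_ (+-comm l₁ l₃) (+-comm l₂ l₄) w) v

    wlog₂₄ : (∀ l₁ l₂ l₃ l₄ → S l₁ l₂ l₃ l₄ → l₁ + l₃ ≤ l₂ + l₄ → l₄ ≤ l₂ → ⊥) →
      ∀ {l₁ l₂ l₃ l₄} → S l₁ l₂ l₃ l₄ → ⊥
    wlog₂₄ rule = wlog λ l₁ l₂ l₃ l₄ s w → case s w (≤-total l₄ l₂)
      where
      case : ∀ {l₁ l₂ l₃ l₄} → S l₁ l₂ l₃ l₄ → l₁ + l₃ ≤ l₂ + l₄ → l₄ ≤ l₂ ⊎ l₂ ≤ l₄ → ⊥
      case s w (inj₁ v) = rule _ _ _ _ s w v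
      case {l₁} {l₂} {l₃} {l₄} s w (inj₂ v) =
        rule _ _ _ _ (flipᵃᵇ s) (subst₂ _≤_ (+-comm l₁ l₃) (+-comm l₂ l₄) w) v

    -- The exchange of a and b comes first here, to put the fewer leaves at b; the exchange of x and
    -- y preserves this.
    wlog₃₄ : (∀ l₁ l₂ l₃ l₄ → S l₁ l₂ l₃ l₄ → l₃ + l₄ ≤ l₁ + l₂ → l₃ ≤ l₄ → ⊥) →
      ∀ {l₁ l₂ l₃ l₄} → S l₁ l₂ l₃ l₄ → ⊥
    wlog₃₄ rule {l₁} {l₂} {l₃} {l₄} s = case₁ s (≤-total (l₃ + l₄) (l₁ + l₂))
      where
      case₂ : ∀ {l₁ l₂ l₃ l₄} → S l₁ l₂ l₃ l₄ → l₃ + l₄ ≤ l₁ + l₂ → l₃ ≤ l₄ ⊎ l₄ ≤ l₃ → ⊥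
      case₂ s w (inj₁ v) = rule _ _ _ _ s w v
      case₂ {l₁} {l₂} {l₃} {l₄} s w (inj₂ v) =
        rule _ _ _ _ (flipˣʸ s) (subst₂ _≤_ (+-comm l₃ l₄) (+-comm l₁ l₂) w) v
      case₁ : ∀ {l₁ l₂ l₃ l₄} → S l₁ l₂ l₃ l₄ → l₃ + l₄ ≤ l₁ + l₂ ⊎ l₁ + l₂ ≤ l₃ + l₄ → ⊥
      case₁ {l₁} {l₂} {l₃} {l₄} s (inj₁ w) = case₂ s w (≤-total l₃ l₄)
      case₁ {l₁} {l₂} {l₃} {l₄} s (inj₂ w) = case₂ (flipᵃᵇ s) w (≤-total l₁ l₂)

  -- Smaller capacities come first: the two roles with the lighter load, then the other sides, and
  -- last the centre, which has room for all leaves.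
  side-order : List (Fin 5)
  side-order = xb ∷ xa ∷ yb ∷ ya ∷ xy ∷ []

  -- The sides carry at most 2q - 1 leaves. Their lighter half is at most q - 1, just what the small
  -- pairs are sure to hold, and all of them fit on the larger ones.
  large-centre : ∀ {m q r c₀ c₁ c₂ c₃ c₄ l₀ l₁ l₂ l₃ l₄} → m ≡ r + q * 3 → q + r ≤ l₀ →
    m ≤ c₀ + 1 → q ≤ c₁ + 1 → 2 * q ≤ c₂ + 1 → q ≤ c₃ + 1 → 2 * q ≤ c₄ + 1 →
    ¬ Stuck m c₀ c₁ c₂ c₃ c₄ l₀ l₁ l₂ l₃ l₄
  large-centre {m} {q} {r} {c₀} {c₁} {c₂} {c₃} {c₄} {l₀} m≡ l₀≥ c₀≥ c₁≥ c₂≥ c₃≥ c₄≥ =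
    wlog case
    where
    case : ∀ l₁ l₂ l₃ l₄ → Stuck m c₀ c₁ c₂ c₃ c₄ l₀ l₁ l₂ l₃ l₄ → l₁ + l₃ ≤ l₂ + l₄ → ⊥
    case l₁ l₂ l₃ l₄ (stuck t none _ _ _) w = none side-order (from-yes (covers? side-order))
      ( (≮⇒≥ λ (h : c₃ < l₃) → refute (l₁ * 2) (2 ⊗ h ⊕ (eq≥ t) ⊕ (eq≤ m≡) ⊕ l₀≥ ⊕ 2 ⊗ c₃≥ ⊕ w)
            (solve (m ∷ q ∷ r ∷ c₃ ∷ l₀ ∷ l₁ ∷ l₂ ∷ l₃ ∷ l₄ ∷ [])))
      , (≮⇒≥ λ (h : c₁ < l₃ + l₁) → refute 0 (2 ⊗ h ⊕ (eq≥ t) ⊕ (eq≤ m≡) ⊕ l₀≥ ⊕ 2 ⊗ c₁≥ ⊕ w)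
            (solve (m ∷ q ∷ r ∷ c₁ ∷ l₀ ∷ l₁ ∷ l₂ ∷ l₃ ∷ l₄ ∷ [])))
      , (≮⇒≥ λ (h : c₄ < l₃ + l₁ + l₄) → refute l₂ (h ⊕ (eq≥ t) ⊕ (eq≤ m≡) ⊕ l₀≥ ⊕ c₄≥)
            (solve (m ∷ q ∷ r ∷ c₄ ∷ l₀ ∷ l₁ ∷ l₂ ∷ l₃ ∷ l₄ ∷ [])))
      , (≮⇒≥ λ (h : c₂ < l₃ + l₁ + l₄ + l₂) → refute 0 (h ⊕ (eq≥ t) ⊕ (eq≤ m≡) ⊕ l₀≥ ⊕ c₂≥)
            (solve (m ∷ q ∷ r ∷ c₂ ∷ l₀ ∷ l₁ ∷ l₂ ∷ l₃ ∷ l₄ ∷ [])))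
      , (≮⇒≥ λ (h : c₀ < l₃ + l₁ + l₄ + l₂ + l₀) → refute 0 (h ⊕ (eq≥ t) ⊕ c₀≥)
            (solve (m ∷ c₀ ∷ l₀ ∷ l₁ ∷ l₂ ∷ l₃ ∷ l₄ ∷ [])))
      , tt )

  -- With l₀ = q the sides may carry 2q + r - 1 leaves and their lighter half q, while `xb` is sure
  -- of q - 1 places only. Since l₃ ≤ l₁, `xb` itself needs at most q/2.
  half-centre₁₃ : ∀ {m q r c₀ c₁ c₂ c₃ c₄ l₀ l₁ l₂ l₃ l₄} → m ≡ r + q * 3 → r ≤ 2 → 6 ≤ q → q ≤ l₀ →
    m ≤ c₀ + 1 → q ≤ c₁ → 2 * q + r ≤ c₂ + 1 → q ≤ c₃ + 1 → 2 * q + r ≤ c₄ + 1 →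
    ¬ Stuck m c₀ c₁ c₂ c₃ c₄ l₀ l₁ l₂ l₃ l₄
  half-centre₁₃ {m} {q} {r} {c₀} {c₁} {c₂} {c₃} {c₄} {l₀} m≡ r≤2 q≥6 l₀≥ c₀≥ c₁≥ c₂≥ c₃≥ c₄≥ =
    wlog₁₃ case
    where
    case : ∀ l₁ l₂ l₃ l₄ → Stuck m c₀ c₁ c₂ c₃ c₄ l₀ l₁ l₂ l₃ l₄ → l₁ + l₃ ≤ l₂ + l₄ → l₃ ≤ l₁ → ⊥
    case l₁ l₂ l₃ l₄ (stuck t none _ _ _) w v = none side-order (from-yes (covers? side-order))
      ( (≮⇒≥ λ (h : c₃ < l₃) →
          refute 10 (4 ⊗ h ⊕ (eq≥ t) ⊕ (eq≤ m≡) ⊕ r≤2 ⊕ 2 ⊗ q≥6 ⊕ l₀≥ ⊕ 4 ⊗ c₃≥ ⊕ w ⊕ 2 ⊗ v)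
            (solve (m ∷ q ∷ r ∷ c₃ ∷ l₀ ∷ l₁ ∷ l₂ ∷ l₃ ∷ l₄ ∷ [])))
      , (≮⇒≥ λ (h : c₁ < l₃ + l₁) → refute 0 (2 ⊗ h ⊕ (eq≥ t) ⊕ (eq≤ m≡) ⊕ r≤2 ⊕ l₀≥ ⊕ 2 ⊗ c₁≥ ⊕ w)
            (solve (m ∷ q ∷ r ∷ c₁ ∷ l₀ ∷ l₁ ∷ l₂ ∷ l₃ ∷ l₄ ∷ [])))
      , (≮⇒≥ λ (h : c₄ < l₃ + l₁ + l₄) → refute l₂ (h ⊕ (eq≥ t) ⊕ (eq≤ m≡) ⊕ l₀≥ ⊕ c₄≥)
            (solve (m ∷ q ∷ r ∷ c₄ ∷ l₀ ∷ l₁ ∷ l₂ ∷ l₃ ∷ l₄ ∷ [])))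
      , (≮⇒≥ λ (h : c₂ < l₃ + l₁ + l₄ + l₂) → refute 0 (h ⊕ (eq≥ t) ⊕ (eq≤ m≡) ⊕ l₀≥ ⊕ c₂≥)
            (solve (m ∷ q ∷ r ∷ c₂ ∷ l₀ ∷ l₁ ∷ l₂ ∷ l₃ ∷ l₄ ∷ [])))
      , (≮⇒≥ λ (h : c₀ < l₃ + l₁ + l₄ + l₂ + l₀) → refute 0 (h ⊕ (eq≥ t) ⊕ c₀≥)
            (solve (m ∷ c₀ ∷ l₀ ∷ l₁ ∷ l₂ ∷ l₃ ∷ l₄ ∷ [])))
      , tt )

  -- Here the pair that may lack a place is `yb`. Since l₄ ≤ l₂, the role `ya`, served after it,
  -- takes at least a quarter of the side leaves, and these need no room on `yb`.
  half-centre₂₄ : ∀ {m q r c₀ c₁ c₂ c₃ c₄ l₀ l₁ l₂ l₃ l₄} → m ≡ r + q * 3 → r ≤ 2 → 6 ≤ q → q ≤ l₀ →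
    m ≤ c₀ + 1 → q ≤ c₁ → 2 * q + r ≤ c₂ + 1 → q ≤ c₃ → 2 * q + r ≤ c₄ + 2 →
    ¬ Stuck m c₀ c₁ c₂ c₃ c₄ l₀ l₁ l₂ l₃ l₄
  half-centre₂₄ {m} {q} {r} {c₀} {c₁} {c₂} {c₃} {c₄} {l₀} m≡ r≤2 q≥6 l₀≥ c₀≥ c₁≥ c₂≥ c₃≥ c₄≥ =
    wlog₂₄ case
    where
    case : ∀ l₁ l₂ l₃ l₄ → Stuck m c₀ c₁ c₂ c₃ c₄ l₀ l₁ l₂ l₃ l₄ → l₁ + l₃ ≤ l₂ + l₄ → l₄ ≤ l₂ → ⊥
    case l₁ l₂ l₃ l₄ (stuck t none _ _ _) w v = none side-order (from-yes (covers? side-order))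
      ( (≮⇒≥ λ (h : c₃ < l₃) →
          refute (l₁ * 2) (2 ⊗ h ⊕ (eq≥ t) ⊕ (eq≤ m≡) ⊕ r≤2 ⊕ l₀≥ ⊕ 2 ⊗ c₃≥ ⊕ w)
            (solve (m ∷ q ∷ r ∷ c₃ ∷ l₀ ∷ l₁ ∷ l₂ ∷ l₃ ∷ l₄ ∷ [])))
      , (≮⇒≥ λ (h : c₁ < l₃ + l₁) → refute 0 (2 ⊗ h ⊕ (eq≥ t) ⊕ (eq≤ m≡) ⊕ r≤2 ⊕ l₀≥ ⊕ 2 ⊗ c₁≥ ⊕ w)
            (solve (m ∷ q ∷ r ∷ c₁ ∷ l₀ ∷ l₁ ∷ l₂ ∷ l₃ ∷ l₄ ∷ [])))
      , (≮⇒≥ λ (h : c₄ < l₃ + l₁ + l₄) →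
          refute (r + 10) (4 ⊗ h ⊕ 3 ⊗ (eq≥ t) ⊕ 3 ⊗ (eq≤ m≡) ⊕ 2 ⊗ q≥6 ⊕ 3 ⊗ l₀≥ ⊕ 4 ⊗ c₄≥ ⊕ w ⊕ 2 ⊗ v)
            (solve (m ∷ q ∷ r ∷ c₄ ∷ l₀ ∷ l₁ ∷ l₂ ∷ l₃ ∷ l₄ ∷ [])))
      , (≮⇒≥ λ (h : c₂ < l₃ + l₁ + l₄ + l₂) → refute 0 (h ⊕ (eq≥ t) ⊕ (eq≤ m≡) ⊕ l₀≥ ⊕ c₂≥)
            (solve (m ∷ q ∷ r ∷ c₂ ∷ l₀ ∷ l₁ ∷ l₂ ∷ l₃ ∷ l₄ ∷ [])))
      , (≮⇒≥ λ (h : c₀ < l₃ + l₁ + l₄ + l₂ + l₀) → refute 0 (h ⊕ (eq≥ t) ⊕ c₀≥)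
            (solve (m ∷ c₀ ∷ l₀ ∷ l₁ ∷ l₂ ∷ l₃ ∷ l₄ ∷ [])))
      , tt )

  -- Only the pairs at b may be short of room, so they come first: they take at most half of the
  -- leaves, and `xb` at most a quarter, against about 2m/3 and m/3 places.
  small-centre₀ : ∀ {m c₀ c₁ c₂ c₃ c₄ b₁ b₂ l₀ l₁ l₂ l₃ l₄} → 19 ≤ m →
    m ≤ c₀ + 1 → m ≤ c₁ + 1 → m ≤ c₂ + 1 → b₁ ≤ c₃ + 2 → b₂ ≤ c₄ + 2 → m < 3 * b₁ → 2 * m < 3 * b₂ →
    ¬ Stuck m c₀ c₁ c₂ c₃ c₄ l₀ l₁ l₂ l₃ l₄
  small-centre₀ {m} {c₀} {c₁} {c₂} {c₃} {c₄} {b₁} {b₂} {l₀} 19≤m c₀≥ c₁≥ c₂≥ b₁≤ b₂≤ m<b₁ m<b₂ =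
    wlog₃₄ case
    where
    case : ∀ l₁ l₂ l₃ l₄ → Stuck m c₀ c₁ c₂ c₃ c₄ l₀ l₁ l₂ l₃ l₄ → l₃ + l₄ ≤ l₁ + l₂ → l₃ ≤ l₄ → ⊥
    case l₁ l₂ l₃ l₄ (stuck t none _ _ _) w v = let os = xb ∷ yb ∷ xy ∷ xa ∷ ya ∷ [] in none os (from-yes (covers? os))
      ( (≮⇒≥ λ (h : c₃ < l₃) →
          refute (l₀ * 3 + 13) (12 ⊗ h ⊕ 3 ⊗ (eq≥ t) ⊕ 19≤m ⊕ 4 ⊗ m<b₁ ⊕ 12 ⊗ b₁≤ ⊕ 3 ⊗ w ⊕ 6 ⊗ v)
            (solve (m ∷ c₃ ∷ b₁ ∷ l₀ ∷ l₁ ∷ l₂ ∷ l₃ ∷ l₄ ∷ [])))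
      , (≮⇒≥ λ (h : c₄ < l₃ + l₄) →
          refute (l₀ * 3 + 17) (6 ⊗ h ⊕ 3 ⊗ (eq≥ t) ⊕ 19≤m ⊕ 2 ⊗ m<b₂ ⊕ 6 ⊗ b₂≤ ⊕ 3 ⊗ w)
            (solve (m ∷ c₄ ∷ b₂ ∷ l₀ ∷ l₁ ∷ l₂ ∷ l₃ ∷ l₄ ∷ [])))
      , (≮⇒≥ λ (h : c₀ < l₃ + l₄ + l₀) → refute (l₁ + l₂) (h ⊕ (eq≥ t) ⊕ c₀≥)
            (solve (m ∷ c₀ ∷ l₀ ∷ l₁ ∷ l₂ ∷ l₃ ∷ l₄ ∷ [])))
      , (≮⇒≥ λ (h : c₁ < l₃ + l₄ + l₀ + l₁) → refute l₂ (h ⊕ (eq≥ t) ⊕ c₁≥)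
            (solve (m ∷ c₁ ∷ l₀ ∷ l₁ ∷ l₂ ∷ l₃ ∷ l₄ ∷ [])))
      , (≮⇒≥ λ (h : c₂ < l₃ + l₄ + l₀ + l₁ + l₂) → refute 0 (h ⊕ (eq≥ t) ⊕ c₂≥)
            (solve (m ∷ c₂ ∷ l₀ ∷ l₁ ∷ l₂ ∷ l₃ ∷ l₄ ∷ [])))
      , tt )

  -- If `xy` does not fit after `xb`, then c₀ < l₀ + l₃. As l₃ is at most a quarter of the side
  -- leaves, l₀ + l₃ ≤ m/2, so the centre has degree at most m/2 + 1; `¬small` then gives `xb` a
  -- larger degree, and it can be served after `xy`.
  small-centre₁ : ∀ {m q r c₀ c₁ c₂ c₃ c₄ b₁ d l₀ l₁ l₂ l₃ l₄} → 19 ≤ m → m ≡ r + q * 3 → r ≤ 2 → l₀ < q + r →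
    l₀ ≤ c₀ → m + l₀ ≤ c₁ * 2 + 2 → m ≤ c₂ + 1 → m ≤ c₄ + 1 → d ≤ c₀ + 2 → b₁ ≤ c₃ + 2 → m < 3 * b₁ →
    (2 * d ≤ m + 2 → m + 2 < 2 * b₁) →
    ¬ Stuck m c₀ c₁ c₂ c₃ c₄ l₀ l₁ l₂ l₃ l₄
  small-centre₁ {m} {q} {r} {c₀} {c₁} {c₂} {c₃} {c₄} {b₁} {d} {l₀} 19≤m m≡ r≤2 l₀< l₀≤ c₁≥ c₂≥ c₄≥ d≤ b₁≤ m<b₁ ¬small =
    wlog₁₃ case
    where
    case : ∀ l₁ l₂ l₃ l₄ → Stuck m c₀ c₁ c₂ c₃ c₄ l₀ l₁ l₂ l₃ l₄ → l₁ + l₃ ≤ l₂ + l₄ → l₃ ≤ l₁ → ⊥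
    case l₁ l₂ l₃ l₄ (stuck t none _ _ _) w v with l₀ + l₃ ≤? c₀
    ... | yes g = none os (from-yes (covers? os))
      ( (≮⇒≥ λ (h : c₃ < l₃) →
          refute (l₀ * 3 + 13) (12 ⊗ h ⊕ 3 ⊗ (eq≥ t) ⊕ 19≤m ⊕ 4 ⊗ m<b₁ ⊕ 12 ⊗ b₁≤ ⊕ 3 ⊗ w ⊕ 6 ⊗ v)
            (solve (m ∷ c₃ ∷ b₁ ∷ l₀ ∷ l₁ ∷ l₂ ∷ l₃ ∷ l₄ ∷ [])))
      , subst (_≤ c₀) (+-comm l₀ l₃) g
      , (≮⇒≥ λ (h : c₁ < l₃ + l₀ + l₁) → refute 0 (2 ⊗ h ⊕ (eq≥ t) ⊕ c₁≥ ⊕ w)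
            (solve (m ∷ c₁ ∷ l₀ ∷ l₁ ∷ l₂ ∷ l₃ ∷ l₄ ∷ [])))
      , (≮⇒≥ λ (h : c₄ < l₃ + l₀ + l₁ + l₄) → refute l₂ (h ⊕ (eq≥ t) ⊕ c₄≥)
            (solve (m ∷ c₄ ∷ l₀ ∷ l₁ ∷ l₂ ∷ l₃ ∷ l₄ ∷ [])))
      , (≮⇒≥ λ (h : c₂ < l₃ + l₀ + l₁ + l₄ + l₂) → refute 0 (h ⊕ (eq≥ t) ⊕ c₂≥)
            (solve (m ∷ c₂ ∷ l₀ ∷ l₁ ∷ l₂ ∷ l₃ ∷ l₄ ∷ [])))
      , tt )
      where os = xb ∷ xy ∷ xa ∷ yb ∷ ya ∷ []
    ... | no ¬g = none os (from-yes (covers? os))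
      ( l₀≤
      , (≮⇒≥ λ (h : c₃ < l₀ + l₃) →
          refute 1 (4 ⊗ h ⊕ (eq≥ t) ⊕ (eq≥ m≡) ⊕ 2 ⊗ r≤2 ⊕ 3 ⊗ l₀< ⊕ 2 ⊗ b₁> ⊕ 4 ⊗ b₁≤ ⊕ w ⊕ 2 ⊗ v)
            (solve (m ∷ q ∷ r ∷ c₃ ∷ b₁ ∷ l₀ ∷ l₁ ∷ l₂ ∷ l₃ ∷ l₄ ∷ [])))
      , (≮⇒≥ λ (h : c₁ < l₀ + l₃ + l₁) → refute 0 (2 ⊗ h ⊕ (eq≥ t) ⊕ c₁≥ ⊕ w)
            (solve (m ∷ c₁ ∷ l₀ ∷ l₁ ∷ l₂ ∷ l₃ ∷ l₄ ∷ [])))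
      , (≮⇒≥ λ (h : c₄ < l₀ + l₃ + l₁ + l₄) → refute l₂ (h ⊕ (eq≥ t) ⊕ c₄≥)
            (solve (m ∷ c₄ ∷ l₀ ∷ l₁ ∷ l₂ ∷ l₃ ∷ l₄ ∷ [])))
      , (≮⇒≥ λ (h : c₂ < l₀ + l₃ + l₁ + l₄ + l₂) → refute 0 (h ⊕ (eq≥ t) ⊕ c₂≥)
            (solve (m ∷ c₂ ∷ l₀ ∷ l₁ ∷ l₂ ∷ l₃ ∷ l₄ ∷ [])))
      , tt )
      where
      os = xy ∷ xb ∷ xa ∷ yb ∷ ya ∷ []
      g : c₀ < l₀ + l₃
      g = ≰⇒> ¬g
      b₁> : m + 2 < 2 * b₁
      b₁> = ¬small (≮⇒≥ λ (h : m + 2 < 2 * d) →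
          refute 1 (2 ⊗ h ⊕ (eq≥ t) ⊕ (eq≥ m≡) ⊕ 2 ⊗ r≤2 ⊕ 3 ⊗ l₀< ⊕ 4 ⊗ g ⊕ 4 ⊗ d≤ ⊕ w ⊕ 2 ⊗ v)
            (solve (m ∷ q ∷ r ∷ c₀ ∷ d ∷ l₀ ∷ l₁ ∷ l₂ ∷ l₃ ∷ l₄ ∷ [])))

  -- `yb` is sure of m - 4 places only, against m - 1 leaves; as `ya` comes last, it suffices that
  -- `ya` takes three of them.
  small-centre₂ : ∀ {m q r c₀ c₁ c₂ c₃ c₄ b₁ b₂ l₀ l₁ l₂ l₃ l₄} → 19 ≤ m → m ≡ r + q * 3 → r ≤ 2 → l₀ < q + r →
    l₀ ≤ c₀ → m + l₀ ≤ c₁ * 2 + 2 → m ≤ c₂ + 1 → b₁ ≤ c₃ + 2 → b₂ ≤ c₄ + 2 → 2 * m + 2 < 3 * b₁ → m ≤ b₂ + 2 →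
    ¬ Stuck m c₀ c₁ c₂ c₃ c₄ l₀ l₁ l₂ l₃ l₄
  small-centre₂ {m} {q} {r} {c₀} {c₁} {c₂} {c₃} {c₄} {b₁} {b₂} {l₀} 19≤m m≡ r≤2 l₀< l₀≤ c₁≥ c₂≥ b₁≤ b₂≤ b₁≥ b₂≥ =
    wlog₂₄ case
    where
    case : ∀ l₁ l₂ l₃ l₄ → Stuck m c₀ c₁ c₂ c₃ c₄ l₀ l₁ l₂ l₃ l₄ → l₁ + l₃ ≤ l₂ + l₄ → l₄ ≤ l₂ → ⊥
    case l₁ l₂ l₃ l₄ (stuck t none _ _ _) w v = none os (from-yes (covers? os))
      ( l₀≤
      , (≮⇒≥ λ (h : c₁ < l₀ + l₁) → refute (l₃ * 2) (2 ⊗ h ⊕ (eq≥ t) ⊕ c₁≥ ⊕ w)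
            (solve (m ∷ c₁ ∷ l₀ ∷ l₁ ∷ l₂ ∷ l₃ ∷ l₄ ∷ [])))
      , (≮⇒≥ λ (h : c₃ < l₀ + l₁ + l₃) →
          refute 1 (6 ⊗ h ⊕ 3 ⊗ (eq≥ t) ⊕ (eq≥ m≡) ⊕ 2 ⊗ r≤2 ⊕ 3 ⊗ l₀< ⊕ 2 ⊗ b₁≥ ⊕ 6 ⊗ b₁≤ ⊕ 3 ⊗ w)
            (solve (m ∷ q ∷ r ∷ c₃ ∷ b₁ ∷ l₀ ∷ l₁ ∷ l₂ ∷ l₃ ∷ l₄ ∷ [])))
      , (≮⇒≥ λ (h : c₄ < l₀ + l₁ + l₃ + l₄) → refute 0 (h ⊕ (eq≥ t) ⊕ b₂≥ ⊕ l₂≥3 ⊕ b₂≤)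
            (solve (m ∷ c₄ ∷ b₂ ∷ l₀ ∷ l₁ ∷ l₂ ∷ l₃ ∷ l₄ ∷ [])))
      , (≮⇒≥ λ (h : c₂ < l₀ + l₁ + l₃ + l₄ + l₂) → refute 0 (h ⊕ (eq≥ t) ⊕ c₂≥)
            (solve (m ∷ c₂ ∷ l₀ ∷ l₁ ∷ l₂ ∷ l₃ ∷ l₄ ∷ [])))
      , tt )
      where
      os = xy ∷ xa ∷ xb ∷ yb ∷ ya ∷ []
      -- l₂ is at least a quarter of the m - 1 - l₀ side leaves; as 3 l₀ ≤ m + 1, this is at least
      -- (m - 2)/6, which exceeds 2.
      l₂≥3 : 3 ≤ l₂
      l₂≥3 = (≮⇒≥ λ (h : l₂ < 3) →
          refute 9 (12 ⊗ h ⊕ 3 ⊗ (eq≤ t) ⊕ 2 ⊗ 19≤m ⊕ (eq≥ m≡) ⊕ 2 ⊗ r≤2 ⊕ 3 ⊗ l₀< ⊕ 3 ⊗ w ⊕ 6 ⊗ v)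
            (solve (m ∷ q ∷ r ∷ l₀ ∷ l₁ ∷ l₂ ∷ l₃ ∷ l₄ ∷ [])))

-- From pair degrees to capacities.

module PairDegrees where

  open import Data.Nat using (_+_; _*_; _∸_; _≤_; _<_; _≤?_)
  open import Data.Nat.Properties hiding (_≟_)
  open import Data.Nat.Tactic.RingSolver using (solve)
  open import Data.List using ([]; _∷_)
  open import Data.Empty using (⊥)
  open import Relation.Nullary using (¬_; yes; no)
  open import Relation.Binary.PropositionalEquality using (_≡_; subst)
  open Arithmetic
  open Scheduling

  weight-antitone : ∀ {K s a S A} → 0 < K → s * S ≡ K → a * A ≡ K → s ≤ a → A ≤ S
  weight-antitone {K} {s} {a} {S} {A} K>0 es ea s≤a = ≮⇒≥ λ (h : S < A) →
    let a>0 : 0 < a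
        a>0 = ≰⇒> λ (g : a ≤ 0) → refute 0 ((eq≥ ea) ⊕ K>0 ⊕ A ⊗ g) (solve (K ∷ a ∷ A ∷ []))
    in refute 0 (a>0 ⊕ (eq≥ es) ⊕ (eq≤ ea) ⊕ a ⊗ h ⊕ S ⊗ s≤a) (solve (K ∷ s ∷ a ∷ S ∷ A ∷ []))

  -- With m = 3q + r, `m < 3 * d` means d ≥ q + 1. The slack 2 in `d ≤ c + 2` stands for the trunk
  -- vertices that may occupy places on the pair; the slack 1 in the next lemma is the case where
  -- only one of them does.
  smallest⇒q : ∀ m q r d c → m ≡ r + q * 3 → m < 3 * d → d ≤ c + 2 → q ≤ c + 1
  smallest⇒q m q r d c m≡ m<d d≤ = (≮⇒≥ λ (h : c + 1 < q) →
      refute r (3 ⊗ h ⊕ (eq≥ m≡) ⊕ m<d ⊕ 3 ⊗ d≤)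
        (solve (m ∷ q ∷ r ∷ d ∷ c ∷ [])))

  smallest⇒q′ : ∀ m q r d c → m ≡ r + q * 3 → m < 3 * d → d ≤ c + 1 → q ≤ c
  smallest⇒q′ m q r d c m≡ m<d d≤ = (≮⇒≥ λ (h : c < q) → refute r (3 ⊗ h ⊕ (eq≥ m≡) ⊕ m<d ⊕ 3 ⊗ d≤)
        (solve (m ∷ q ∷ r ∷ d ∷ c ∷ [])))

  middle⇒2q : ∀ m q r d c → m ≡ r + q * 3 → 2 * m < 3 * d → d ≤ c + 2 → 2 * q ≤ c + 1
  middle⇒2q m q r d c m≡ m<d d≤ = (≮⇒≥ λ (h : c + 1 < 2 * q) →
      refute (r * 2) (3 ⊗ h ⊕ 2 ⊗ (eq≥ m≡) ⊕ m<d ⊕ 3 ⊗ d≤)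
        (solve (m ∷ q ∷ r ∷ d ∷ c ∷ [])))

  middle⇒2q+r : ∀ m q r d c j → m ≡ r + q * 3 → r ≤ 2 → 2 * m < 3 * d → d ≤ c + j → 2 * q + r ≤ c + j
  middle⇒2q+r m q r d c j m≡ r≤2 m<d d≤ = (≮⇒≥ λ (h : c + j < 2 * q + r) →
      refute 1 (3 ⊗ h ⊕ 2 ⊗ (eq≥ m≡) ⊕ r≤2 ⊕ m<d ⊕ 3 ⊗ d≤)
        (solve (m ∷ q ∷ r ∷ d ∷ c ∷ j ∷ [])))

  large⇒m : ∀ m d c → m < d → d ≤ c + 2 → m ≤ c + 1
  large⇒m m d c m<d d≤ = (≮⇒≥ λ (h : c + 1 < m) → refute 0 (h ⊕ m<d ⊕ d≤) (solve (m ∷ d ∷ c ∷ [])))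

  -- `l₀ + 2 ≤ ε + 1` lets `xy` be served first, and `m + l₀ + 2 ≤ 2 * a₁` gives `xa` room for l₀
  -- and half of the other leaves. The cases differ in whether the degree of the centre or b₂
  -- exceeds m, that is, in which pairs can hold all m - 1 leaves.
  small-case : ∀ {m q r l₀ l₁ l₂ l₃ l₄ c₀ c₁ c₂ c₃ c₄ a₁ a₂ b₁ b₂ K D W₁ W₂} ε →
    19 ≤ m → m ≡ r + q * 3 → r ≤ 2 → l₀ < q + r →
    ε + 1 ≤ c₀ + 2 → a₁ ≤ c₁ + 2 → a₂ ≤ c₂ + 2 → b₁ ≤ c₃ + 2 → b₂ ≤ c₄ + 2 →
    l₀ + 2 ≤ ε + 1 → ε + 1 ≤ a₁ → a₁ ≤ a₂ → m + l₀ + 2 ≤ 2 * a₁ → m < a₂ →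
    (ε + 1) * D ≡ K → b₁ * W₁ ≡ K → b₂ * W₂ ≡ K → b₁ ≤ b₂ → NearlyLight m ε K D W₁ W₂ →
    ¬ Stuck m c₀ c₁ c₂ c₃ c₄ l₀ l₁ l₂ l₃ l₄
  small-case {m} {q} {r} {l₀} {l₁} {l₂} {l₃} {l₄} {c₀} {c₁} {c₂} {c₃} {c₄} {a₁} {a₂} {b₁} {b₂} {K} {D} {W₁} {W₂} ε
    19≤m m≡ r≤2 l₀< D≤ a₁≤ a₂≤ b₁≤ b₂≤ l₀≤D D≤a₁ a₁≤a₂ l₀≤a₁ m<a₂ eD e₁ e₂ b₁≤b₂ near
    with ε + 1 ≤? m
  ... | no D≰m = small-centre₀ {b₁ = b₁} {b₂} 19≤m
        (large⇒m m (ε + 1) c₀ (≰⇒> D≰m) D≤) (large⇒m m a₁ c₁ (<-≤-trans (≰⇒> D≰m) D≤a₁) a₁≤) (large⇒m m a₂ c₂ m<a₂ a₂≤)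
        b₁≤ b₂≤ (light⇒smallest m {K} {b₁} {W₁} {W₂} e₁ good) (light⇒middle m {K} {b₁} {b₂} {W₁} {W₂} e₁ e₂ b₁≤b₂ good)
    where good = near⇒good {m} {ε} {K} {D} {W₁} {W₂} 19≤m eD near
  ... | yes D≤m with b₂ ≤? m
  -- A light B would have a degree above m and could not occur here. B is only nearly light, which
  -- is why the finer bounds `near⇒middle` and `near⇒large` enter.
  ... | yes b₂≤m = small-centre₂ {q = q} {r} {b₁ = b₁} {b₂} 19≤m m≡ r≤2 l₀<
        l₀≤c₀ c₁≥ (large⇒m m a₂ c₂ m<a₂ a₂≤) b₁≤ b₂≤
        (near⇒middle {m} {ε} {K} {D} {W₁} {W₂} {b₁} {b₂} 19≤m eD e₁ e₂ near ε<m b₂≤m)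
        (near⇒large {m} {ε} {K} {D} {W₁} {W₂} {b₁} {b₂} 19≤m eD e₁ e₂ near ε<m b₁≤b₂)
    where
    ε<m : ε < m
    ε<m = subst (_≤ m) (+-comm ε 1) D≤m
    l₀≤c₀ : l₀ ≤ c₀
    l₀≤c₀ = +-cancelʳ-≤ 2 l₀ c₀ (≤-trans l₀≤D D≤)
    c₁≥ : m + l₀ ≤ c₁ * 2 + 2
    c₁≥ = ≮⇒≥ λ (h : c₁ * 2 + 2 < m + l₀) → refute 0 (h ⊕ l₀≤a₁ ⊕ 2 ⊗ a₁≤)
          (solve (m ∷ l₀ ∷ c₁ ∷ a₁ ∷ []))
  ... | no b₂≰m = small-centre₁ {q = q} {r} {b₁ = b₁} {ε + 1} 19≤m m≡ r≤2 l₀<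
        l₀≤c₀ c₁≥ (large⇒m m a₂ c₂ m<a₂ a₂≤) (large⇒m m b₂ c₄ (≰⇒> b₂≰m) b₂≤) D≤ b₁≤
        (light⇒smallest m {K} {b₁} {W₁} {W₂} e₁ (near⇒good {m} {ε} {K} {D} {W₁} {W₂} 19≤m eD near))
        (near⇒¬small {m} {ε} {K} {D} {W₁} {W₂} {b₁} 19≤m eD e₁ near)
    where
    l₀≤c₀ : l₀ ≤ c₀
    l₀≤c₀ = +-cancelʳ-≤ 2 l₀ c₀ (≤-trans l₀≤D D≤)
    c₁≥ : m + l₀ ≤ c₁ * 2 + 2
    c₁≥ = ≮⇒≥ λ (h : c₁ * 2 + 2 < m + l₀) → refute 0 (h ⊕ l₀≤a₁ ⊕ 2 ⊗ a₁≤)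
          (solve (m ∷ l₀ ∷ c₁ ∷ a₁ ∷ []))

  near-from-charges : ∀ {m ε K D A v v′} U → v ≡ m * (D + A) → v < 3 * K → v′ ≡ m * (D + U) →
    ε * (v′ ∸ 3 * K) < (3 * K ∸ v) * 3 → m * ((ε + 3) * D + ε * U) < 3 * (ε + 3) * K
  near-from-charges {m} {ε} {K} {D} {A} {v} {v′} U v≡ v<3K v′≡ close =
    finish (v′ ∸ 3 * K) (3 * K ∸ v) (m≤n+m∸n v′ (3 * K)) (≤-reflexive (m∸n+n≡m (<⇒≤ v<3K))) close
    where
    finish : ∀ p p′ → v′ ≤ 3 * K + p → p′ + v ≤ 3 * K → ε * p < p′ * 3 → m * ((ε + 3) * D + ε * U) < 3 * (ε + 3) * K
    finish p p′ v′≤ v≤ close = ≰⇒> λ (h : 3 * (ε + 3) * K ≤ m * ((ε + 3) * D + ε * U)) →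
      refute (A * m * 3) (h ⊕ 3 ⊗ v≤ ⊕ close ⊕ 3 ⊗ (eq≥ v≡) ⊕ ε ⊗ v′≤ ⊕ ε ⊗ (eq≥ v′≡))
            (solve (m ∷ ε ∷ K ∷ D ∷ A ∷ U ∷ v ∷ v′ ∷ p ∷ p′ ∷ []))

  -- The three lemmas refute the second alternative of good-partner.
  crowded-narrow : ∀ {m K s S A D c} → 19 ≤ m → m < 3 * s → 3 * s ≤ m + 4 → s * S ≡ K → D ≤ A →
    c + m * (D + (S + A)) ≤ 3 * K → ¬ (m * K < (1 + s) * (m * D + c * 3))
  crowded-narrow {m} {K} {s} {S} {A} {D} {c} 19≤m m<s s≤m es D≤A c≤ h =
    -- A side of degree s ≤ (m + 4)/3 already uses up all but 4K/s of the 3K available; c and m(D +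
    -- A) share this remainder.
    let sc : s * c ≤ 4 * K
        sc = ≮⇒≥ λ (g : 4 * K < s * c) →
            refute (A * m * s + D * m * s) (g ⊕ s ⊗ c≤ ⊕ m ⊗ (eq≥ es) ⊕ K ⊗ s≤m)
              (solve (m ∷ K ∷ s ∷ S ∷ A ∷ D ∷ c ∷ []))
        sD : s * m * D ≤ 2 * K
        sD = ≮⇒≥ λ (g : 2 * K < s * m * D) →
            refute (c * s + 1) (2 ⊗ g ⊕ s ⊗ c≤ ⊕ m ⊗ (eq≥ es) ⊕ K ⊗ s≤m ⊕ (m * s) ⊗ D≤A)
              (solve (m ∷ K ∷ s ∷ S ∷ A ∷ D ∷ c ∷ []))
    in final sc sD
    where
    s≥7 : 7 ≤ s
    s≥7 = ≮⇒≥ λ (g : s < 7) → refute 1 (3 ⊗ g ⊕ m<s ⊕ 19≤m) (solve (m ∷ s ∷ []))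
    final : s * c ≤ 4 * K → s * m * D ≤ 2 * K → ⊥
    final sc sD =
        -- Since s ≥ 7, the right side of `h` is at most (8/7)(2 + 12)K = 16K, whereas the left side
        -- is at least 19K.
        refute (K * m * s * 3 + 132) (19 ⊗ s≥7 ⊕ 57 ⊗ sc ⊕ 19 ⊗ sD ⊕ (s * 19) ⊗ h ⊕ (s * 57) ⊗ sc ⊕ (s * 19) ⊗ sD ⊕ (K * s * 16) ⊗ 19≤m ⊕ (K * 38) ⊗ s≥7)
          (solve (m ∷ K ∷ s ∷ D ∷ c ∷ []))

  crowded-wide : ∀ {m K s a S A D c} → 19 ≤ m → 1 ≤ a → 3 * a ≤ 2 * m + 2 → s * S ≡ K → a * A ≡ K → s ≤ a →
    c + m * (D + (S + A)) ≤ 3 * K → ¬ (m * K < (1 + a) * (m * D + c * 3))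
  crowded-wide {m} {K} {s} {a} {S} {A} {D} {c} 19≤m a≥1 a≤m es ea s≤a c≤ h =
    -- Both sides have degree at most a and so use at least 2mK/a of the 3K available; this leaves
    -- (3a - 2m)K/a ≤ 2K/a for mD + c.
    let ac : a * (m * D + c) ≤ 2 * K
        ac = ≮⇒≥ λ (g : 2 * K < a * (m * D + c)) →
            refute 0 (g ⊕ a ⊗ c≤ ⊕ m ⊗ (eq≥ es) ⊕ m ⊗ (eq≥ ea) ⊕ K ⊗ a≤m ⊕ (S * m) ⊗ s≤a)
              (solve (m ∷ K ∷ s ∷ a ∷ S ∷ A ∷ D ∷ c ∷ []))
    in final ac
    where
    final : a * (m * D + c) ≤ 2 * K → ⊥
    final ac =
        refute (D * a * a * m * 38 + D * a * m * 38 + K * a * m * 7 + 18) (19 ⊗ a≥1 ⊕ 57 ⊗ ac ⊕ (a * 19) ⊗ h ⊕ (a * 57) ⊗ ac ⊕ (K * a * 12) ⊗ 19≤m ⊕ (K * 114) ⊗ a≥1)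
          (solve (m ∷ K ∷ a ∷ D ∷ c ∷ []))

  crowded-none : ∀ {m K d D c v} → 19 ≤ m → m < d → d * D ≡ K → c + v ≤ 3 * K → ¬ (m * K < 1 * (m * D + c * 3))
  crowded-none {m} {K} {d} {D} {c} {v} 19≤m m<d eD c≤ h =
    -- From m < d follows mD ≤ K, and c ≤ 3K, so the right side of `h` is at most 10K.
    refute (K * m * 9 + D * 19 + v * 57 + 18) (19 ⊗ h ⊕ 19 ⊗ (eq≤ eD) ⊕ 57 ⊗ c≤ ⊕ (K * 10) ⊗ 19≤m ⊕ (D * 19) ⊗ m<d)
          (solve (m ∷ K ∷ d ∷ D ∷ c ∷ v ∷ []))

  -- A side of degree at most (m + 4)/3 leaves less than 12K/(m + 4) for `m * A`, so that a > m(m +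
  -- 4)/12. This is the degree that is quadratic in m.
  narrow⇒m≤ : ∀ {m K s a S A} → 19 ≤ m → 3 * s ≤ m + 4 → s * S ≡ K → a * A ≡ K → m * (S + A) < 3 * K → m ≤ a
  narrow⇒m≤ {m} {K} {s} {a} {S} {A} 19≤m s≤m es ea g = ≮⇒≥ λ (h : a < m) →
    refute (A * m * 11 + A * 12 + 22) (57 ⊗ (eq≥ es) ⊕ 12 ⊗ (eq≥ ea) ⊕ 23 ⊗ g ⊕ (A * 12) ⊗ h ⊕ (S * 4) ⊗ 19≤m ⊕ (S * 19) ⊗ s≤m)
          (solve (m ∷ K ∷ s ∷ a ∷ S ∷ A ∷ []))

  narrow-bound : ∀ m q r l₀ s → m ≡ r + q * 3 → r ≤ 2 → l₀ < q + r → s ≤ l₀ + 1 → 3 * s ≤ m + 4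
  narrow-bound m q r l₀ s m≡ r≤2 l₀< s≤ = (≮⇒≥ λ (h : m + 4 < 3 * s) →
      refute 0 (h ⊕ (eq≥ m≡) ⊕ 2 ⊗ r≤2 ⊕ 3 ⊗ l₀< ⊕ 3 ⊗ s≤)
        (solve (m ∷ q ∷ r ∷ l₀ ∷ s ∷ [])))

  narrow⇒q≤l₀ : ∀ m q r l₀ s → m ≡ r + q * 3 → m < 3 * s → s ≤ l₀ + 1 → q ≤ l₀
  narrow⇒q≤l₀ m q r l₀ s m≡ m<s s≤ = (≮⇒≥ λ (h : l₀ < q) →
      refute r (3 ⊗ h ⊕ (eq≥ m≡) ⊕ m<s ⊕ 3 ⊗ s≤)
        (solve (m ∷ q ∷ r ∷ l₀ ∷ s ∷ [])))

  huge⇒2q+r : ∀ m q r d c → m ≡ r + q * 3 → 6 ≤ q → m ≤ d → d ≤ c + 2 → 2 * q + r ≤ c + 1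
  huge⇒2q+r m q r d c m≡ q≥6 m≤d d≤ = (≮⇒≥ λ (h : c + 1 < 2 * q + r) →
      refute 5 (h ⊕ (eq≥ m≡) ⊕ q≥6 ⊕ m≤d ⊕ d≤)
        (solve (m ∷ q ∷ r ∷ d ∷ c ∷ [])))

  wide-bound : ∀ m q r l₀ a → m ≡ r + q * 3 → r ≤ 2 → l₀ < q + r → 2 * a ≤ m + l₀ + 1 → 3 * a ≤ 2 * m + 2
  wide-bound m q r l₀ a m≡ r≤2 l₀< a≤ = (≮⇒≥ λ (h : 2 * m + 2 < 3 * a) →
      refute 1 (2 ⊗ h ⊕ (eq≥ m≡) ⊕ 2 ⊗ r≤2 ⊕ 3 ⊗ l₀< ⊕ 3 ⊗ a≤)
        (solve (m ∷ q ∷ r ∷ l₀ ∷ a ∷ [])))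

  wide⇒q≤l₀ : ∀ m q r l₀ a → m ≡ r + q * 3 → 2 * m < 3 * a → 2 * a ≤ m + l₀ + 1 → q ≤ l₀
  wide⇒q≤l₀ m q r l₀ a m≡ a≥ a≤ = (≮⇒≥ λ (h : l₀ < q) →
      refute (r + 1) (3 ⊗ h ⊕ (eq≥ m≡) ⊕ 2 ⊗ a≥ ⊕ 3 ⊗ a≤)
        (solve (m ∷ q ∷ r ∷ l₀ ∷ a ∷ [])))

  wide⇒q≤c : ∀ q l₀ s c → q ≤ l₀ → l₀ + 2 ≤ s → s ≤ c + 2 → q ≤ c
  wide⇒q≤c q l₀ s c q≤ s≥ s≤ = (≮⇒≥ λ (h : c < q) → refute 0 (h ⊕ q≤ ⊕ s≥ ⊕ s≤)
        (solve (q ∷ l₀ ∷ s ∷ c ∷ [])))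

  q≥6-of : ∀ m q r → m ≡ r + q * 3 → r ≤ 2 → 19 ≤ m → 6 ≤ q
  q≥6-of m q r m≡ r≤2 19≤m = (≮⇒≥ λ (h : q < 6) → refute 1 (3 ⊗ h ⊕ (eq≤ m≡) ⊕ r≤2 ⊕ 19≤m)
        (solve (m ∷ q ∷ r ∷ [])))

  middle-positive : ∀ m a → 2 * m < 3 * a → 1 ≤ a
  middle-positive m a h = ≮⇒≥ λ (g : a < 1) → refute (m * 2) (3 ⊗ g ⊕ h) (solve (m ∷ a ∷ []))

-- Weights and charges in 3-graphs.

module ThreeGraphs where

  open import Data.Bool using (Bool; true; false)
  import Data.Bool.Properties as Bool
  open import Data.Nat using (ℕ; zero; suc; _+_; _*_; _∸_; _≤_; _<_; z≤n; s≤s; _/_; _!; _<?_)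
  open import Data.Nat.Properties hiding (_≟_)
  open import Data.Nat.DivMod using (m*[n/m]≡n; m/n*n≤m)
  open import Data.Nat.Divisibility using (∣-trans; m∣m*n; m≤n⇒m!∣n!)
  open import Data.Nat.Tactic.RingSolver using (solve)
  open import Data.Fin using (Fin; zero; suc)
  open import Data.Fin.Properties using (any?; _≟_)
  open import Data.List using ([]; _∷_)
  open import Data.Product using (_×_; _,_; ∃-syntax; proj₁; proj₂)
  open import Data.Sum using (_⊎_; inj₁; inj₂)
  open import Data.Empty using (⊥; ⊥-elim)
  open import Function using (_∘_)
  open import Relation.Nullary using (yes; no; does; Dec; contradiction)
  open import Relation.Nullary.Decidable using (_×-dec_; ¬?)
  open import Relation.Binary.PropositionalEquality
  open import Algebra.Properties.Semiring.Sum +-*-semiring using (sum; sum-cong-≗; ∑-distrib-+; ∑-comm; *-distribʳ-sum)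
  open Arithmetic

  ⟦_⟧ : Bool → ℕ
  ⟦ true ⟧  = 1
  ⟦ false ⟧ = 0

  sum-mono : ∀ {n} {f g : Fin n → ℕ} → (∀ i → f i ≤ g i) → sum f ≤ sum g
  sum-mono {zero}  f≤g = z≤n
  sum-mono {suc n} f≤g = +-mono-≤ (f≤g zero) (sum-mono (f≤g ∘ suc))

  sum-const : ∀ n c → sum {n} (λ _ → c) ≡ n * c
  sum-const zero    c = refl
  sum-const (suc n) c = cong (c +_) (sum-const n c)

  δ : ∀ {n} → Fin n → Fin n → ℕ
  δ i j = ⟦ does (j ≟ i) ⟧

  δ-refl : ∀ {n} (i : Fin n) → δ i i ≡ 1
  δ-refl i with i ≟ i
  ... | yes _  = refl
  ... | no i≢i = contradiction refl i≢i

  sum-δ : ∀ {n} (i : Fin n) → sum (δ i) ≡ 1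
  sum-δ {suc n} zero    = cong suc (trans (sum-const n 0) (*-zeroʳ n))
  sum-δ {suc n} (suc i) = trans (sum-cong-≗ shift) (sum-δ i)
    where
    shift : ∀ j → δ (suc i) (suc j) ≡ δ i j
    shift j with j ≟ i
    ... | yes _ = refl
    ... | no _  = refl

  sum-linear : ∀ {n} (f g : Fin n → ℕ) c d → sum (λ i → f i * c + g i * d) ≡ sum f * c + sum g * d
  sum-linear f g c d = trans (∑-distrib-+ (λ i → f i * c) (λ i → g i * d))
    (cong₂ _+_ (sym (*-distribʳ-sum c f)) (sym (*-distribʳ-sum d g)))

  argmax : ∀ {n} (f : Fin n → ℕ) → 0 < sum f → ∃[ i ] (∀ j → f j ≤ f i)
  argmax {suc n} f _ = go f
    where
    go : ∀ {n} (f : Fin (suc n) → ℕ) → ∃[ i ] (∀ j → f j ≤ f i)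
    go {zero}  f = zero , λ { zero → ≤-refl }
    go {suc n} f with go (f ∘ suc)
    ... | i , max with ≤-total (f zero) (f (suc i))
    ... | inj₁ ≤i = suc i , λ { zero → ≤i ; (suc j) → max j }
    ... | inj₂ i≤ = zero  , λ { zero → ≤-refl ; (suc j) → ≤-trans (max j) i≤ }

  does≡true : ∀ {P : Set} (P? : Dec P) → does P? ≡ true → P
  does≡true (yes p) _ = p

  sum³ : ∀ {n} → (Fin n → Fin n → Fin n → ℕ) → ℕ
  sum³ f = sum λ x → sum λ y → sum λ z → f x y z

  module _ {n : ℕ} where

    sum³-cong : {f g : Fin n → Fin n → Fin n → ℕ} → (∀ x y z → f x y z ≡ g x y z) → sum³ f ≡ sum³ g
    sum³-cong f≡g = sum-cong-≗ λ x → sum-cong-≗ λ y → sum-cong-≗ (f≡g x y)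

    sum³-mono : {f g : Fin n → Fin n → Fin n → ℕ} → (∀ x y z → f x y z ≤ g x y z) → sum³ f ≤ sum³ g
    sum³-mono f≤g = sum-mono λ x → sum-mono λ y → sum-mono (f≤g x y)

    sum³-+ : (f g : Fin n → Fin n → Fin n → ℕ) → sum³ (λ x y z → f x y z + g x y z) ≡ sum³ f + sum³ g
    sum³-+ f g = begin
      sum³ (λ x y z → f x y z + g x y z)
        ≡⟨ sum-cong-≗ (λ x → sum-cong-≗ λ y → ∑-distrib-+ (f x y) (g x y)) ⟩
      (sum λ x → sum λ y → sum (f x y) + sum (g x y))
        ≡⟨ sum-cong-≗ (λ x → ∑-distrib-+ (λ y → sum (f x y)) (λ y → sum (g x y))) ⟩
      (sum λ x → (sum λ y → sum (f x y)) + (sum λ y → sum (g x y)))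
        ≡⟨ ∑-distrib-+ (λ x → sum λ y → sum (f x y)) (λ x → sum λ y → sum (g x y)) ⟩
      sum³ f + sum³ g ∎
      where open ≡-Reasoning

    sum³-* : (f : Fin n → Fin n → Fin n → ℕ) (c : ℕ) → sum³ (λ x y z → f x y z * c) ≡ sum³ f * c
    sum³-* f c = begin
      sum³ (λ x y z → f x y z * c)
        ≡⟨ sum-cong-≗ (λ x → sum-cong-≗ λ y → sym (*-distribʳ-sum c (f x y))) ⟩
      (sum λ x → sum λ y → sum (f x y) * c)
        ≡⟨ sum-cong-≗ (λ x → sym (*-distribʳ-sum c (λ y → sum (f x y)))) ⟩
      (sum λ x → (sum λ y → sum (f x y)) * c)
        ≡⟨ sym (*-distribʳ-sum c (λ x → sum λ y → sum (f x y))) ⟩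
      sum³ f * c ∎
      where open ≡-Reasoning

    sum³-rotate : (f : Fin n → Fin n → Fin n → ℕ) → sum³ (λ x y z → f y z x) ≡ sum³ f
    sum³-rotate f = trans (∑-comm (λ x y → sum λ z → f y z x)) (sum-cong-≗ λ y → ∑-comm (λ x z → f y z x))

  -- Edges are counted as ordered triples, six for each edge, so that all counts below are plain
  -- sums over vertices.
  record Graph (n : ℕ) : Set where
    field
      E        : Fin n → Fin n → Fin n → Bool
      E-swap   : ∀ x y z → E x y z ≡ E y x z
      E-flip   : ∀ x y z → E x y z ≡ E x z y
      E-irrefl : ∀ x z → E x x z ≡ false

    E-rotate : ∀ x y z → E y z x ≡ E x y z
    E-rotate x y z = trans (E-flip y z x) (E-swap y x z)

    e : Fin n → Fin n → Fin n → ℕ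
    e x y z = ⟦ E x y z ⟧

    deg : Fin n → Fin n → ℕ
    deg x y = sum (e x y)

    deg-sym : ∀ x y → deg x y ≡ deg y x
    deg-sym x y = sum-cong-≗ λ z → cong ⟦_⟧ (E-swap x y z)

    K : ℕ
    K = n !

    -- K / d is exact for 0 < d ≤ n; the degree 0 gets the junk value 0.
    weight : ℕ → ℕ
    weight zero    = 0
    weight (suc d) = K / suc d

    W : Fin n → Fin n → ℕ
    W x y = weight (deg x y)

    W-sym : ∀ x y → W x y ≡ W y x
    W-sym x y = cong weight (deg-sym x y)

    K>0 : 0 < K
    K>0 = 1≤n! n

    weight-≤ : ∀ d → d * weight d ≤ K
    weight-≤ zero    = z≤n
    weight-≤ (suc d) = subst (_≤ K) (*-comm (K / suc d) (suc d)) (m/n*n≤m K (suc d))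

    weight-≡ : ∀ {d} → 1 ≤ d → d ≤ n → d * weight d ≡ K
    weight-≡ {suc d} _ d≤n = m*[n/m]≡n (∣-trans (m∣m*n (d !)) (m≤n⇒m!∣n! d≤n))

    e≤1 : ∀ x y z → e x y z ≤ 1
    e≤1 x y z with E x y z
    ... | true  = ≤-refl
    ... | false = z≤n

    deg≤n : ∀ x y → deg x y ≤ n
    deg≤n x y = ≤-trans (sum-mono (e≤1 x y)) (≤-reflexive (trans (sum-const n 1) (*-identityʳ n)))

    edge⇒deg : ∀ {x y z} → E x y z ≡ true → 1 ≤ deg x y
    edge⇒deg {x} {y} {z} Exyz = ≤-trans (≤-reflexive (sym (sum-δ z))) (sum-mono below)
      where
      below : ∀ i → δ z i ≤ e x y i
      below i with i ≟ z
      ... | yes refl = ≤-reflexive (sym (cong ⟦_⟧ Exyz))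
      ... | no _     = z≤n

    deg*W : ∀ {x y z} → E x y z ≡ true → deg x y * W x y ≡ K
    deg*W {x} {y} Exyz = weight-≡ (edge⇒deg Exyz) (deg≤n x y)

    deg-irrefl : ∀ x → deg x x ≡ 0
    deg-irrefl x = trans (sum-cong-≗ λ z → cong ⟦_⟧ (E-irrefl x z)) (trans (sum-const n 0) (*-zeroʳ n))

    size³ : ℕ
    size³ = sum³ e

    weights : ℕ
    weights = sum³ λ x y z → e x y z * W x y

    -- An ordered pair of positive degree d contributes d · (K/d) = K, any other pair 0. The
    -- diagonal contributes nothing, and adding `n * K` to the left states the bound n(n - 1)K
    -- without subtraction.
    weights-bound : weights + n * K ≤ n * (n * K)
    weights-bound = begin
      weights + n * K                       ≡⟨ cong (weights +_) (sym (sum-const n K)) ⟩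
      weights + sum (λ (_ : Fin n) → K)     ≡⟨ sym (∑-distrib-+ (λ x → sum λ y → sum λ z → e x y z * W x y) (λ _ → K)) ⟩
      sum (λ x → (sum λ y → sum λ z → e x y z * W x y) + K)  ≤⟨ sum-mono row ⟩
      sum (λ (_ : Fin n) → n * K)           ≡⟨ sum-const n (n * K) ⟩
      n * (n * K)                           ∎
      where
      open ≤-Reasoning
      entry : ∀ x y → (sum λ z → e x y z * W x y) + δ x y * K ≤ K
      entry x y with y ≟ x
      ... | yes refl = begin
        (sum λ z → e x x z * W x x) + 1 * K  ≡⟨ cong₂ _+_ (sym (*-distribʳ-sum (W x x) (e x x))) (*-identityˡ K) ⟩
        deg x x * W x x + K                  ≡⟨ cong (λ d → d * W x x + K) (deg-irrefl x) ⟩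
        K                                    ∎
      ... | no _     = begin
        (sum λ z → e x y z * W x y) + 0      ≡⟨ +-identityʳ _ ⟩
        (sum λ z → e x y z * W x y)          ≡⟨ sym (*-distribʳ-sum (W x y) (e x y)) ⟩
        deg x y * W x y                      ≤⟨ weight-≤ (deg x y) ⟩
        K                                    ∎
      row : ∀ x → (sum λ y → sum λ z → e x y z * W x y) + K ≤ n * K
      row x = begin
        (sum λ y → sum λ z → e x y z * W x y) + K
          ≡⟨ cong ((sum λ y → sum λ z → e x y z * W x y) +_) (sym (trans (cong (_* K) (sum-δ x)) (*-identityˡ K))) ⟩
        (sum λ y → sum λ z → e x y z * W x y) + sum (δ x) * K
          ≡⟨ cong ((sum λ y → sum λ z → e x y z * W x y) +_) (*-distribʳ-sum K (δ x)) ⟩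
        (sum λ y → sum λ z → e x y z * W x y) + sum (λ y → δ x y * K)
          ≡⟨ sym (∑-distrib-+ (λ y → sum λ z → e x y z * W x y) (λ y → δ x y * K)) ⟩
        (sum λ y → (sum λ z → e x y z * W x y) + δ x y * K)
          ≤⟨ sum-mono (entry x) ⟩
        sum (λ (_ : Fin n) → K)
          ≡⟨ sum-const n K ⟩
        n * K ∎

    module Charging (m : ℕ) where

      -- Scaled by m, so that a light edge is one with `w x y z < 3 * K`.
      w : Fin n → Fin n → Fin n → ℕ
      w x y z = m * (W x y + (W x z + W y z))

      w-rotate : ∀ x y z → w y z x ≡ w x y z
      w-rotate x y z = cong (m *_) (trans (cong₂ (λ u v → W y z + (u + v)) (W-sym y x) (W-sym z x))
        (rearrange (W y z) (W x y) (W x z)))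
        where
        rearrange : ∀ a b c → a + (b + c) ≡ b + (c + a)
        rearrange a b c = solve (a ∷ b ∷ c ∷ [])

      deficit excess : Fin n → Fin n → Fin n → ℕ
      deficit x y z = e x y z * (3 * K ∸ w x y z)
      excess  x y z = e x y z * (w x y z ∸ 3 * K)

      deficit-rotate : ∀ x y z → deficit y z x ≡ deficit x y z
      deficit-rotate x y z = cong₂ (λ b v → ⟦ b ⟧ * (3 * K ∸ v)) (E-rotate x y z) (w-rotate x y z)

      weighted-size : sum³ (λ x y z → e x y z * w x y z) ≡ weights * 3 * m
      weighted-size = begin
        sum³ (λ x y z → e x y z * w x y z)
          ≡⟨ sum³-cong (λ x y z → expand (e x y z) (W x y) (W x z) (W y z)) ⟩
        sum³ (λ x y z → (f x y z + (g x y z + h x y z)) * m)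
          ≡⟨ sum³-* (λ x y z → f x y z + (g x y z + h x y z)) m ⟩
        sum³ (λ x y z → f x y z + (g x y z + h x y z)) * m
          ≡⟨ cong (_* m) (trans (sum³-+ f (λ x y z → g x y z + h x y z)) (cong (sum³ f +_) (sum³-+ g h))) ⟩
        (sum³ f + (sum³ g + sum³ h)) * m
          ≡⟨ cong (_* m) (cong₂ (λ u v → sum³ f + (u + v)) g≡f h≡f) ⟩
        (sum³ f + (sum³ f + sum³ f)) * m
          ≡⟨ cong (_* m) (triple (sum³ f)) ⟩
        weights * 3 * m ∎
        where
        open ≡-Reasoning
        f g h : Fin n → Fin n → Fin n → ℕ
        f x y z = e x y z * W x y
        g x y z = e x y z * W x z
        h x y z = e x y z * W y z
        expand : ∀ i a b c → i * (m * (a + (b + c))) ≡ (i * a + (i * b + i * c)) * m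
        expand i a b c = solve (i ∷ a ∷ b ∷ c ∷ m ∷ [])
        triple : ∀ a → a + (a + a) ≡ a * 3
        triple a = solve (a ∷ [])
        h≡f : sum³ h ≡ sum³ f
        h≡f = trans (sum³-cong λ x y z → cong (λ b → ⟦ b ⟧ * W y z) (sym (E-rotate x y z))) (sum³-rotate f)
        g≡f : sum³ g ≡ sum³ f
        g≡f = trans (sym (sum³-rotate g)) (sum³-cong λ x y z → cong₂ (λ b v → ⟦ b ⟧ * v) (E-rotate x y z) (W-sym y x))

      module _ (π : Fin n → Fin n → Fin n → Bool) where

       -- `π x y z` decides whether the edge xyz hands its deficit to the pair xy. Several pairs of
       -- an edge may be selected when degrees tie; `covers` below asks for at least one.
       charge : Fin n → Fin n → Fin n → ℕ
       charge x y z = deficit x y z * ⟦ π x y z ⟧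

       module _ (covers : ∀ x y z → E x y z ≡ true → w x y z < 3 * K → 1 ≤ ⟦ π x y z ⟧ + (⟦ π y z x ⟧ + ⟦ π z x y ⟧)) where

        -- The deficit of a light edge appears in `charge` for at least one of the three rotations
        -- of xyz, and `sum³` does not change under rotation.
        deficit≤charge : sum³ deficit ≤ sum³ charge * 3
        deficit≤charge = begin
          sum³ deficit
            ≤⟨ sum³-mono pointwise ⟩
          sum³ (λ x y z → charge x y z + (charge y z x + charge z x y))
            ≡⟨ trans (sum³-+ charge (λ x y z → charge y z x + charge z x y))
                 (cong (sum³ charge +_) (sum³-+ (λ x y z → charge y z x) (λ x y z → charge z x y))) ⟩
          sum³ charge + (sum³ (λ x y z → charge y z x) + sum³ (λ x y z → charge z x y))
            ≡⟨ cong (sum³ charge +_) (cong₂ _+_ (sum³-rotate charge) (sym (sum³-rotate (λ x y z → charge z x y)))) ⟩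
          sum³ charge + (sum³ charge + sum³ charge)
            ≡⟨ triple (sum³ charge) ⟩
          sum³ charge * 3 ∎
          where
          open ≤-Reasoning
          triple : ∀ a → a + (a + a) ≡ a * 3
          triple a = solve (a ∷ [])
          distrib : ∀ a b c d → a * (b + (c + d)) ≡ a * b + (a * c + a * d)
          distrib a b c d = solve (a ∷ b ∷ c ∷ d ∷ [])
          bound : ∀ x y z → deficit x y z ≤ deficit x y z * (⟦ π x y z ⟧ + (⟦ π y z x ⟧ + ⟦ π z x y ⟧))
          bound x y z with E x y z in Exyz | w x y z <? 3 * K
          ... | false | _      = z≤n
          ... | true  | yes lt = subst (_≤ (1 * (3 * K ∸ w x y z)) * (⟦ π x y z ⟧ + (⟦ π y z x ⟧ + ⟦ π z x y ⟧)))
                  (*-identityʳ _) (*-monoʳ-≤ (1 * (3 * K ∸ w x y z)) (covers x y z Exyz lt))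
          ... | true  | no ≮   = ≤-trans (≤-reflexive (trans (*-identityˡ _) (m≤n⇒m∸n≡0 (≮⇒≥ ≮)))) z≤n
          pointwise : ∀ x y z → deficit x y z ≤ charge x y z + (charge y z x + charge z x y)
          pointwise x y z = ≤-trans (bound x y z) (≤-reflexive (trans
            (distrib (deficit x y z) ⟦ π x y z ⟧ ⟦ π y z x ⟧ ⟦ π z x y ⟧)
            (cong₂ (λ u v → charge x y z + (u * ⟦ π y z x ⟧ + v * ⟦ π z x y ⟧))
              (sym (deficit-rotate x y z)) (trans (sym (deficit-rotate x y z)) (sym (deficit-rotate y z x))))))

        -- The hypothesis says `size³` > m n(n - 1). As the weights total at most n(n - 1)K, the
        -- total deficit exceeds the total excess; if no pair were overcharged, summing over all
        -- pairs would give the reverse. The factor 3 reflects that a pair receives a third of each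
        -- excess.
        dense⇒overcharged : m * (n * n) < size³ + m * n →
          ∃[ x ] ∃[ y ] sum (excess x y) < sum (charge x y) * 3
        dense⇒overcharged dense with any? (λ x → any? λ y → sum (excess x y) <? sum (charge x y) * 3)
        ... | yes found = found
        ... | no none   = ⊥-elim (final K weights size³ (sum³ excess) (sum³ deficit) K>0 dense weights-bound balance (≤-trans deficit≤charge charge≤excess))
          where
          charge≤excess : sum³ charge * 3 ≤ sum³ excess
          charge≤excess = ≤-trans (≤-reflexive (sym (sum³-* charge 3)))
            (sum-mono λ x → sum-mono λ y → ≤-trans (≤-reflexive (sym (*-distribʳ-sum 3 (charge x y))))
              (≮⇒≥ λ lt → none (x , y , lt)))
          split : ∀ i a b → i * (a ∸ b) + i * b ≡ i * (b ∸ a) + i * a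
          split i a b = trans (sym (*-distribˡ-+ i (a ∸ b) b)) (trans (cong (i *_) (max a b)) (*-distribˡ-+ i (b ∸ a) a))
            where
            max : ∀ a b → a ∸ b + b ≡ b ∸ a + a
            max a b with ≤-total a b
            ... | inj₁ a≤b = trans (cong (_+ b) (m≤n⇒m∸n≡0 a≤b)) (sym (m∸n+n≡m a≤b))
            ... | inj₂ b≤a = trans (m∸n+n≡m b≤a) (sym (cong (_+ a) (m≤n⇒m∸n≡0 b≤a)))
          balance : sum³ excess + size³ * (3 * K) ≡ sum³ deficit + weights * 3 * m
          balance = begin
            sum³ excess + size³ * (3 * K)
              ≡⟨ cong (sum³ excess +_) (sym (sum³-* e (3 * K))) ⟩
            sum³ excess + sum³ (λ x y z → e x y z * (3 * K))
              ≡⟨ sym (sum³-+ excess (λ x y z → e x y z * (3 * K))) ⟩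
            sum³ (λ x y z → excess x y z + e x y z * (3 * K))
              ≡⟨ sum³-cong (λ x y z → split (e x y z) (w x y z) (3 * K)) ⟩
            sum³ (λ x y z → deficit x y z + e x y z * w x y z)
              ≡⟨ sum³-+ deficit (λ x y z → e x y z * w x y z) ⟩
            sum³ deficit + sum³ (λ x y z → e x y z * w x y z)
              ≡⟨ cong (sum³ deficit +_) weighted-size ⟩
            sum³ deficit + weights * 3 * m ∎
            where open ≡-Reasoning
          final : ∀ K v s x d → 0 < K → m * (n * n) < s + m * n → v + n * K ≤ n * (n * K) →
            x + s * (3 * K) ≡ d + v * 3 * m → d ≤ x → ⊥
          final K v s x d K>0 dense bound bal d≤x =
            refute 2 (3 ⊗ K>0 ⊕ (eq≤ bal) ⊕ d≤x ⊕ (K * 3) ⊗ dense ⊕ (m * 3) ⊗ bound)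
                  (solve (n ∷ m ∷ K ∷ v ∷ s ∷ x ∷ d ∷ []))

       charge≤deficit : ∀ x y z → charge x y z ≤ deficit x y z
       charge≤deficit x y z with π x y z
       ... | true  = ≤-reflexive (*-identityʳ _)
       ... | false = ≤-trans (≤-reflexive (*-zeroʳ (deficit x y z))) z≤n

       heavy⇒no-charge : ∀ {x y z} → 3 * K ≤ w x y z → charge x y z ≡ 0
       heavy⇒no-charge {x} {y} {z} heavy = n≤0⇒n≡0 (≤-trans (charge≤deficit x y z)
         (≤-reflexive (trans (cong (e x y z *_) (m≤n⇒m∸n≡0 heavy)) (*-zeroʳ (e x y z)))))

       deficit-edge : ∀ {x y z} → E x y z ≡ true → deficit x y z ≡ 3 * K ∸ w x y z
       deficit-edge {x} {y} {z} Exyz = trans (cong (λ b → ⟦ b ⟧ * (3 * K ∸ w x y z)) Exyz) (*-identityˡ _)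

       nonedge⇒no-charge : ∀ {x y z} → E x y z ≡ false → charge x y z ≡ 0
       nonedge⇒no-charge {x} {y} {z} ¬Exyz = cong (λ b → ⟦ b ⟧ * (3 * K ∸ w x y z) * ⟦ π x y z ⟧) ¬Exyz

       -- ε counts the edges on xy other than A. If each of them had ε times its excess at least c,
       -- three times the deficit of A, then all would be heavy and only A would charge xy; their
       -- excesses, at least c in total, would balance that charge.
       near-partner : ∀ {x y a} ε → deg x y ≡ ε + 1 → 1 ≤ ε → E x y a ≡ true → w x y a < 3 * K →
         sum (excess x y) < sum (charge x y) * 3 →
         ∃[ b ] b ≢ a × E x y b ≡ true × ε * (w x y b ∸ 3 * K) < (3 * K ∸ w x y a) * 3
       near-partner {x} {y} {a} ε deg≡ ε≥1 Exya light over
         with any? (λ b → ¬? (b ≟ a) ×-dec (E x y b Bool.≟ true) ×-dec (ε * (w x y b ∸ 3 * K) <? (3 * K ∸ w x y a) * 3))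
       ... | yes found = found
       ... | no none   = ⊥-elim (conclude c (sum (excess x y)) ε≥1 excesses charges over)
         where
         c = (3 * K ∸ w x y a) * 3
         c>0 : 0 < c
         c>0 = ≤-trans (s≤s z≤n) (*-monoˡ-≤ 3 (m<n⇒0<n∸m light))
         far : ∀ b → b ≢ a → E x y b ≡ true → c ≤ ε * (w x y b ∸ 3 * K)
         far b b≢a Exyb = ≮⇒≥ λ lt → none (b , b≢a , Exyb , lt)
         heavy : ∀ b → b ≢ a → E x y b ≡ true → 3 * K ≤ w x y b
         heavy b b≢a Exyb = ≰⇒≥ λ w≤ → <⇒≱ c>0 (≤-trans (far b b≢a Exyb)
           (≤-reflexive (trans (cong (ε *_) (m≤n⇒m∸n≡0 w≤)) (*-zeroʳ ε))))
         charge-bound : ∀ b → charge x y b * 3 ≤ δ a b * c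
         charge-bound b with b ≟ a | E x y b Bool.≟ true
         ... | yes refl | _       = ≤-trans (*-monoˡ-≤ 3 (≤-trans (charge≤deficit x y b) (≤-reflexive (deficit-edge Exya)))) (≤-reflexive (sym (*-identityˡ c)))
         ... | no _     | no ¬E   = ≤-trans (≤-reflexive (cong (_* 3) (nonedge⇒no-charge (Bool.¬-not ¬E)))) z≤n
         ... | no b≢a   | yes Exyb = ≤-trans (≤-reflexive (cong (_* 3) (heavy⇒no-charge (heavy b b≢a Exyb)))) z≤n
         charges : sum (charge x y) * 3 ≤ c
         charges = begin
           sum (charge x y) * 3          ≡⟨ *-distribʳ-sum 3 (charge x y) ⟩
           sum (λ b → charge x y b * 3)  ≤⟨ sum-mono charge-bound ⟩
           sum (λ b → δ a b * c)         ≡⟨ sym (*-distribʳ-sum c (δ a)) ⟩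
           sum (δ a) * c                 ≡⟨ trans (cong (_* c) (sum-δ a)) (*-identityˡ c) ⟩
           c                             ∎
           where open ≤-Reasoning
         excess-bound : ∀ b → e x y b * c ≤ δ a b * c + excess x y b * ε
         excess-bound b with b ≟ a | E x y b in Exyb
         ... | yes refl | true  = m≤m+n (1 * c) _
         ... | yes _    | false = z≤n
         ... | no _     | false = z≤n
         ... | no b≢a   | true  = ≤-trans (≤-reflexive (*-identityˡ c)) (≤-trans (far b b≢a Exyb)
                 (≤-reflexive (trans (*-comm ε _) (cong (_* ε) (sym (*-identityˡ (w x y b ∸ 3 * K)))))))
         excesses : (ε + 1) * c ≤ c + sum (excess x y) * ε
         excesses = begin
           (ε + 1) * c                                    ≡⟨ cong (_* c) (sym deg≡) ⟩
           deg x y * c                                    ≡⟨ *-distribʳ-sum c (e x y) ⟩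
           sum (λ b → e x y b * c)                        ≤⟨ sum-mono excess-bound ⟩
           sum (λ b → δ a b * c + excess x y b * ε)       ≡⟨ sum-linear (δ a) (excess x y) c ε ⟩
           sum (δ a) * c + sum (excess x y) * ε           ≡⟨ cong (_+ sum (excess x y) * ε) (trans (cong (_* c) (sum-δ a)) (*-identityˡ c)) ⟩
           c + sum (excess x y) * ε                       ∎
           where open ≤-Reasoning
         conclude : ∀ {t} c s → 1 ≤ ε → (ε + 1) * c ≤ c + s * ε → t ≤ c → s < t → ⊥
         conclude {t} c s ε≥1 h t≤c s<t =
           refute 0 (ε≥1 ⊕ h ⊕ ε ⊗ t≤c ⊕ ε ⊗ s<t) (solve (ε ∷ t ∷ c ∷ s ∷ []))

       Good : Fin n → Fin n → Fin n → Set
       Good x y b = E x y b ≡ true × m * (W x b + W y b) < 3 * K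

       -- Suppose there is no such b. Apart from a and the excluded vertices, every edge on xy has
       -- sides weighing at least 3K/m, so it charges nothing and has excess at least `m * W x y`.
       -- Since `deg x y * W x y` is K, the excess on xy is at least mK less `m * W x y` for each
       -- exceptional vertex, and each of these charges at most c.
       good-partner : ∀ {x y a c} (excluded : Fin n → Bool) → E x y a ≡ true → (∀ z → charge x y z ≤ c) →
         sum (excess x y) < sum (charge x y) * 3 →
         (∃[ b ] b ≢ a × Good x y b × excluded b ≡ false) ⊎
         m * K < (1 + sum (λ z → ⟦ excluded z ⟧)) * (m * W x y + c * 3)
       good-partner {x} {y} {a} {c} excluded Exya max over
         with any? (λ b → ¬? (b ≟ a) ×-dec ((E x y b Bool.≟ true) ×-dec (m * (W x b + W y b) <? 3 * K)) ×-dec (excluded b Bool.≟ false))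
       ... | yes found = inj₁ found
       ... | no none   = inj₂ (conclude (sum (charge x y)) (sum (excess x y)) degrees charges over)
         where
         ω = m * W x y
         g = 1 + sum (λ z → ⟦ excluded z ⟧)
         mark : Fin n → ℕ
         mark b = δ a b + ⟦ excluded b ⟧
         marks : sum mark ≡ g
         marks = trans (∑-distrib-+ (δ a) (λ z → ⟦ excluded z ⟧)) (cong (_+ sum (λ z → ⟦ excluded z ⟧)) (sum-δ a))
         bad : ∀ b → b ≢ a → E x y b ≡ true → excluded b ≡ false → ω + 3 * K ≤ w x y b
         bad b b≢a Exyb incl = ≤-trans (+-monoʳ-≤ ω (≮⇒≥ λ lt → none (b , b≢a , (Exyb , lt) , incl)))
           (≤-reflexive (sym (*-distribˡ-+ m (W x y) _)))
         charge-bound : ∀ b → charge x y b ≤ mark b * c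
         charge-bound b with b ≟ a | excluded b in excl | E x y b Bool.≟ true
         ... | yes refl | _     | _        = ≤-trans (max b) (m≤m+n c _)
         ... | no _     | true  | _        = ≤-trans (max b) (≤-reflexive (sym (*-identityˡ c)))
         ... | no _     | false | no ¬E    = ≤-trans (≤-reflexive (nonedge⇒no-charge (Bool.¬-not ¬E))) z≤n
         ... | no b≢a   | false | yes Exyb = ≤-trans (≤-reflexive (heavy⇒no-charge (m+n≤o⇒n≤o ω (bad b b≢a Exyb excl)))) z≤n
         charges : sum (charge x y) ≤ g * c
         charges = ≤-trans (sum-mono charge-bound) (≤-reflexive (trans (sym (*-distribʳ-sum c mark)) (cong (_* c) marks)))
         excess-bound : ∀ b → e x y b * ω ≤ mark b * ω + excess x y b * 1
         excess-bound b with b ≟ a | excluded b in excl | E x y b in Exyb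
         ... | _        | _     | false = z≤n
         ... | yes refl | _     | true  = ≤-trans (≤-reflexive (*-identityˡ ω)) (≤-trans (m≤m+n ω _) (m≤m+n _ _))
         ... | no _     | true  | true  = m≤m+n (1 * ω) _
         ... | no b≢a   | false | true  = ≤-trans (≤-reflexive (*-identityˡ ω)) (≤-trans (m+n≤o⇒m≤o∸n ω (bad b b≢a Exyb excl))
                 (≤-reflexive (sym (trans (*-identityʳ _) (*-identityˡ (w x y b ∸ 3 * K))))))
         degrees : m * K ≤ g * ω + sum (excess x y)
         degrees = begin
           m * K                                       ≡⟨ cong (m *_) (sym (deg*W Exya)) ⟩
           m * (deg x y * W x y)                       ≡⟨ exchange m (deg x y) (W x y) ⟩
           deg x y * ω                                 ≡⟨ *-distribʳ-sum ω (e x y) ⟩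
           sum (λ b → e x y b * ω)                     ≤⟨ sum-mono excess-bound ⟩
           sum (λ b → mark b * ω + excess x y b * 1)   ≡⟨ sum-linear mark (excess x y) ω 1 ⟩
           sum mark * ω + sum (excess x y) * 1         ≡⟨ cong₂ (λ u v → u * ω + v) marks (*-identityʳ _) ⟩
           g * ω + sum (excess x y)                    ∎
           where
           open ≤-Reasoning
           exchange : ∀ a b c → a * (b * c) ≡ b * (a * c)
           exchange a b c = solve (a ∷ b ∷ c ∷ [])
         conclude : ∀ {r} t s → r ≤ g * ω + s → t ≤ g * c → s < t * 3 → r < g * (ω + c * 3)
         conclude t s r≤ t≤ s< = ≤-trans (s≤s r≤) (≤-trans (≤-reflexive (sym (+-suc (g * ω) s))) (≤-trans (+-monoʳ-≤ (g * ω) (≤-trans s< (*-monoˡ-≤ 3 t≤)))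
           (≤-reflexive (trans (cong (g * ω +_) (*-assoc g c 3)) (sym (*-distribˡ-+ g ω (c * 3)))))))

       most-charged : ∀ {x y} → sum (excess x y) < sum (charge x y) * 3 →
         ∃[ a ] (∀ z → charge x y z ≤ charge x y a) × E x y a ≡ true × w x y a < 3 * K × π x y a ≡ true
       most-charged {x} {y} over = a , max , edge , light , chosen
         where
         positive : 0 < sum (charge x y)
         positive = n≢0⇒n>0 λ zero-sum → <⇒≱ over (≤-trans (≤-reflexive (cong (_* 3) zero-sum)) z≤n)
         a = proj₁ (argmax (charge x y) positive)
         max = proj₂ (argmax (charge x y) positive)
         charged : charge x y a ≢ 0
         charged c≡0 = n>0⇒n≢0 positive (n≤0⇒n≡0 (≤-trans (sum-mono λ z → subst (charge x y z ≤_) c≡0 (max z))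
           (≤-reflexive (trans (sum-const n 0) (*-zeroʳ n)))))
         edge : E x y a ≡ true
         edge with E x y a Bool.≟ true
         ... | yes Exya = Exya
         ... | no ¬E    = contradiction (nonedge⇒no-charge (Bool.¬-not ¬E)) charged
         light : w x y a < 3 * K
         light = ≰⇒> λ heavy → charged (heavy⇒no-charge heavy)
         chosen : π x y a ≡ true
         chosen with π x y a Bool.≟ true
         ... | yes πxya = πxya
         ... | no ¬π    = contradiction (trans (cong (λ b → deficit x y a * ⟦ b ⟧) (Bool.¬-not ¬π)) (*-zeroʳ (deficit x y a))) charged

-- The edge bound for graphs without room for the tree.

module DenseGraphs where

  open import Data.Bool using (Bool; true; false)
  open import Data.Nat using (ℕ; suc; _+_; _*_; _∸_; _≤_; _<_; _≤?_; z≤n; s≤s; _/_; _%_)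
  open import Data.Nat.Properties hiding (_≟_)
  open import Data.Nat.DivMod using (m≡m%n+[m/n]*n; m%n<n)
  open import Data.Nat.Tactic.RingSolver using (solve)
  open import Data.Fin using (Fin; suc)
  open import Data.List using ([]; _∷_)
  open import Data.Product using (_×_; _,_; ∃-syntax)
  open import Data.Sum using (_⊎_; inj₁; inj₂; [_,_]′)
  open import Data.Empty using (⊥)
  open import Function using (_∘_)
  open import Relation.Nullary using (¬_; yes; no; does; Dec)
  open import Relation.Nullary.Decidable using (_×-dec_; _⊎-dec_; dec-true)
  open import Relation.Binary.PropositionalEquality
  open import Algebra.Properties.Semiring.Sum +-*-semiring using (sum)
  open Arithmetic
  open Scheduling
  open PairDegrees
  open ThreeGraphs

  data Sorted₃ (R : ℕ → ℕ → ℕ → Set) (p q r : ℕ) : Set where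
    first  : R p q r → Sorted₃ R p q r
    second : R q p r → Sorted₃ R p q r
    third  : R r p q → Sorted₃ R p q r

  module _ {R : ℕ → ℕ → ℕ → Set} (R-sym : ∀ {d a b} → R d a b → R d b a)
    (ends : ∀ {s a b} → s ≤ a → a ≤ b → R s a b ⊎ R b s a) where

    -- Every light edge must find a receiving pair. As R is symmetric in its last two arguments, it
    -- suffices to decide between the smallest and the largest of three sorted degrees.
    choose-pair : ∀ p q r → Sorted₃ R p q r
    choose-pair p q r with ≤-total p q | ≤-total q r | ≤-total p r
    ... | inj₁ p≤q | inj₁ q≤r | _        with ends p≤q q≤r
    ...   | inj₁ R₁ = first R₁
    ...   | inj₂ R₂ = third R₂
    choose-pair p q r | inj₁ p≤q | inj₂ r≤q | inj₁ p≤r with ends p≤r r≤q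
    ...   | inj₁ R₁ = first (R-sym R₁)
    ...   | inj₂ R₂ = second R₂
    choose-pair p q r | inj₁ p≤q | inj₂ r≤q | inj₂ r≤p with ends r≤p p≤q
    ...   | inj₁ R₁ = third R₁
    ...   | inj₂ R₂ = second (R-sym R₂)
    choose-pair p q r | inj₂ q≤p | inj₁ q≤r | inj₁ p≤r with ends q≤p p≤r
    ...   | inj₁ R₁ = second R₁
    ...   | inj₂ R₂ = third (R-sym R₂)
    choose-pair p q r | inj₂ q≤p | inj₁ q≤r | inj₂ r≤p with ends q≤r r≤p
    ...   | inj₁ R₁ = second (R-sym R₁)
    ...   | inj₂ R₂ = first R₂
    choose-pair p q r | inj₂ q≤p | inj₂ r≤q | _        with ends r≤q q≤p
    ...   | inj₁ R₁ = third (R-sym R₁)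
    ...   | inj₂ R₂ = first (R-sym R₂)

  module Bound {n : ℕ} (G : Graph n) (m : ℕ) (19≤m : 19 ≤ m) (l₀ l₁ l₂ l₃ l₄ : ℕ)
    (total : m ≡ suc (l₀ + (l₁ + l₂ + (l₃ + l₄)))) where

    open Graph G
    open Charging m

    -- For an edge xya of the trunk, y always takes one of the places on xa, and b takes another one
    -- exactly if xab is an edge.
    capacity : Fin n → Fin n → Fin n → ℕ
    capacity x a b = deg x a ∸ (1 + ⟦ E x a b ⟧)

    module _ (no-room : ∀ x y a b → E x y a ≡ true → E x y b ≡ true → b ≢ a →
      Blocked (assign (deg x y ∸ 2) (capacity x a b) (capacity y a b) (capacity x b a) (capacity y b a))
              (assign l₀ l₁ l₂ l₃ l₄)) where

      exchangeˣʸ exchangeᵃᵇ exchange : Fin 5 → Fin 5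
      exchangeˣʸ xy = xy
      exchangeˣʸ xa = ya
      exchangeˣʸ ya = xa
      exchangeˣʸ xb = yb
      exchangeˣʸ yb = xb
      exchangeᵃᵇ xy = xy
      exchangeᵃᵇ xa = xb
      exchangeᵃᵇ ya = yb
      exchangeᵃᵇ xb = xa
      exchangeᵃᵇ yb = ya
      exchange i = exchangeᵃᵇ (exchangeˣʸ i)

      -- The four readings of the tree come from `no-room` applied with x and y, or a and b,
      -- exchanged in the graph; `relabel` carries each back to the same capacities.
      stuck-at : ∀ {x y a b} → E x y a ≡ true → E x y b ≡ true → b ≢ a →
        Stuck m (deg x y ∸ 2) (capacity x a b) (capacity y a b) (capacity x b a) (capacity y b a) l₀ l₁ l₂ l₃ l₄
      stuck-at {x} {y} {a} {b} Exya Exyb b≢a = stuck total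
        (no-room x y a b Exya Exyb b≢a)
        (relabel (assign (deg y x ∸ 2) (capacity y a b) (capacity x a b) (capacity y b a) (capacity x b a)) _ (assign l₀ l₁ l₂ l₃ l₄) _ exchangeˣʸ
          (λ { xy → refl ; xa → refl ; ya → refl ; xb → refl ; yb → refl })
          (λ { xy → cong (_∸ 2) (deg-sym y x) ; xa → refl ; ya → refl ; xb → refl ; yb → refl })
          (λ { xy → refl ; xa → refl ; ya → refl ; xb → refl ; yb → refl })
          (no-room y x a b (trans (E-swap y x a) Exya) (trans (E-swap y x b) Exyb) b≢a))
        (relabel (assign (deg x y ∸ 2) (capacity x b a) (capacity y b a) (capacity x a b) (capacity y a b)) _ (assign l₀ l₁ l₂ l₃ l₄) _ exchangeᵃᵇ
          (λ { xy → refl ; xa → refl ; ya → refl ; xb → refl ; yb → refl })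
          (λ { xy → refl ; xa → refl ; ya → refl ; xb → refl ; yb → refl })
          (λ { xy → refl ; xa → refl ; ya → refl ; xb → refl ; yb → refl })
          (no-room x y b a Exyb Exya (b≢a ∘ sym)))
        (relabel (assign (deg y x ∸ 2) (capacity y b a) (capacity x b a) (capacity y a b) (capacity x a b)) _ (assign l₀ l₁ l₂ l₃ l₄) _ exchange
          (λ { xy → refl ; xa → refl ; ya → refl ; xb → refl ; yb → refl })
          (λ { xy → cong (_∸ 2) (deg-sym y x) ; xa → refl ; ya → refl ; xb → refl ; yb → refl })
          (λ { xy → refl ; xa → refl ; ya → refl ; xb → refl ; yb → refl })
          (no-room y x b a (trans (E-swap y x b) Exyb) (trans (E-swap y x a) Exya) (b≢a ∘ sym)))

      deg≤∸2 : ∀ d → d ≤ d ∸ 2 + 2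
      deg≤∸2 d = subst (d ≤_) (+-comm 2 (d ∸ 2)) (m≤n+m∸n d 2)

      deg≤capacity : ∀ x a b → deg x a ≤ capacity x a b + 2
      deg≤capacity x a b with E x a b
      ... | true  = deg≤∸2 (deg x a)
      ... | false = ≤-trans (m≤n+m∸n (deg x a) 1) (≤-trans (≤-reflexive (+-comm 1 (deg x a ∸ 1))) (+-monoʳ-≤ (deg x a ∸ 1) (s≤s z≤n)))

      deg≤capacity′ : ∀ x a b → E x a b ≡ false → deg x a ≤ capacity x a b + 1
      deg≤capacity′ x a b ¬E = subst (λ t → deg x a ≤ deg x a ∸ (1 + ⟦ t ⟧) + 1) (sym ¬E)
        (≤-trans (m≤n+m∸n (deg x a) 1) (≤-reflexive (+-comm 1 (deg x a ∸ 1))))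

      r q : ℕ
      r = m % 3
      q = m / 3

      m≡ : m ≡ r + q * 3
      m≡ = m≡m%n+[m/n]*n m 3

      r≤2 : r ≤ 2
      r≤2 = ≤-pred (m%n<n m 3)

      side-weight : ∀ {x y a} → E x y a ≡ true → deg x a * W x a ≡ K
      side-weight {x} {y} {a} Exya = deg*W (trans (E-flip x a y) Exya)

      side-weight′ : ∀ {x y a} → E x y a ≡ true → deg y a * W y a ≡ K
      side-weight′ {x} {y} {a} Exya = deg*W (trans (E-rotate x y a) Exya)

      light⇒good : ∀ {x y a} → w x y a < 3 * K → m * (W x a + W y a) < 3 * K
      light⇒good {x} {y} {a} light = ≤-<-trans (*-monoʳ-≤ m (m≤n+m (W x a + W y a) (W x y))) light

      charge-room : ∀ (π : Fin n → Fin n → Fin n → Bool) {x y a} → E x y a ≡ true → w x y a < 3 * K → charge π x y a + w x y a ≤ 3 * K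
      charge-room π {x} {y} {a} Exya light = ≤-trans (+-monoˡ-≤ (w x y a) (≤-trans (charge≤deficit π x y a) (≤-reflexive (deficit-edge π Exya))))
        (≤-reflexive (m∸n+n≡m (<⇒≤ light)))

      covers-of : {R : ℕ → ℕ → ℕ → Set} (R? : ∀ d a b → Dec (R d a b)) (R-sym : ∀ {d a b} → R d a b → R d b a) →
        (∀ p q r → Sorted₃ R p q r) → ∀ x y z →
        1 ≤ ⟦ does (R? (deg x y) (deg x z) (deg y z)) ⟧ + (⟦ does (R? (deg y z) (deg y x) (deg z x)) ⟧ + ⟦ does (R? (deg z x) (deg z y) (deg x y)) ⟧)
      covers-of {R} R? R-sym sorted x y z = go (sorted (deg x y) (deg x z) (deg y z))
        where
        one : ∀ {P : Set} (P? : Dec P) → P → 1 ≤ ⟦ does P? ⟧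
        one P? p rewrite dec-true P? p = ≤-refl
        A B C : ℕ
        A = ⟦ does (R? (deg x y) (deg x z) (deg y z)) ⟧
        B = ⟦ does (R? (deg y z) (deg y x) (deg z x)) ⟧
        C = ⟦ does (R? (deg z x) (deg z y) (deg x y)) ⟧
        go : Sorted₃ R (deg x y) (deg x z) (deg y z) → 1 ≤ A + (B + C)
        go (first Rp)  = ≤-trans (one (R? (deg x y) (deg x z) (deg y z)) Rp) (m≤m+n A (B + C))
        go (second Rq) = ≤-trans (one (R? (deg z x) (deg z y) (deg x y))
          (subst₂ (λ u v → R u v (deg x y)) (deg-sym x z) (deg-sym y z) (R-sym Rq))) (≤-trans (m≤n+m C B) (m≤n+m (B + C) A))
        go (third Rr)  = ≤-trans (one (R? (deg y z) (deg y x) (deg z x))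
          (subst₂ (R (deg y z)) (deg-sym x y) (deg-sym x z) Rr)) (≤-trans (m≤m+n B C) (m≤n+m (B + C) A))

      swap-good : ∀ {x y b} → m * (W x b + W y b) < 3 * K → m * (W y b + W x b) < 3 * K
      swap-good {x} {y} {b} = subst (λ t → m * t < 3 * K) (+-comm (W x b) (W y b))

      smallest-x : ∀ {x y a} → E x y a ≡ true → m * (W x a + W y a) < 3 * K → m < 3 * deg x a
      smallest-x {x} {y} {a} Exya = light⇒smallest m {K} {deg x a} {W x a} {W y a} (side-weight Exya)

      smallest-y : ∀ {x y a} → E x y a ≡ true → m * (W x a + W y a) < 3 * K → m < 3 * deg y a
      smallest-y {x} {y} {a} Exya good = light⇒smallest m {K} {deg y a} {W y a} {W x a} (side-weight′ Exya) (swap-good {x} {y} {a} good)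

      middle-y : ∀ {x y a} → E x y a ≡ true → deg x a ≤ deg y a → m * (W x a + W y a) < 3 * K → 2 * m < 3 * deg y a
      middle-y {x} {y} {a} Exya = light⇒middle m {K} {deg x a} {deg y a} {W x a} {W y a} (side-weight Exya) (side-weight′ Exya)

      middle-x : ∀ {x y a} → E x y a ≡ true → deg y a ≤ deg x a → m * (W x a + W y a) < 3 * K → 2 * m < 3 * deg x a
      middle-x {x} {y} {a} Exya a≥ good =
        light⇒middle m {K} {deg y a} {deg x a} {W y a} {W x a} (side-weight′ Exya) (side-weight Exya) a≥ (swap-good {x} {y} {a} good)

      top-large : ∀ {x y a} → E x y a ≡ true → w x y a < 3 * K → deg x a ≤ deg x y → deg y a ≤ deg x y → m < deg x y
      top-large {x} {y} {a} Exya light xa≤ ya≤ = light⇒largest m {K} {deg x a} {deg y a} {deg x y} {W x a} {W y a} {W x y}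
        (side-weight Exya) (side-weight′ Exya) (deg*W Exya) xa≤ ya≤ light

      -- The centre of the tree carries many leaves: assign every light edge to its
      -- pair of largest degree.
      module ManyCentral (l₀≥ : q + r ≤ l₀) where

        Top : ℕ → ℕ → ℕ → Set
        Top d a b = a ≤ d × b ≤ d

        Top? : ∀ d a b → Dec (Top d a b)
        Top? d a b = a ≤? d ×-dec b ≤? d

        π : Fin n → Fin n → Fin n → Bool
        π x y z = does (Top? (deg x y) (deg x z) (deg y z))

        Top-sorted : ∀ p q r → Sorted₃ Top p q r
        Top-sorted = choose-pair (λ (p , q) → q , p) (λ s≤a a≤b → inj₂ (≤-trans s≤a a≤b , a≤b))

        finish : ∀ {x y a b} → m < deg x y → E x y a ≡ true → m * (W x a + W y a) < 3 * K →
          b ≢ a → Good π x y b → deg x a ≤ deg y a → ⊥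
        finish {x} {y} {a} {b} m<d Exya good-a b≢a (Exyb , good-b) a≤ with ≤-total (deg x b) (deg y b)
        ... | inj₁ b≤ = large-centre m≡ l₀≥
          (large⇒m m (deg x y) (deg x y ∸ 2) m<d (deg≤∸2 (deg x y)))
          (smallest⇒q m q r (deg x a) (capacity x a b) m≡ (smallest-x Exya good-a) (deg≤capacity x a b))
          (middle⇒2q m q r (deg y a) (capacity y a b) m≡ (middle-y Exya a≤ good-a) (deg≤capacity y a b))
          (smallest⇒q m q r (deg x b) (capacity x b a) m≡ (smallest-x Exyb good-b) (deg≤capacity x b a))
          (middle⇒2q m q r (deg y b) (capacity y b a) m≡ (middle-y Exyb b≤ good-b) (deg≤capacity y b a))
          (stuck-at Exya Exyb b≢a)
        ... | inj₂ b≥ = large-centre m≡ l₀≥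
          (large⇒m m (deg x y) (deg x y ∸ 2) m<d (deg≤∸2 (deg x y)))
          (smallest⇒q m q r (deg x a) (capacity x a b) m≡ (smallest-x Exya good-a) (deg≤capacity x a b))
          (middle⇒2q m q r (deg y a) (capacity y a b) m≡ (middle-y Exya a≤ good-a) (deg≤capacity y a b))
          (smallest⇒q m q r (deg y b) (capacity y b a) m≡ (smallest-y Exyb good-b) (deg≤capacity y b a))
          (middle⇒2q m q r (deg x b) (capacity x b a) m≡ (middle-x Exyb b≥ good-b) (deg≤capacity x b a))
          (mirror (stuck-at Exya Exyb b≢a))

        module _ {x y a : Fin n} (over : sum (excess x y) < sum (charge π x y) * 3) (max : ∀ z → charge π x y z ≤ charge π x y a)
          (Exya : E x y a ≡ true) (light : w x y a < 3 * K) (xa≤ : deg x a ≤ deg x y) (ya≤ : deg y a ≤ deg x y) where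

          m<d : m < deg x y
          m<d = top-large Exya light xa≤ ya≤

          no-partner : (∃[ b ] b ≢ a × Good π x y b × false ≡ false) → ⊥
          no-partner (b , b≢a , (Exyb , good-b) , _) = by-size (≤-total (deg x a) (deg y a))
            where
            by-size : deg x a ≤ deg y a ⊎ deg y a ≤ deg x a → ⊥
            by-size (inj₁ a≤) = finish m<d Exya (light⇒good {x} {y} {a} light) b≢a (Exyb , good-b) a≤
            by-size (inj₂ a≥) = finish (subst (m <_) (deg-sym x y) m<d) (trans (E-swap y x a) Exya)
              (swap-good {x} {y} {a} (light⇒good {x} {y} {a} light)) b≢a
              (trans (E-swap y x b) Exyb , swap-good {x} {y} {b} good-b) a≥

          not-crowded : ¬ (m * K < (1 + sum (λ (_ : Fin n) → 0)) * (m * W x y + charge π x y a * 3))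
          not-crowded crowded = crowded-none {m} {K} {deg x y} {W x y} {charge π x y a} {w x y a} 19≤m m<d (deg*W Exya) (charge-room π Exya light)
            (subst (λ t → m * K < (1 + t) * (m * W x y + charge π x y a * 3)) (trans (sum-const n 0) (*-zeroʳ n)) crowded)

          top : ⊥
          top = [ no-partner , not-crowded ]′ (good-partner π (λ _ → false) Exya max over)

        sparse : ¬ (m * (n * n) < size³ + m * n)
        sparse dense =
          let x , y , over = dense⇒overcharged π (λ x y z _ _ → covers-of Top? (λ (p , q) → q , p) Top-sorted x y z) dense
              a , max , Exya , light , chosen = most-charged π over
              xa≤ , ya≤ = does≡true (Top? (deg x y) (deg x a) (deg y a)) chosen
          in top over max Exya light xa≤ ya≤

      -- The centre carries few leaves: assign a light edge to its pair of smallest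
      -- degree if the two other pairs leave enough room, and else to its largest pair.
      module FewCentral (l₀< : l₀ < q + r) where

        -- After the places of a and b are removed, `l₀ + 2 ≤ d` leaves l₀ places on the centre, and
        -- `m + l₀ + 2 ≤ 2 * a` leaves room for l₀ plus half of the side leaves. If sorted degrees
        -- violate this, either the smallest is at most l₀ + 1 (narrow), or twice the middle one,
        -- hence also twice the smallest, is at most m + l₀ + 1 (wide); both are stated in `Large`
        -- as seen from the largest pair.
        Small Large R : ℕ → ℕ → ℕ → Set
        Small d a b = (d ≤ a × d ≤ b) × l₀ + 2 ≤ d × m + l₀ + 2 ≤ 2 * a × m + l₀ + 2 ≤ 2 * b
        Large d a b = (a ≤ d × b ≤ d) × (a ≤ l₀ + 1 ⊎ b ≤ l₀ + 1 ⊎ (2 * a ≤ m + l₀ + 1 × 2 * b ≤ m + l₀ + 1))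
        R d a b = Small d a b ⊎ Large d a b

        R? : ∀ d a b → Dec (R d a b)
        R? d a b =
          ((d ≤? a ×-dec d ≤? b) ×-dec l₀ + 2 ≤? d ×-dec m + l₀ + 2 ≤? 2 * a ×-dec m + l₀ + 2 ≤? 2 * b)
          ⊎-dec ((a ≤? d ×-dec b ≤? d) ×-dec (a ≤? l₀ + 1 ⊎-dec b ≤? l₀ + 1 ⊎-dec (2 * a ≤? m + l₀ + 1 ×-dec 2 * b ≤? m + l₀ + 1)))

        R-sym : ∀ {d a b} → R d a b → R d b a
        R-sym (inj₁ ((p , q) , s , t , u))           = inj₁ ((q , p) , s , u , t)
        R-sym (inj₂ ((p , q) , inj₁ s))              = inj₂ ((q , p) , inj₂ (inj₁ s))
        R-sym (inj₂ ((p , q) , inj₂ (inj₁ s)))       = inj₂ ((q , p) , inj₁ s)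
        R-sym (inj₂ ((p , q) , inj₂ (inj₂ (s , t)))) = inj₂ ((q , p) , inj₂ (inj₂ (t , s)))

        pred-≤ : ∀ {u v} → ¬ (v + 2 ≤ u) → u ≤ v + 1
        pred-≤ {u} {v} h = ≤-pred (subst (suc u ≤_) (+-suc v 1) (≰⇒> h))

        R-ends : ∀ {s a b} → s ≤ a → a ≤ b → R s a b ⊎ R b s a
        R-ends {s} {a} {b} s≤a a≤b with l₀ + 2 ≤? s | m + l₀ + 2 ≤? 2 * a
        ... | yes h₁ | yes h₂ = inj₁ (inj₁ ((s≤a , ≤-trans s≤a a≤b) , h₁ , h₂ , ≤-trans h₂ (*-monoʳ-≤ 2 a≤b)))
        ... | no h₁  | _      = inj₂ (inj₂ ((≤-trans s≤a a≤b , a≤b) , inj₁ (pred-≤ h₁)))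
        ... | yes _  | no h₂  = inj₂ (inj₂ ((≤-trans s≤a a≤b , a≤b) , inj₂ (inj₂ (≤-trans (*-monoʳ-≤ 2 s≤a) (pred-≤ h₂) , pred-≤ h₂))))

        π : Fin n → Fin n → Fin n → Bool
        π x y z = does (R? (deg x y) (deg x z) (deg y z))

        q≥6 : 6 ≤ q
        q≥6 = q≥6-of m q r m≡ r≤2 19≤m

        small-finish : ∀ {x y a b} ε → deg x y ≡ ε + 1 → E x y a ≡ true → E x y b ≡ true → b ≢ a →
          w x y a < 3 * K → Small (deg x y) (deg x a) (deg y a) →
          NearlyLight m ε K (W x y) (W x b) (W y b) → deg x a ≤ deg y a → ⊥
        small-finish {x} {y} {a} {b} ε deg≡ Exya Exyb b≢a light ((D≤xa , D≤ya) , l₀≤D , l₀≤xa , _) near a≤ =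
          by-size (≤-total (deg x b) (deg y b))
          where
          m<a₂ : m < deg y a
          m<a₂ = light⇒largest m {K} {deg x y} {deg x a} {deg y a} {W x y} {W x a} {W y a} (deg*W Exya) (side-weight Exya) (side-weight′ Exya) D≤ya a≤
            (subst (_< 3 * K) (cong (m *_) (rotate (W x y) (W x a) (W y a))) light)
            where
            rotate : ∀ a b c → a + (b + c) ≡ c + (a + b)
            rotate a b c = solve (a ∷ b ∷ c ∷ [])
          centre : ε + 1 ≤ deg x y ∸ 2 + 2
          centre = subst (_≤ deg x y ∸ 2 + 2) deg≡ (deg≤∸2 (deg x y))
          eD : (ε + 1) * W x y ≡ K
          eD = subst (λ d → d * W x y ≡ K) deg≡ (deg*W Exya)
          by-size : deg x b ≤ deg y b ⊎ deg y b ≤ deg x b → ⊥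
          by-size (inj₁ b≤) = small-case {q = q} {r} {a₁ = deg x a} {deg y a} {deg x b} {deg y b} {K} {W x y} {W x b} {W y b} ε
            19≤m m≡ r≤2 l₀< centre (deg≤capacity x a b) (deg≤capacity y a b) (deg≤capacity x b a) (deg≤capacity y b a)
            (subst (l₀ + 2 ≤_) deg≡ l₀≤D) (subst (_≤ deg x a) deg≡ D≤xa) a≤ l₀≤xa m<a₂
            eD (side-weight Exyb) (side-weight′ Exyb) b≤ near (stuck-at Exya Exyb b≢a)
          by-size (inj₂ b≥) = small-case {q = q} {r} {a₁ = deg x a} {deg y a} {deg y b} {deg x b} {K} {W x y} {W y b} {W x b} ε
            19≤m m≡ r≤2 l₀< centre (deg≤capacity x a b) (deg≤capacity y a b) (deg≤capacity y b a) (deg≤capacity x b a)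
            (subst (l₀ + 2 ≤_) deg≡ l₀≤D) (subst (_≤ deg x a) deg≡ D≤xa) a≤ l₀≤xa m<a₂
            eD (side-weight′ Exyb) (side-weight Exyb) b≥
            (subst (λ u → m * ((ε + 3) * W x y + ε * u) < 3 * (ε + 3) * K) (+-comm (W x b) (W y b)) near)
            (mirror (stuck-at Exya Exyb b≢a))

        -- As xab is not an edge, `xa` and `xb` each lose one place to the trunk instead of two,
        -- which makes up for rounding; `ya` has a huge degree by `narrow⇒m≤`.
        narrow-finish : ∀ {x y a b} → m < deg x y → E x y a ≡ true → m * (W x a + W y a) < 3 * K →
          b ≢ a → Good π x y b → E x a b ≡ false → deg x a ≤ l₀ + 1 → ⊥
        narrow-finish {x} {y} {a} {b} m<d Exya good-a b≢a (Exyb , good-b) ¬Exab s≤ = by-size (≤-total (deg x b) (deg y b))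
          where
          m<s : m < 3 * deg x a
          m<s = smallest-x Exya good-a
          ¬Exba : E x b a ≡ false
          ¬Exba = trans (E-flip x b a) ¬Exab
          l₀≥ : q ≤ l₀
          l₀≥ = narrow⇒q≤l₀ m q r l₀ (deg x a) m≡ m<s s≤
          c₁≥ : q ≤ capacity x a b
          c₁≥ = smallest⇒q′ m q r (deg x a) (capacity x a b) m≡ m<s (deg≤capacity′ x a b ¬Exab)
          c₂≥ : 2 * q + r ≤ capacity y a b + 1
          c₂≥ = huge⇒2q+r m q r (deg y a) (capacity y a b) m≡ q≥6
            (narrow⇒m≤ {m} {K} {deg x a} {deg y a} {W x a} {W y a} 19≤m (narrow-bound m q r l₀ (deg x a) m≡ r≤2 l₀< s≤) (side-weight Exya) (side-weight′ Exya) good-a)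
            (deg≤capacity y a b)
          c₀≥ : m ≤ deg x y ∸ 2 + 1
          c₀≥ = large⇒m m (deg x y) (deg x y ∸ 2) m<d (deg≤∸2 (deg x y))
          by-size : deg x b ≤ deg y b ⊎ deg y b ≤ deg x b → ⊥
          by-size (inj₁ b≤) = half-centre₂₄ m≡ r≤2 q≥6 l₀≥ c₀≥ c₁≥ c₂≥
            (smallest⇒q′ m q r (deg x b) (capacity x b a) m≡ (smallest-x Exyb good-b) (deg≤capacity′ x b a ¬Exba))
            (middle⇒2q+r m q r (deg y b) (capacity y b a) 2 m≡ r≤2 (middle-y Exyb b≤ good-b) (deg≤capacity y b a))
            (stuck-at Exya Exyb b≢a)
          by-size (inj₂ b≥) = half-centre₁₃ m≡ r≤2 q≥6 l₀≥ c₀≥ c₁≥ c₂≥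
            (smallest⇒q m q r (deg y b) (capacity y b a) m≡ (smallest-y Exyb good-b) (deg≤capacity y b a))
            (middle⇒2q+r m q r (deg x b) (capacity x b a) 1 m≡ r≤2 (middle-x Exyb b≥ good-b) (deg≤capacity′ x b a ¬Exba))
            (mirror (stuck-at Exya Exyb b≢a))

        -- Now yab is not an edge, which saves a place on `ya` and `yb`; `xa` has enough room
        -- already, because q ≤ l₀ and its degree is at least l₀ + 2.
        wide-finish : ∀ {x y a b} → m < deg x y → E x y a ≡ true → m * (W x a + W y a) < 3 * K →
          b ≢ a → Good π x y b → E y a b ≡ false → deg x a ≤ deg y a → l₀ + 2 ≤ deg x a → 2 * deg y a ≤ m + l₀ + 1 → ⊥
        wide-finish {x} {y} {a} {b} m<d Exya good-a b≢a (Exyb , good-b) ¬Eyab a≤ s≥ ya≤ = by-size (≤-total (deg x b) (deg y b))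
          where
          ¬Eyba : E y b a ≡ false
          ¬Eyba = trans (E-flip y b a) ¬Eyab
          ya> : 2 * m < 3 * deg y a
          ya> = middle-y Exya a≤ good-a
          l₀≥ : q ≤ l₀
          l₀≥ = wide⇒q≤l₀ m q r l₀ (deg y a) m≡ ya> ya≤
          c₁≥ : q ≤ capacity x a b
          c₁≥ = wide⇒q≤c q l₀ (deg x a) (capacity x a b) l₀≥ s≥ (deg≤capacity x a b)
          c₂≥ : 2 * q + r ≤ capacity y a b + 1
          c₂≥ = middle⇒2q+r m q r (deg y a) (capacity y a b) 1 m≡ r≤2 ya> (deg≤capacity′ y a b ¬Eyab)
          c₀≥ : m ≤ deg x y ∸ 2 + 1
          c₀≥ = large⇒m m (deg x y) (deg x y ∸ 2) m<d (deg≤∸2 (deg x y))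
          by-size : deg x b ≤ deg y b ⊎ deg y b ≤ deg x b → ⊥
          by-size (inj₁ b≤) = half-centre₁₃ m≡ r≤2 q≥6 l₀≥ c₀≥ c₁≥ c₂≥
            (smallest⇒q m q r (deg x b) (capacity x b a) m≡ (smallest-x Exyb good-b) (deg≤capacity x b a))
            (middle⇒2q+r m q r (deg y b) (capacity y b a) 1 m≡ r≤2 (middle-y Exyb b≤ good-b) (deg≤capacity′ y b a ¬Eyba))
            (stuck-at Exya Exyb b≢a)
          by-size (inj₂ b≥) = half-centre₂₄ m≡ r≤2 q≥6 l₀≥ c₀≥ c₁≥ c₂≥
            (smallest⇒q′ m q r (deg y b) (capacity y b a) m≡ (smallest-y Exyb good-b) (deg≤capacity′ y b a ¬Eyba))
            (middle⇒2q+r m q r (deg x b) (capacity x b a) 2 m≡ r≤2 (middle-x Exyb b≥ good-b) (deg≤capacity x b a))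
            (mirror (stuck-at Exya Exyb b≢a))

        module _ {x y a : Fin n} (over : sum (excess x y) < sum (charge π x y) * 3) (max : ∀ z → charge π x y z ≤ charge π x y a)
          (Exya : E x y a ≡ true) (light : w x y a < 3 * K) where

          Eyxa : E y x a ≡ true
          Eyxa = trans (E-swap y x a) Exya

          good-a : m * (W x a + W y a) < 3 * K
          good-a = light⇒good {x} {y} {a} light

          room : charge π x y a + m * (W x y + (W x a + W y a)) ≤ 3 * K
          room = charge-room π Exya light

          room′ : charge π x y a + m * (W x y + (W y a + W x a)) ≤ 3 * K
          room′ = subst (λ t → charge π x y a + m * (W x y + t) ≤ 3 * K) (+-comm (W x a) (W y a)) room

          module _ (xa≤ : deg x a ≤ deg x y) (ya≤ : deg y a ≤ deg x y) where

            m<d : m < deg x y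
            m<d = top-large Exya light xa≤ ya≤

            m<d′ : m < deg y x
            m<d′ = subst (m <_) (deg-sym x y) m<d

            -- The excluded vertices are those completing xa to an edge. They number at most l₀ + 1,
            -- too few to account for the overcharge of xy.
            narrow-x : deg x a ≤ l₀ + 1 → ⊥
            narrow-x s≤ = [ found , crowded ]′ (good-partner π (E x a) Exya max over)
              where
              found : (∃[ b ] b ≢ a × Good π x y b × E x a b ≡ false) → ⊥
              found (b , b≢a , good-b , ¬E) = narrow-finish m<d Exya good-a b≢a good-b ¬E s≤
              crowded : ¬ (m * K < (1 + deg x a) * (m * W x y + charge π x y a * 3))
              crowded = crowded-narrow {m} {K} {deg x a} {W x a} {W y a} {W x y} {charge π x y a} 19≤m (smallest-x Exya good-a)
                (narrow-bound m q r l₀ (deg x a) m≡ r≤2 l₀< s≤) (side-weight Exya)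
                (weight-antitone {K} {deg y a} {deg x y} {W y a} {W x y} K>0 (side-weight′ Exya) (deg*W Exya) ya≤) room

            narrow-y : deg y a ≤ l₀ + 1 → ⊥
            narrow-y s≤ = [ found , crowded ]′ (good-partner π (E y a) Exya max over)
              where
              found : (∃[ b ] b ≢ a × Good π x y b × E y a b ≡ false) → ⊥
              found (b , b≢a , (Exyb , good-b) , ¬E) = narrow-finish m<d′ Eyxa (swap-good {x} {y} {a} good-a) b≢a
                (trans (E-swap y x b) Exyb , swap-good {x} {y} {b} good-b) ¬E s≤
              crowded : ¬ (m * K < (1 + deg y a) * (m * W x y + charge π x y a * 3))
              crowded = crowded-narrow {m} {K} {deg y a} {W y a} {W x a} {W x y} {charge π x y a} 19≤m (smallest-y Exya good-a)
                (narrow-bound m q r l₀ (deg y a) m≡ r≤2 l₀< s≤) (side-weight′ Exya)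
                (weight-antitone {K} {deg x a} {deg x y} {W x a} {W x y} K>0 (side-weight Exya) (deg*W Exya) xa≤) room′

            -- Here the vertices completing the larger side ya are excluded, at most (2m + 2)/3 of
            -- them.
            wide-y : deg x a ≤ deg y a → l₀ + 2 ≤ deg x a → 2 * deg y a ≤ m + l₀ + 1 → ⊥
            wide-y a≤ s≥ a₂≤ = [ found , crowded ]′ (good-partner π (E y a) Exya max over)
              where
              found : (∃[ b ] b ≢ a × Good π x y b × E y a b ≡ false) → ⊥
              found (b , b≢a , good-b , ¬E) = wide-finish m<d Exya good-a b≢a good-b ¬E a≤ s≥ a₂≤
              crowded : ¬ (m * K < (1 + deg y a) * (m * W x y + charge π x y a * 3))
              crowded = crowded-wide {m} {K} {deg x a} {deg y a} {W x a} {W y a} {W x y} {charge π x y a} 19≤m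
                (middle-positive m (deg y a) (middle-y Exya a≤ good-a))
                (wide-bound m q r l₀ (deg y a) m≡ r≤2 l₀< a₂≤)
                (side-weight Exya) (side-weight′ Exya) a≤ room

            wide-x : deg y a ≤ deg x a → l₀ + 2 ≤ deg y a → 2 * deg x a ≤ m + l₀ + 1 → ⊥
            wide-x a≤ s≥ a₂≤ = [ found , crowded ]′ (good-partner π (E x a) Exya max over)
              where
              found : (∃[ b ] b ≢ a × Good π x y b × E x a b ≡ false) → ⊥
              found (b , b≢a , (Exyb , good-b) , ¬E) = wide-finish m<d′ Eyxa (swap-good {x} {y} {a} good-a) b≢a
                (trans (E-swap y x b) Exyb , swap-good {x} {y} {b} good-b) ¬E a≤ s≥ a₂≤
              crowded : ¬ (m * K < (1 + deg x a) * (m * W x y + charge π x y a * 3))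
              crowded = crowded-wide {m} {K} {deg y a} {deg x a} {W y a} {W x a} {W x y} {charge π x y a} 19≤m
                (middle-positive m (deg x a) (middle-x Exya a≤ good-a))
                (wide-bound m q r l₀ (deg x a) m≡ r≤2 l₀< a₂≤)
                (side-weight′ Exya) (side-weight Exya) a≤ room′

            wide : 2 * deg x a ≤ m + l₀ + 1 → 2 * deg y a ≤ m + l₀ + 1 → ⊥
            wide xa≤′ ya≤′ = by-size (l₀ + 2 ≤? deg x a) (l₀ + 2 ≤? deg y a) (≤-total (deg x a) (deg y a))
              where
              by-size : Dec (l₀ + 2 ≤ deg x a) → Dec (l₀ + 2 ≤ deg y a) → deg x a ≤ deg y a ⊎ deg y a ≤ deg x a → ⊥
              by-size (no h)   _        _         = narrow-x (pred-≤ h)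
              by-size (yes _)  (no h)   _         = narrow-y (pred-≤ h)
              by-size (yes h₁) (yes h₂) (inj₁ a≤) = wide-y a≤ h₁ ya≤′
              by-size (yes h₁) (yes h₂) (inj₂ a≥) = wide-x a≥ h₂ xa≤′

          large : Large (deg x y) (deg x a) (deg y a) → ⊥
          large ((p , q) , inj₁ s)              = narrow-x p q s
          large ((p , q) , inj₂ (inj₁ s))       = narrow-y p q s
          large ((p , q) , inj₂ (inj₂ (s , t))) = wide p q s t

          small : Small (deg x y) (deg x a) (deg y a) → ⊥
          small is-small@((D≤xa , D≤ya) , l₀≤D , l₀≤xa , l₀≤ya) = partner (near-partner π ε deg≡ ε≥1 Exya light over)
            where
            ε = deg x y ∸ 1
            deg≡ : deg x y ≡ ε + 1
            deg≡ = sym (m∸n+n≡m (edge⇒deg Exya))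
            ε≥1 : 1 ≤ ε
            ε≥1 = ∸-monoˡ-≤ 1 (≤-trans (m≤n+m 2 l₀) l₀≤D)
            light′ : w y x a < 3 * K
            light′ = subst (_< 3 * K) (cong (m *_) (cong₂ _+_ (W-sym x y) (+-comm (W x a) (W y a)))) light
            partner : (∃[ b ] b ≢ a × E x y b ≡ true × ε * (w x y b ∸ 3 * K) < (3 * K ∸ w x y a) * 3) → ⊥
            partner (b , b≢a , Exyb , close) = by-size (≤-total (deg x a) (deg y a))
              where
              near : NearlyLight m ε K (W x y) (W x b) (W y b)
              near = near-from-charges {m} {ε} {K} {W x y} {W x a + W y a} {w x y a} {w x y b} (W x b + W y b) refl light refl close
              near′ : NearlyLight m ε K (W y x) (W y b) (W x b)
              near′ = subst₂ (λ d u → m * ((ε + 3) * d + ε * u) < 3 * (ε + 3) * K) (W-sym x y) (+-comm (W x b) (W y b)) near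
              by-size : deg x a ≤ deg y a ⊎ deg y a ≤ deg x a → ⊥
              by-size (inj₁ a≤) = small-finish ε deg≡ Exya Exyb b≢a light is-small near a≤
              by-size (inj₂ a≥) = small-finish ε (trans (deg-sym y x) deg≡) Eyxa (trans (E-swap y x b) Exyb) b≢a light′
                (subst (λ d → Small d (deg y a) (deg x a)) (deg-sym x y) ((D≤ya , D≤xa) , l₀≤D , l₀≤ya , l₀≤xa)) near′ a≥

        sparse : ¬ (m * (n * n) < size³ + m * n)
        sparse dense =
          let x , y , over = dense⇒overcharged π (λ x y z _ _ → covers-of R? R-sym (choose-pair R-sym R-ends) x y z) dense
              a , max , Exya , light , chosen = most-charged π over
          in [ small over max Exya light , large over max Exya light ]′ (does≡true (R? (deg x y) (deg x a) (deg y a)) chosen)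

      size-bound : size³ + m * n ≤ m * (n * n)
      size-bound with q + r ≤? l₀
      ... | yes l₀≥ = ≮⇒≥ (ManyCentral.sparse l₀≥)
      ... | no l₀<  = ≮⇒≥ (FewCentral.sparse (≰⇒> l₀<))

-- Three-element subsets as unordered triples.

module Triples where

  open import Defs
  open import Data.Bool using (Bool; true; false)
  import Data.Bool.Properties as Bool
  open import Data.Nat using (ℕ; zero; suc; _+_; _*_; _≤_; z≤n)
  open import Data.Nat.Properties hiding (_≟_)
  open import Data.Fin using (Fin; zero; suc)
  open import Data.Fin.Properties using (_≟_)
  open import Data.Fin.Subset using (Subset; inside; outside; ⁅_⁆; _∪_; _∈_; _∉_; _-_; ∣_∣)
  open import Data.Fin.Subset.Properties
  open import Data.Vec using ([]; _∷_; lookup; here; there)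
  open import Data.Vec.Properties using (≡-dec; lookup⇒[]=)
  open import Data.List using (List; []; _∷_; length)
  import Data.List.Membership.DecPropositional as DecMembership
  open import Data.List.Relation.Unary.Any using (here; there)
  import Data.List.Relation.Unary.All as All
  open import Data.List.Relation.Unary.Unique.Propositional using (Unique; _∷_)
  open import Data.Product using (_,_; ∃-syntax)
  open import Data.Sum using (_⊎_; inj₁; inj₂; [_,_]′)
  open import Data.Empty using (⊥)
  open import Function using (_∘_)
  open import Relation.Nullary using (Dec; yes; no; does; contradiction)
  open import Relation.Nullary.Decidable using (dec-true)
  open import Relation.Binary.PropositionalEquality
  open import Algebra.Properties.Semiring.Sum +-*-semiring using (sum; *-distribʳ-sum)
  open ThreeGraphs

  _≟ˢ_ : ∀ {n} (p q : Subset n) → Dec (p ≡ q)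
  _≟ˢ_ = ≡-dec Bool._≟_

  x∉p-x : ∀ {n} {p : Subset n} {x} → x ∉ p - x
  x∉p-x {p = s ∷ p} {suc x} (there x∈) = x∉p-x {p = p} x∈

  x∈p-y⇒x∈p : ∀ {n} {p : Subset n} {x y} → x ∈ p - y → x ∈ p
  x∈p-y⇒x∈p {p = p} {y = y} = p─q⊆p p ⁅ y ⁆

  x∈p-y⇒x≢y : ∀ {n} {p : Subset n} {x y} → x ∈ p - y → x ≢ y
  x∈p-y⇒x≢y x∈ refl = x∉p-x x∈

  x∈p∧x≢y⇒x∈p-y′ : ∀ {n} {p : Subset n} {x y} → x ∈ p → x ≢ y → x ∈ p - y
  x∈p∧x≢y⇒x∈p-y′ {y = y} x∈p x≢y = x∈p∧x∉q⇒x∈p─q x∈p (x≢y ∘ x∈⁅y⁆⇒x≡y y)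

  ∣p∣≡1+∣p-x∣ : ∀ {n} {p : Subset n} {x} → x ∈ p → ∣ p ∣ ≡ suc ∣ p - x ∣
  ∣p∣≡1+∣p-x∣ {p = inside ∷ p}  {zero}  here       = cong suc (cong ∣_∣ (sym (p─⊥≡p p)))
  ∣p∣≡1+∣p-x∣ {p = inside ∷ p}  {suc x} (there x∈) = cong suc (∣p∣≡1+∣p-x∣ x∈)
  ∣p∣≡1+∣p-x∣ {p = outside ∷ p} {suc x} (there x∈) = ∣p∣≡1+∣p-x∣ x∈

  ∣p-x∣≡ : ∀ {n} {p : Subset n} {x j} → ∣ p ∣ ≡ suc j → x ∈ p → ∣ p - x ∣ ≡ j
  ∣p-x∣≡ ∣p∣≡ x∈p = suc-injective (trans (sym (∣p∣≡1+∣p-x∣ x∈p)) ∣p∣≡)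

  element : ∀ {n} {p : Subset n} {j} → ∣ p ∣ ≡ suc j → ∃[ x ] x ∈ p
  element {p = inside ∷ p}  _   = zero , here
  element {p = outside ∷ p} eq with element {p = p} eq
  ... | x , x∈p = suc x , there x∈p

  no-element : ∀ {n} {p : Subset n} {x} → ∣ p ∣ ≡ 0 → x ∉ p
  no-element ∣p∣≡0 x∈p = 0≢1+n (trans (sym ∣p∣≡0) (∣p∣≡1+∣p-x∣ x∈p))

  tri : ∀ {n} → Fin n → Fin n → Fin n → Subset n
  tri x y z = ⁅ x ⁆ ∪ (⁅ y ⁆ ∪ ⁅ z ⁆)

  module _ {n : ℕ} {x y z : Fin n} where

    ∈tri⁻ : ∀ {u} → u ∈ tri x y z → u ≡ x ⊎ u ≡ y ⊎ u ≡ z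
    ∈tri⁻ u∈ with x∈p∪q⁻ ⁅ x ⁆ _ u∈
    ... | inj₁ u∈x = inj₁ (x∈⁅y⁆⇒x≡y x u∈x)
    ... | inj₂ u∈yz with x∈p∪q⁻ ⁅ y ⁆ ⁅ z ⁆ u∈yz
    ...   | inj₁ u∈y = inj₂ (inj₁ (x∈⁅y⁆⇒x≡y y u∈y))
    ...   | inj₂ u∈z = inj₂ (inj₂ (x∈⁅y⁆⇒x≡y z u∈z))

    tri₁ : x ∈ tri x y z
    tri₁ = x∈p∪q⁺ (inj₁ (x∈⁅x⁆ x))

    tri₂ : y ∈ tri x y z
    tri₂ = x∈p∪q⁺ (inj₂ (x∈p∪q⁺ (inj₁ (x∈⁅x⁆ y))))

    tri₃ : z ∈ tri x y z
    tri₃ = x∈p∪q⁺ (inj₂ (x∈p∪q⁺ (inj₂ (x∈⁅x⁆ z))))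

    ≡tri : ∀ {e : Subset n} → x ∈ e → y ∈ e → z ∈ e → (∀ {u} → u ∈ e → u ≡ x ⊎ u ≡ y ⊎ u ≡ z) → e ≡ tri x y z
    ≡tri x∈ y∈ z∈ only = ⊆-antisym
      (λ u∈ → [ (λ { refl → tri₁ }) , [ (λ { refl → tri₂ }) , (λ { refl → tri₃ }) ]′ ]′ (only u∈))
      (λ u∈ → [ (λ { refl → x∈ }) , [ (λ { refl → y∈ }) , (λ { refl → z∈ }) ]′ ]′ (∈tri⁻ u∈))

    tri-of : ∀ {e : Subset n} → ∣ e ∣ ≡ 3 → x ∈ e → y ∈ e - x → z ∈ e - x - y → e ≡ tri x y z
    tri-of {e} ∣e∣≡3 x∈ y∈ z∈ = ≡tri x∈ (x∈p-y⇒x∈p y∈) (x∈p-y⇒x∈p (x∈p-y⇒x∈p {p = e - x} z∈)) only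
      where
      only : ∀ {u} → u ∈ e → u ≡ x ⊎ u ≡ y ⊎ u ≡ z
      only {u} u∈ with u ≟ x | u ≟ y | u ≟ z
      ... | yes u≡x | _       | _       = inj₁ u≡x
      ... | no _    | yes u≡y | _       = inj₂ (inj₁ u≡y)
      ... | no _    | no _    | yes u≡z = inj₂ (inj₂ u≡z)
      ... | no u≢x  | no u≢y  | no u≢z  = contradiction
        (x∈p∧x≢y⇒x∈p-y′ (x∈p∧x≢y⇒x∈p-y′ (x∈p∧x≢y⇒x∈p-y′ u∈ u≢x) u≢y) u≢z)
        (no-element (∣p-x∣≡ (∣p-x∣≡ (∣p-x∣≡ ∣e∣≡3 x∈) y∈) z∈))

  tri-swap : ∀ {n} (x y z : Fin n) → tri x y z ≡ tri y x z
  tri-swap x y z = ≡tri tri₂ tri₁ tri₃ (λ u∈ → [ inj₂ ∘ inj₁ , [ inj₁ , inj₂ ∘ inj₂ ]′ ]′ (∈tri⁻ u∈))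

  tri-flip : ∀ {n} (x y z : Fin n) → tri x y z ≡ tri x z y
  tri-flip x y z = cong (⁅ x ⁆ ∪_) (∪-comm ⁅ y ⁆ ⁅ z ⁆)

  -- A third element and a second one, both different from x, would both have to be z.
  tri-distinct : ∀ {n} {x z : Fin n} → ∣ tri x x z ∣ ≢ 3
  tri-distinct {x = x} {z} ∣e∣≡3 with ∣p-x∣≡ {p = tri x x z} ∣e∣≡3 (tri₁ {x = x} {x} {z})
  ... | ∣e-x∣≡2 with element {p = tri x x z - x} ∣e-x∣≡2
  ... | y , y∈ with element {p = tri x x z - x - y} (∣p-x∣≡ {p = tri x x z - x} ∣e-x∣≡2 y∈)
  ... | u , u∈ = clash (∈tri⁻ (x∈p-y⇒x∈p {p = tri x x z} y∈)) (∈tri⁻ (x∈p-y⇒x∈p {p = tri x x z} (x∈p-y⇒x∈p {p = tri x x z - x} u∈)))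
    where
    y≢x = x∈p-y⇒x≢y {p = tri x x z} y∈
    u≢x = x∈p-y⇒x≢y {p = tri x x z} (x∈p-y⇒x∈p {p = tri x x z - x} u∈)
    u≢y = x∈p-y⇒x≢y {p = tri x x z - x} u∈
    clash : y ≡ x ⊎ y ≡ x ⊎ y ≡ z → u ≡ x ⊎ u ≡ x ⊎ u ≡ z → ⊥
    clash (inj₁ y≡x)        _                  = y≢x y≡x
    clash (inj₂ (inj₁ y≡x)) _                  = y≢x y≡x
    clash (inj₂ (inj₂ _))   (inj₁ u≡x)         = u≢x u≡x
    clash (inj₂ (inj₂ _))   (inj₂ (inj₁ u≡x))  = u≢x u≡x
    clash (inj₂ (inj₂ y≡z)) (inj₂ (inj₂ u≡z))  = u≢y (trans u≡z (sym y≡z))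

  sum-lookup : ∀ {n} (p : Subset n) → sum (λ x → ⟦ lookup p x ⟧) ≡ ∣ p ∣
  sum-lookup []            = refl
  sum-lookup (inside ∷ p)  = cong suc (sum-lookup p)
  sum-lookup (outside ∷ p) = sum-lookup p

  below-indicator : ∀ {n} (p : Subset n) (f : Fin n → ℕ) {j} c → ∣ p ∣ ≡ j → (∀ {x} → x ∈ p → c ≤ f x) → j * c ≤ sum f
  below-indicator p f c refl h = ≤-trans (≤-reflexive (trans (cong (_* c) (sym (sum-lookup p))) (*-distribʳ-sum c (λ x → ⟦ lookup p x ⟧))))
    (sum-mono pointwise)
    where
    pointwise : ∀ x → ⟦ lookup p x ⟧ * c ≤ f x
    pointwise x with lookup p x in eq
    ... | true  = ≤-trans (≤-reflexive (*-identityˡ c)) (h (lookup⇒[]= x p eq))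
    ... | false = z≤n

  -- Three choices for x, then two for y and one for z; the constants 2, 1, 1 passed to
  -- `below-indicator` bound the number of completions of each choice.
  orderings : ∀ {n} {e : Subset n} → ∣ e ∣ ≡ 3 → 6 ≤ sum³ (λ x y z → ⟦ does (tri x y z ≟ˢ e) ⟧)
  orderings {e = e} ∣e∣≡3 =
    below-indicator e (λ x → sum λ y → sum λ z → is-e x y z) 2 ∣e∣≡3 λ {x} x∈ →
    below-indicator (e - x) (λ y → sum λ z → is-e x y z) 1 (∣p-x∣≡ ∣e∣≡3 x∈) λ {y} y∈ →
    below-indicator (e - x - y) (λ z → is-e x y z) 1 (∣p-x∣≡ (∣p-x∣≡ ∣e∣≡3 x∈) y∈) λ {z} z∈ →
    ≤-reflexive (sym (cong ⟦_⟧ (dec-true (tri x y z ≟ˢ e) (sym (tri-of ∣e∣≡3 x∈ y∈ z∈)))))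
    where
    is-e : Fin _ → Fin _ → Fin _ → ℕ
    is-e x y z = ⟦ does (tri x y z ≟ˢ e) ⟧

  module _ {n : ℕ} where

    open DecMembership (_≟ˢ_ {n}) public using () renaming (_∈?_ to _∈ˡ?_)

    six-orderings : (es : List (Subset n)) → Unique es → All.All (λ e → ∣ e ∣ ≡ 3) es →
      6 * length es ≤ sum³ (λ x y z → ⟦ does (tri x y z ∈ˡ? es) ⟧)
    six-orderings []       _            _             = z≤n
    six-orderings (e ∷ es) (e∉es ∷ u) (∣e∣≡3 All.∷ h) = begin
      6 * suc (length es)
        ≡⟨ *-suc 6 (length es) ⟩
      6 + 6 * length es
        ≤⟨ +-mono-≤ (orderings {e = e} ∣e∣≡3) (six-orderings es u h) ⟩
      sum³ (λ x y z → ⟦ does (tri x y z ≟ˢ e) ⟧) + sum³ (λ x y z → ⟦ does (tri x y z ∈ˡ? es) ⟧)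
        ≡⟨ sym (sum³-+ (λ x y z → ⟦ does (tri x y z ≟ˢ e) ⟧) (λ x y z → ⟦ does (tri x y z ∈ˡ? es) ⟧)) ⟩
      sum³ (λ x y z → ⟦ does (tri x y z ≟ˢ e) ⟧ + ⟦ does (tri x y z ∈ˡ? es) ⟧)
        ≤⟨ sum³-mono (λ x y z → split (tri x y z)) ⟩
      sum³ (λ x y z → ⟦ does (tri x y z ∈ˡ? (e ∷ es)) ⟧) ∎
      where
      open ≤-Reasoning
      split : ∀ p → ⟦ does (p ≟ˢ e) ⟧ + ⟦ does (p ∈ˡ? es) ⟧ ≤ ⟦ does (p ∈ˡ? (e ∷ es)) ⟧
      split p with p ≟ˢ e | p ∈ˡ? es | p ∈ˡ? (e ∷ es)
      ... | yes refl | yes p∈es | _      = contradiction refl (All.lookup e∉es p∈es)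
      ... | yes refl | no _     | yes _  = ≤-refl
      ... | yes refl | no _     | no p∉  = contradiction (here refl) p∉
      ... | no _     | yes p∈es | yes _  = ≤-refl
      ... | no _     | yes p∈es | no p∉  = contradiction (there p∈es) p∉
      ... | no _     | no _     | _      = z≤n

  adjacency : ∀ {n} → RGraph 3 n → Graph n
  adjacency G = record
    { E        = λ x y z → does (tri x y z ∈ˡ? edges G)
    ; E-swap   = λ x y z → cong (λ p → does (p ∈ˡ? edges G)) (tri-swap x y z)
    ; E-flip   = λ x y z → cong (λ p → does (p ∈ˡ? edges G)) (tri-flip x y z)
    ; E-irrefl = irrefl
    }
    where
    irrefl : ∀ x z → does (tri x x z ∈ˡ? edges G) ≡ false
    irrefl x z with tri x x z ∈ˡ? edges G
    ... | yes e∈ = contradiction (All.lookup (uniform G) e∈) (tri-distinct {x = x} {z})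
    ... | no _   = refl

  size-adjacency : ∀ {n} (G : RGraph 3 n) → 6 * size G ≤ Graph.size³ (adjacency G)
  size-adjacency G = six-orderings (edges G) (unique G) (uniform G)

-- Trees with a trunk of at most two edges.

module TightTrees where

  open import Defs
  open import Data.Nat using (ℕ; _≤_; z≤n; s≤s)
  open import Data.Nat.Properties hiding (_≟_)
  open import Data.Fin using (Fin)
  open import Data.Fin.Subset using (Subset; _∈_; _∉_; _⊆_; _-_; ∣_∣; ⋃)
  open import Data.Fin.Subset.Properties using (x∈p∪q⁻; ∉⊥)
  open import Data.List using (List; []; _∷_; _++_; map)
  open import Data.List.Membership.Propositional using (find) renaming (_∈_ to _∈ˡ_)
  open import Data.List.Membership.Propositional.Properties using (∈-map⁺)
  open import Data.List.Relation.Unary.Any using (here; there)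
  open import Data.List.Relation.Unary.All as All using (All; []; _∷_)
  open import Data.List.Relation.Binary.Permutation.Propositional using (_↭_; ↭-sym; ↭-trans; ↭-reflexive)
  open import Data.List.Relation.Binary.Permutation.Propositional.Properties using (∈-resp-↭; ↭-length; ↭-empty-inv)
  open import Data.Product using (_×_; _,_; ∃-syntax; proj₁; proj₂)
  open import Data.Sum using (_⊎_; inj₁; inj₂; [_,_]′)
  open import Data.Empty using (⊥-elim)
  open import Function using (_∘_)
  open import Relation.Nullary using (contradiction)
  open import Relation.Binary.PropositionalEquality
  open Scheduling using (xy; xa; ya; xb; yb)
  open Triples

  ∈⋃⁻ : ∀ {n} (ps : List (Subset n)) {v} → v ∈ ⋃ ps → ∃[ p ] p ∈ˡ ps × v ∈ p
  ∈⋃⁻ []       v∈ = contradiction v∈ ∉⊥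
  ∈⋃⁻ (p ∷ ps) v∈ with x∈p∪q⁻ p (⋃ ps) v∈
  ... | inj₁ v∈p = p , here refl , v∈p
  ... | inj₂ v∈ps with ∈⋃⁻ ps v∈ps
  ...   | p′ , p′∈ , v∈p′ = p′ , there p′∈ , v∈p′

  record Trunk₂ {k} (T : RGraph 3 k) : Set where
    field
      {e₁ e₂} : Subset k
      {fs}    : List (Subset k)
      shape   : e₁ ∷ e₂ ∷ fs ↭ edges T
      proper  : ProperAfter (e₁ ∷ []) (e₂ ∷ fs)
      leaves  : ∀ v → v ∉ e₁ → v ∉ e₂ → IsLeaf T v

  trunk₂ : ∀ {k} {T : RGraph 3 k} {c} → IsTightTree T → IsMinTrunkSize T c → c ≤ 2 → 2 ≤ size T → Trunk₂ T
  trunk₂ {T = T} {c} (_ , spanning) ((T′ , (tight , (es , fs , es↭ , es++fs↭ , proper) , leaves) , size≡) , _) c≤2 2≤t =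
    go es es↭ es++fs↭ proper
    where
    leaf : ∀ {es} → es ↭ edges T′ → ∀ {v} → (∀ {e} → e ∈ˡ es → v ∉ e) → IsLeaf T v
    leaf es↭ {v} v∉ = leaves v (spanning v) λ v∈V → let p , p∈ , v∈p = ∈⋃⁻ (edges T′) v∈V in v∉ (∈-resp-↭ (↭-sym es↭) p∈) v∈p
    go : ∀ es → es ↭ edges T′ → es ++ fs ↭ edges T → Proper (es ++ fs) → Trunk₂ T
    go [] es↭ _ _ =
      let es′ , es′↭ , proper′ = tight in ⊥-elim (subst Proper (↭-empty-inv (↭-trans es′↭ (↭-sym es↭))) proper′)
    go (e₁ ∷ []) es↭ shape proper = single fs shape proper
      where
      single : ∀ fs → e₁ ∷ fs ↭ edges T → Proper (e₁ ∷ fs) → Trunk₂ T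
      single []        shape _      = contradiction (subst (2 ≤_) (sym (↭-length shape)) 2≤t) λ { (s≤s ()) }
      -- A trunk of one edge is enlarged by the next edge of the proper ordering; vertices outside
      -- both edges are still leaves.
      single (e₂ ∷ fs) shape proper = record
        { shape = shape ; proper = proper ; leaves = λ v v∉e₁ _ → leaf es↭ λ { (here refl) → v∉e₁ } }
    go (e₁ ∷ e₂ ∷ []) es↭ shape proper = record
      { shape = shape ; proper = proper ; leaves = λ v v∉e₁ v∉e₂ → leaf es↭ λ { (here refl) → v∉e₁ ; (there (here refl)) → v∉e₂ } }
    go (e₁ ∷ e₂ ∷ e₃ ∷ es) es↭ _ _ =
      contradiction (≤-trans (subst (3 ≤_) (trans (↭-length es↭) size≡) (s≤s (s≤s (s≤s z≤n)))) c≤2) λ { (s≤s (s≤s ())) }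

  module Hanging {k : ℕ} {T : RGraph 3 k} (trunk : Trunk₂ T) where

    open Trunk₂ trunk

    Hangs : Subset k → Set
    Hangs f = ∃[ v ] v ∈ f × v ∉ e₁ × v ∉ e₂ × (f - v ⊆ e₁ ⊎ f - v ⊆ e₂)

    Earlier : Subset k → Set
    Earlier p = p ∈ˡ edges T × (p ≡ e₁ ⊎ p ≡ e₂ ⊎ Hangs p)

    -- If f is attached to a hanging edge p, the leaf of p is not in f, so f is
    -- already attached to the trunk.
    hangs : ∀ {ps f} → f ∈ˡ edges T → All Earlier ps → e₁ ∈ˡ ps → e₂ ∈ˡ ps → Attaches ps f → Hangs f
    hangs {ps} {f} f∈ earlier e₁∈ e₂∈ (v , v∈f , v∉ps , any) with find any
    ... | p , p∈ , f-v⊆p = v , v∈f , All.lookup v∉ps e₁∈ , All.lookup v∉ps e₂∈ , below (proj₂ (All.lookup earlier p∈))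
      where
      below : p ≡ e₁ ⊎ p ≡ e₂ ⊎ Hangs p → f - v ⊆ e₁ ⊎ f - v ⊆ e₂
      below (inj₁ refl)        = inj₁ f-v⊆p
      below (inj₂ (inj₁ refl)) = inj₂ f-v⊆p
      below (inj₂ (inj₂ (u , u∈p , u∉e₁ , u∉e₂ , p-u⊆))) = [ inj₁ ∘ extend , inj₂ ∘ extend ]′ p-u⊆
        where
        u∉f : u ∉ f
        u∉f u∈f with leaves u u∉e₁ u∉e₂
        ... | e , _ , unique-e = All.lookup v∉ps p∈ (subst (v ∈_)
          (trans (sym (unique-e (f∈ , u∈f))) (unique-e (proj₁ (All.lookup earlier p∈) , u∈p))) v∈f)
        extend : ∀ {e} → p - u ⊆ e → f - v ⊆ e
        extend p-u⊆e w∈ = p-u⊆e (x∈p∧x≢y⇒x∈p-y′ (f-v⊆p w∈) λ { refl → u∉f (x∈p-y⇒x∈p w∈) })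

    all-hang : ∀ {ps fs} → All (_∈ˡ edges T) fs → All Earlier ps → e₁ ∈ˡ ps → e₂ ∈ˡ ps → ProperAfter ps fs → All Hangs fs
    all-hang []        _       _   _   []        = []
    all-hang (f∈ ∷ fs∈) earlier e₁∈ e₂∈ (at ∷ rest) =
      let h = hangs f∈ earlier e₁∈ e₂∈ at
      in h ∷ all-hang fs∈ ((f∈ , inj₂ (inj₂ h)) ∷ earlier) (there e₁∈) (there e₂∈) rest

  module _ {A : Set} (x y a b : A) where

    left right : Fin 5 → A
    left xy = x
    left xa = x
    left ya = y
    left xb = x
    left yb = y
    right xy = y
    right xa = a
    right ya = a
    right xb = b
    right yb = b

  -- The trunk consists of the edges xya and xyb.  A leaf edge is given by its leaf
  -- and by the pair of trunk vertices, of the five possible ones, that it contains.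
  record Broom {k} (T : RGraph 3 k) : Set where
    field
      x y a b     : Fin k
      leaf-edges  : List (Fin k × Fin 5)

    edge : Fin k × Fin 5 → Subset k
    edge (v , i) = tri v (left x y a b i) (right x y a b i)

    field
      x≢y : x ≢ y
      a≢x : a ≢ x
      a≢y : a ≢ y
      b≢x : b ≢ x
      b≢y : b ≢ y
      b≢a : b ≢ a
      shape  : tri x y a ∷ tri x y b ∷ map edge leaf-edges ↭ edges T
      fresh  : ∀ {v i} → (v , i) ∈ˡ leaf-edges → v ∉ tri x y a × v ∉ tri x y b
      leaves : ∀ v → v ∉ tri x y a → v ∉ tri x y b → IsLeaf T v

    -- v is a leaf, so it lies in one edge. Equality of the edges, rather than of the roles, is what
    -- the embedding needs.
    leaf-edge-unique : ∀ {v i j} → (v , i) ∈ˡ leaf-edges → (v , j) ∈ˡ leaf-edges → edge (v , i) ≡ edge (v , j)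
    leaf-edge-unique {v} {i} {j} i∈ j∈ with leaves v (proj₁ (fresh i∈)) (proj₂ (fresh i∈))
    ... | e , _ , unique-e = trans (sym (unique-e (in-T i∈ , tri₁))) (unique-e (in-T j∈ , tri₁))
      where
      in-T : ∀ {i} → (v , i) ∈ˡ leaf-edges → edge (v , i) ∈ˡ edges T
      in-T i∈ = ∈-resp-↭ shape (there (there (∈-map⁺ edge i∈)))

  broom : ∀ {k} {T : RGraph 3 k} → Trunk₂ T → Broom T
  broom {k} {T} trunk = build proper
    where
    open Trunk₂ trunk
    open Hanging trunk
    card : ∀ {e} → e ∈ˡ edges T → ∣ e ∣ ≡ 3
    card = All.lookup (uniform T)
    e₁∈ : e₁ ∈ˡ edges T
    e₁∈ = ∈-resp-↭ shape (here refl)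
    e₂∈ : e₂ ∈ˡ edges T
    e₂∈ = ∈-resp-↭ shape (there (here refl))
    fs∈ : All (_∈ˡ edges T) fs
    fs∈ = All.tabulate λ f∈ → ∈-resp-↭ shape (there (there f∈))

    build : ProperAfter (e₁ ∷ []) (e₂ ∷ fs) → Broom T
    -- The second edge attaches to the first: b is its new vertex, the other two vertices x and y
    -- lie in `e₁`, and a is the third vertex of `e₁`.
    build ((b , b∈e₂ , (b∉e₁ ∷ []) , here e₂-b⊆e₁) ∷ rest) = choose-x (element (∣p-x∣≡ (card e₂∈) b∈e₂))
      where
      hung : All Hangs fs
      hung = all-hang fs∈ ((e₂∈ , inj₂ (inj₁ refl)) ∷ (e₁∈ , inj₁ refl) ∷ []) (there (here refl)) (here refl) rest
      choose-x : ∃[ x ] x ∈ e₂ - b → Broom T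
      choose-x (x , x∈) = choose-y (element (∣p-x∣≡ (∣p-x∣≡ (card e₂∈) b∈e₂) x∈))
        where
        x∈e₁ : x ∈ e₁
        x∈e₁ = e₂-b⊆e₁ x∈
        choose-y : ∃[ y ] y ∈ e₂ - b - x → Broom T
        choose-y (y , y∈) = choose-a (element (∣p-x∣≡ (∣p-x∣≡ (card e₁∈) x∈e₁) y∈e₁))
          where
          y≢x : y ≢ x
          y≢x = x∈p-y⇒x≢y {p = e₂ - b} y∈
          y∈e₁ : y ∈ e₁ - x
          y∈e₁ = x∈p∧x≢y⇒x∈p-y′ (e₂-b⊆e₁ (x∈p-y⇒x∈p y∈)) y≢x
          e₂≡ : e₂ ≡ tri x y b
          e₂≡ = trans (tri-of (card e₂∈) b∈e₂ x∈ y∈) (trans (tri-swap b x y) (tri-flip x b y))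
          choose-a : ∃[ a ] a ∈ e₁ - x - y → Broom T
          choose-a (a , a∈) = record
            { x = x ; y = y ; a = a ; b = b ; leaf-edges = tasks fs∈ hung
            ; x≢y = y≢x ∘ sym
            ; a≢x = x∈p-y⇒x≢y {p = e₁} (x∈p-y⇒x∈p {p = e₁ - x} a∈)
            ; a≢y = x∈p-y⇒x≢y {p = e₁ - x} a∈
            ; b≢x = λ { refl → b∉e₁ x∈e₁ }
            ; b≢y = λ { refl → b∉e₁ (x∈p-y⇒x∈p y∈e₁) }
            ; b≢a = λ { refl → b∉e₁ (x∈p-y⇒x∈p {p = e₁} (x∈p-y⇒x∈p {p = e₁ - x} a∈)) }
            ; shape = ↭-trans (↭-reflexive (cong₂ _∷_ (sym e₁≡) (cong₂ _∷_ (sym e₂≡) (tasks-edges fs∈ hung)))) shape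
            ; fresh = λ v∈ → subst₂ (λ p p′ → _ ∉ p × _ ∉ p′) e₁≡ e₂≡ (tasks-fresh fs∈ hung v∈)
            ; leaves = λ v v∉₁ v∉₂ → leaves v (subst (v ∉_) (sym e₁≡) v∉₁) (subst (v ∉_) (sym e₂≡) v∉₂)
            }
            where
            e₁≡ : e₁ ≡ tri x y a
            e₁≡ = tri-of (card e₁∈) x∈e₁ y∈e₁ a∈

            l r : Fin 5 → Fin k
            l = left x y a b
            r = right x y a b

            role₁ : ∀ {u p s} → p ≢ s → p ∈ tri x y a → s ∈ tri x y a → ∃[ i ] tri u p s ≡ tri u (l i) (r i)
            role₁ {u} p≢s p∈ s∈ with ∈tri⁻ p∈ | ∈tri⁻ s∈
            ... | inj₁ refl        | inj₁ refl        = contradiction refl p≢s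
            ... | inj₁ refl        | inj₂ (inj₁ refl) = xy , refl
            ... | inj₁ refl        | inj₂ (inj₂ refl) = xa , refl
            ... | inj₂ (inj₁ refl) | inj₁ refl        = xy , tri-flip u y x
            ... | inj₂ (inj₁ refl) | inj₂ (inj₁ refl) = contradiction refl p≢s
            ... | inj₂ (inj₁ refl) | inj₂ (inj₂ refl) = ya , refl
            ... | inj₂ (inj₂ refl) | inj₁ refl        = xa , tri-flip u a x
            ... | inj₂ (inj₂ refl) | inj₂ (inj₁ refl) = ya , tri-flip u a y
            ... | inj₂ (inj₂ refl) | inj₂ (inj₂ refl) = contradiction refl p≢s

            role₂ : ∀ {u p s} → p ≢ s → p ∈ tri x y b → s ∈ tri x y b → ∃[ i ] tri u p s ≡ tri u (l i) (r i)
            role₂ {u} p≢s p∈ s∈ with ∈tri⁻ p∈ | ∈tri⁻ s∈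
            ... | inj₁ refl        | inj₁ refl        = contradiction refl p≢s
            ... | inj₁ refl        | inj₂ (inj₁ refl) = xy , refl
            ... | inj₁ refl        | inj₂ (inj₂ refl) = xb , refl
            ... | inj₂ (inj₁ refl) | inj₁ refl        = xy , tri-flip u y x
            ... | inj₂ (inj₁ refl) | inj₂ (inj₁ refl) = contradiction refl p≢s
            ... | inj₂ (inj₁ refl) | inj₂ (inj₂ refl) = yb , refl
            ... | inj₂ (inj₂ refl) | inj₁ refl        = xb , tri-flip u b x
            ... | inj₂ (inj₂ refl) | inj₂ (inj₁ refl) = yb , tri-flip u b y
            ... | inj₂ (inj₂ refl) | inj₂ (inj₂ refl) = contradiction refl p≢s

            task : ∀ {f} → f ∈ˡ edges T → (h : Hangs f) → ∃[ i ] f ≡ tri (proj₁ h) (l i) (r i)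
            task {f} f∈ (v , v∈f , _ , _ , f-v⊆) = result f-v⊆
              where
              ∣f-v∣≡2 = ∣p-x∣≡ (card f∈) v∈f
              p  = proj₁ (element {p = f - v} ∣f-v∣≡2)
              p∈ = proj₂ (element {p = f - v} ∣f-v∣≡2)
              ∣f-v-p∣≡1 = ∣p-x∣≡ {p = f - v} ∣f-v∣≡2 p∈
              s  = proj₁ (element {p = f - v - p} ∣f-v-p∣≡1)
              s∈ = proj₂ (element {p = f - v - p} ∣f-v-p∣≡1)
              p≢s : p ≢ s
              p≢s p≡s = x∈p-y⇒x≢y {p = f - v} s∈ (sym p≡s)
              result : f - v ⊆ e₁ ⊎ f - v ⊆ e₂ → ∃[ i ] f ≡ tri v (l i) (r i)
              result (inj₁ ⊆e₁) =
                let i , eq = role₁ {v} p≢s (subst (p ∈_) e₁≡ (⊆e₁ p∈)) (subst (s ∈_) e₁≡ (⊆e₁ (x∈p-y⇒x∈p {p = f - v} s∈)))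
                in i , trans (tri-of (card f∈) v∈f p∈ s∈) eq
              result (inj₂ ⊆e₂) =
                let i , eq = role₂ {v} p≢s (subst (p ∈_) e₂≡ (⊆e₂ p∈)) (subst (s ∈_) e₂≡ (⊆e₂ (x∈p-y⇒x∈p {p = f - v} s∈)))
                in i , trans (tri-of (card f∈) v∈f p∈ s∈) eq

            tasks : ∀ {fs} → All (_∈ˡ edges T) fs → All Hangs fs → List (Fin k × Fin 5)
            tasks []         []       = []
            tasks (f∈ ∷ fs∈) (h ∷ hs) = (proj₁ h , proj₁ (task f∈ h)) ∷ tasks fs∈ hs

            tasks-edges : ∀ {fs} (fs∈ : All (_∈ˡ edges T) fs) (hs : All Hangs fs) →
              map (λ (v , i) → tri v (l i) (r i)) (tasks fs∈ hs) ≡ fs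
            tasks-edges []         []       = refl
            tasks-edges (f∈ ∷ fs∈) (h ∷ hs) = cong₂ _∷_ (sym (proj₂ (task f∈ h))) (tasks-edges fs∈ hs)

            tasks-fresh : ∀ {fs} (fs∈ : All (_∈ˡ edges T) fs) (hs : All Hangs fs) {v i} →
              (v , i) ∈ˡ tasks fs∈ hs → v ∉ e₁ × v ∉ e₂
            tasks-fresh []         []                               ()
            tasks-fresh (f∈ ∷ fs∈) ((_ , _ , v∉e₁ , v∉e₂ , _) ∷ hs) (here refl) = v∉e₁ , v∉e₂
            tasks-fresh (f∈ ∷ fs∈) (h ∷ hs)                         (there v∈)  = tasks-fresh fs∈ hs v∈

-- Greedy placement of the leaves and the resulting embedding.

module Embeddings where

  open import Defs
  open import Data.Bool using (Bool; true; false; _∧_)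
  import Data.Bool.Properties as Bool
  open import Data.Nat using (ℕ; suc; _+_; _*_; _∸_; _≤_; _<_; z≤n; s≤s)
  open import Data.Nat.Properties hiding (_≟_)
  open import Data.Fin using (Fin; suc)
  open import Data.Fin.Properties using (any?; _≟_)
  open import Data.Fin.Subset using (Subset; _∈_)
  open import Data.Fin.Subset.Properties using (_∈?_)
  open import Data.Vec.Properties using ([]=⇒lookup; lookup⇒[]=; lookup∘tabulate)
  open import Data.List using (List; []; _∷_; length; map; filter)
  open import Data.List.Membership.Propositional using () renaming (_∈_ to _∈ˡ_; _∉_ to _∉ˡ_)
  open import Data.List.Membership.Propositional.Properties using (∈-map⁻; ∈-map⁺; ∈-filter⁺; ∈-filter⁻)
  import Data.List.Membership.DecPropositional as DecMembership
  open import Data.List.Relation.Unary.Any using (here; there)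
  open import Data.List.Relation.Unary.All as All using (All; []; _∷_)
  open import Data.List.Relation.Unary.AllPairs using ([]; _∷_)
  open import Data.List.Relation.Unary.Unique.Propositional using (Unique)
  open import Data.List.Relation.Binary.Permutation.Propositional using (↭-sym)
  open import Data.List.Relation.Binary.Permutation.Propositional.Properties using (∈-resp-↭; All-resp-↭)
  open import Data.Product using (_×_; _,_; ∃-syntax; proj₁; proj₂; swap)
  open import Data.Sum using (_⊎_; inj₁; inj₂; [_,_]′)
  open import Data.Empty using (⊥-elim)
  open import Function using (_∘_)
  open import Function.Definitions using (Injective)
  open import Relation.Nullary using (¬_; Dec; yes; no; does; contradiction)
  open import Relation.Nullary.Decidable using (_×-dec_; ¬?; dec-true)
  open import Relation.Binary.PropositionalEquality
  open import Algebra.Properties.Semiring.Sum +-*-semiring using (sum; ∑-distrib-+; *-distribʳ-sum)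
  open Scheduling
  open ThreeGraphs
  open Triples
  open TightTrees

  ∧-true : ∀ {p q} → p ∧ q ≡ true → p ≡ true × q ≡ true
  ∧-true {true} {true} _ = refl , refl

  unique-value : ∀ {A B : Set} {ps : List (A × B)} {u v w} → Unique (map proj₂ ps) → (u , w) ∈ˡ ps → (v , w) ∈ˡ ps → u ≡ v
  unique-value (_ ∷ _)  (here refl) (here refl) = refl
  unique-value (w∉ ∷ _) (here refl) (there v∈)  = contradiction refl (All.lookup w∉ (∈-map⁺ proj₂ v∈))
  unique-value (w∉ ∷ _) (there u∈)  (here refl) = contradiction refl (All.lookup w∉ (∈-map⁺ proj₂ u∈))
  unique-value (_ ∷ un) (there u∈)  (there v∈)  = unique-value un u∈ v∈

  block : ∀ {L : Set} → List (L × Fin 5) → Fin 5 → List (L × Fin 5)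
  block ts i = filter (λ τ → proj₂ τ ≟ i) ts

  block-total : ∀ {L : Set} (ts : List (L × Fin 5)) → length ts ≡ length (block ts xy) + (length (block ts xa) + length (block ts ya) + (length (block ts xb) + length (block ts yb)))
  block-total []       = refl
  block-total ((_ , i) ∷ ts) = trans (cong suc (block-total ts)) (count i)
    where
    l : Fin 5 → ℕ
    l i = length (block ts i)
    shift : ∀ p q → suc (p + q) ≡ p + suc q
    shift p q = sym (+-suc p q)
    count : ∀ i → suc (l xy + (l xa + l ya + (l xb + l yb))) ≡
      length (block ((_ , i) ∷ ts) xy) + (length (block ((_ , i) ∷ ts) xa) + length (block ((_ , i) ∷ ts) ya) +
      (length (block ((_ , i) ∷ ts) xb) + length (block ((_ , i) ∷ ts) yb)))
    count xy = refl
    count xa = shift (l xy) _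
    count ya = trans (shift (l xy) _) (cong (λ u → l xy + (u + (l xb + l yb))) (shift (l xa) (l ya)))
    count xb = trans (shift (l xy) _) (cong (l xy +_) (shift (l xa + l ya) _))
    count yb = trans (shift (l xy) _) (cong (l xy +_) (trans (shift (l xa + l ya) _) (cong (l xa + l ya +_) (shift (l xb) (l yb)))))

  module Placing {n : ℕ} {L : Set} (N : Fin 5 → Fin n → Bool) (c : Fin 5 → ℕ)
    (room : ∀ i → c i ≤ sum (λ v → ⟦ N i v ⟧)) where

    open DecMembership (_≟_ {n}) using () renaming (_∈?_ to _∈ᶠ?_)

    Task : Set
    Task = L × Fin 5

    used-count : ∀ (us : List (Fin n)) → sum (λ v → ⟦ does (v ∈ᶠ? us) ⟧) ≤ length us
    used-count []       = ≤-reflexive (trans (sum-const n 0) (*-zeroʳ n))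
    used-count (u ∷ us) = begin
      sum (λ v → ⟦ does (v ∈ᶠ? (u ∷ us)) ⟧)        ≤⟨ sum-mono split ⟩
      sum (λ v → δ u v + ⟦ does (v ∈ᶠ? us) ⟧)      ≡⟨ ∑-distrib-+ (δ u) (λ v → ⟦ does (v ∈ᶠ? us) ⟧) ⟩
      sum (δ u) + sum (λ v → ⟦ does (v ∈ᶠ? us) ⟧)  ≤⟨ +-mono-≤ (≤-reflexive (sum-δ u)) (used-count us) ⟩
      suc (length us)                              ∎
      where
      open ≤-Reasoning
      split : ∀ v → ⟦ does (v ∈ᶠ? (u ∷ us)) ⟧ ≤ δ u v + ⟦ does (v ∈ᶠ? us) ⟧
      split v with v ≟ u | v ∈ᶠ? us
      ... | yes _ | _     = s≤s z≤n
      ... | no _  | yes _ = ≤-refl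
      ... | no _  | no _  = z≤n

    pick : ∀ i us → length us < c i → ∃[ v ] N i v ≡ true × v ∉ˡ us
    pick i us us<c with any? (λ v → (N i v Bool.≟ true) ×-dec ¬? (v ∈ᶠ? us))
    ... | yes found = found
    ... | no none   = contradiction (≤-trans (room i) (≤-trans (sum-mono all-used) (used-count us))) (<⇒≱ us<c)
      where
      all-used : ∀ v → ⟦ N i v ⟧ ≤ ⟦ does (v ∈ᶠ? us) ⟧
      all-used v with N i v in eq | v ∈ᶠ? us
      ... | false | _      = z≤n
      ... | true  | yes _  = ≤-refl
      ... | true  | no v∉  = contradiction (v , eq , v∉) none

    State : Set
    State = List (Task × Fin n)

    module _ (all : List Task) where

     record Valid (st : State) : Set where
       constructor valid
       field
         distinct : Unique (map proj₂ st)
         allowed  : ∀ {ℓ i v} → ((ℓ , i) , v) ∈ˡ st → N i v ≡ true × (ℓ , i) ∈ˡ all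

     record Extension (st : State) (ts : List Task) : Set where
       field
         st′     : State
         valid′  : Valid st′
         length′ : length st′ ≡ length st + length ts
         keep    : ∀ {p} → p ∈ˡ st → p ∈ˡ st′
         placed  : ∀ {τ} → τ ∈ˡ ts → ∃[ v ] (τ , v) ∈ˡ st′

     open Extension

     extend : ∀ i (ts : List Task) → All (λ τ → proj₂ τ ≡ i × τ ∈ˡ all) ts → ∀ st → Valid st → length st + length ts ≤ c i → Extension st ts
     extend i []       _           st ok _ = record
       { st′ = st ; valid′ = ok ; length′ = sym (+-identityʳ (length st)) ; keep = λ p∈ → p∈ ; placed = λ () }
     extend i (τ@(ℓ , _) ∷ ts) ((refl , τ∈) ∷ roles) st (valid distinct allowed) fits =
       let v , Nv , v∉ = pick i (map proj₂ st) (subst (_< c i) (sym (length-map st))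
             (≤-trans (s≤s (m≤m+n (length st) (length ts))) fits′))
           ok = valid (All.tabulate (λ w∈ v≡w → v∉ (subst (_∈ˡ map proj₂ st) (sym v≡w) w∈)) ∷ distinct)
             λ { (here refl) → Nv , τ∈ ; (there p∈) → allowed p∈ }
           rest = extend i ts roles ((τ , v) ∷ st) ok fits′
       in record
         { st′ = st′ rest ; valid′ = valid′ rest ; length′ = trans (length′ rest) (sym (+-suc (length st) (length ts)))
         ; keep = keep rest ∘ there
         ; placed = λ { (here refl) → v , keep rest (here refl) ; (there τ∈) → placed rest τ∈ } }
       where
       fits′ : suc (length st + length ts) ≤ c i
       fits′ = subst (_≤ c i) (+-suc (length st) (length ts)) fits
       length-map : ∀ (st : State) → length (map proj₂ st) ≡ length st
       length-map []       = refl
       length-map (_ ∷ st) = cong suc (length-map st)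

    open Extension

    -- The length of the state is the accumulator of `Feasible`: it counts the host vertices taken
    -- so far, so each block finds a free vertex by `pick`.
    run : ∀ ts os st → Valid ts st → Feasible (length st) (map (λ i → c i , length (block ts i)) os) →
      ∃[ st′ ] Valid ts st′ × (∀ {p} → p ∈ˡ st → p ∈ˡ st′) × (∀ {ℓ i} → (ℓ , i) ∈ˡ ts → i ∈ˡ os → ∃[ v ] ((ℓ , i) , v) ∈ˡ st′)
    run ts []       st ok _                = st , ok , (λ p∈ → p∈) , λ _ ()
    run ts (i ∷ os) st ok (fits , feasible) =
      let ext = extend ts i (block ts i) (All.tabulate (λ τ∈ → swap (∈-filter⁻ (λ τ → proj₂ τ ≟ i) {xs = ts} τ∈))) st ok fits
          st″ , ok″ , keep″ , placed″ = run ts os (st′ ext) (valid′ ext)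
            (subst (λ u → Feasible u (map (λ i → c i , length (block ts i)) os)) (sym (length′ ext)) feasible)
      in st″ , ok″ , keep″ ∘ keep ext , λ
        { τ∈ (here refl) → let v , v∈ = placed ext (∈-filter⁺ (λ τ → proj₂ τ ≟ i) τ∈ refl) in v , keep″ v∈
        ; τ∈ (there i∈)  → placed″ τ∈ i∈ }

  ∈image⁺ : ∀ {k n} (f : Fin k → Fin n) {p : Subset k} {i} → i ∈ p → f i ∈ image f p
  ∈image⁺ f {p} {i} i∈ = lookup⇒[]= (f i) (image f p)
    (trans (lookup∘tabulate (λ j → does (any? λ i → (i ∈? p) ×-dec (f i ≟ j))) (f i)) (dec-true (any? λ j → (j ∈? p) ×-dec (f j ≟ f i)) (i , i∈ , refl)))

  ∈image⁻ : ∀ {k n} (f : Fin k → Fin n) {p : Subset k} {j} → j ∈ image f p → ∃[ i ] i ∈ p × f i ≡ j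
  ∈image⁻ f {p} {j} j∈ = does≡true (any? λ i → (i ∈? p) ×-dec (f i ≟ j))
    (trans (sym (lookup∘tabulate (λ j → does (any? λ i → (i ∈? p) ×-dec (f i ≟ j))) j)) ([]=⇒lookup j∈))

  image-tri : ∀ {k n} (f : Fin k → Fin n) x y z → image f (tri x y z) ≡ tri (f x) (f y) (f z)
  image-tri f x y z = ≡tri (∈image⁺ f (tri₁ {x = x} {y} {z})) (∈image⁺ f (tri₂ {x = x} {y} {z})) (∈image⁺ f (tri₃ {x = x} {y} {z}))
    λ u∈ → let i , i∈ , fi≡u = ∈image⁻ f u∈ in
      [ (λ i≡ → inj₁ (trans (sym fi≡u) (cong f i≡))) , [ (λ i≡ → inj₂ (inj₁ (trans (sym fi≡u) (cong f i≡)))) , (λ i≡ → inj₂ (inj₂ (trans (sym fi≡u) (cong f i≡)))) ]′ ]′ (∈tri⁻ i∈)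

  module Embedding {k n : ℕ} (T : RGraph 3 k) (spanning : ∀ v → v ∈ V T) (B′ : Broom T) (G : RGraph 3 n) where

    open Broom B′
    open Graph (adjacency G)

    E⇒∈ : ∀ {u v w} → E u v w ≡ true → tri u v w ∈ˡ edges G
    E⇒∈ {u} {v} {w} = does≡true (tri u v w ∈ˡ? edges G)

    E-distinct : ∀ {u v w} → E u v w ≡ true → u ≢ v
    E-distinct {u} {.u} {w} Euvw refl = contradiction (trans (sym Euvw) (E-irrefl u w)) λ ()

    module _ {X Y A B : Fin n} (EXYA : E X Y A ≡ true) (EXYB : E X Y B ≡ true) (B≢A : B ≢ A) where

      X≢Y : X ≢ Y
      X≢Y = E-distinct EXYA
      X≢A : X ≢ A
      X≢A = E-distinct (trans (E-flip X A Y) EXYA)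
      Y≢A : Y ≢ A
      Y≢A = E-distinct (trans (E-rotate X Y A) EXYA)
      X≢B : X ≢ B
      X≢B = E-distinct (trans (E-flip X B Y) EXYB)
      Y≢B : Y ≢ B
      Y≢B = E-distinct (trans (E-rotate X Y B) EXYB)

      Fresh : Fin n → Set
      Fresh v = v ≢ X × v ≢ Y × v ≢ A × v ≢ B

      fresh? : ∀ v → Dec (Fresh v)
      fresh? v = ¬? (v ≟ X) ×-dec ¬? (v ≟ Y) ×-dec ¬? (v ≟ A) ×-dec ¬? (v ≟ B)

      stale : ∀ {v} → ¬ Fresh v → v ≡ X ⊎ v ≡ Y ⊎ v ≡ A ⊎ v ≡ B
      stale {v} ¬f with v ≟ X | v ≟ Y | v ≟ A | v ≟ B
      ... | yes e | _     | _     | _     = inj₁ e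
      ... | no _  | yes e | _     | _     = inj₂ (inj₁ e)
      ... | no _  | no _  | yes e | _     = inj₂ (inj₂ (inj₁ e))
      ... | no _  | no _  | no _  | yes e = inj₂ (inj₂ (inj₂ e))
      ... | no p  | no q  | no r  | no s  = contradiction (p , q , r , s) ¬f

      N : Fin 5 → Fin n → Bool
      N i v = E (left X Y A B i) (right X Y A B i) v ∧ does (fresh? v)

      -- Of the four trunk images, p and q never complete the pair pq to an edge, s costs at most
      -- one place, and u costs one exactly if pqu is an edge.
      room-at : ∀ p q s u → (∀ {v} → ¬ Fresh v → v ≡ p ⊎ v ≡ q ⊎ v ≡ s ⊎ v ≡ u) →
        deg p q ∸ (1 + ⟦ E p q u ⟧) ≤ sum (λ v → ⟦ E p q v ∧ does (fresh? v) ⟧)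
      room-at p q s u split = m≤n+o⇒m∸n≤o (deg p q) (1 + ⟦ E p q u ⟧) (begin
        deg p q
          ≤⟨ sum-mono pointwise ⟩
        sum (λ v → (δ s v + δ u v * ⟦ E p q u ⟧) + ⟦ E p q v ∧ does (fresh? v) ⟧)
          ≡⟨ ∑-distrib-+ (λ v → δ s v + δ u v * ⟦ E p q u ⟧) (λ v → ⟦ E p q v ∧ does (fresh? v) ⟧) ⟩
        sum (λ v → δ s v + δ u v * ⟦ E p q u ⟧) + sum (λ v → ⟦ E p q v ∧ does (fresh? v) ⟧)
          ≡⟨ cong (_+ sum (λ v → ⟦ E p q v ∧ does (fresh? v) ⟧)) marks ⟩
        1 + ⟦ E p q u ⟧ + sum (λ v → ⟦ E p q v ∧ does (fresh? v) ⟧) ∎)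
        where
        open ≤-Reasoning
        marks : sum (λ v → δ s v + δ u v * ⟦ E p q u ⟧) ≡ 1 + ⟦ E p q u ⟧
        marks = trans (∑-distrib-+ (δ s) (λ v → δ u v * ⟦ E p q u ⟧))
          (cong₂ _+_ (sum-δ s) (trans (sym (*-distribʳ-sum ⟦ E p q u ⟧ (δ u))) (trans (cong (_* ⟦ E p q u ⟧) (sum-δ u)) (*-identityˡ _))))
        nonedge : ∀ {v} → E p q v ≡ false → ∀ {j} → e p q v ≤ j
        nonedge ¬E = ≤-trans (≤-reflexive (cong ⟦_⟧ ¬E)) z≤n
        taken : ∀ v → v ≡ p ⊎ v ≡ q ⊎ v ≡ s ⊎ v ≡ u → e p q v ≤ δ s v + δ u v * ⟦ E p q u ⟧
        taken v (inj₁ refl)               = nonedge (trans (E-flip v q v) (E-irrefl v q))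
        taken v (inj₂ (inj₁ refl))        = nonedge (trans (sym (E-rotate p v v)) (E-irrefl v p))
        taken v (inj₂ (inj₂ (inj₁ refl))) = ≤-trans (e≤1 p q v) (≤-trans (≤-reflexive (sym (δ-refl v))) (m≤m+n (δ v v) _))
        taken v (inj₂ (inj₂ (inj₂ refl))) = ≤-trans (≤-reflexive (sym (trans (cong (_* e p q v) (δ-refl v)) (*-identityˡ _)))) (m≤n+m (δ v v * e p q v) (δ s v))
        pointwise : ∀ v → e p q v ≤ (δ s v + δ u v * ⟦ E p q u ⟧) + ⟦ E p q v ∧ does (fresh? v) ⟧
        pointwise v = by-cases (fresh? v)
          where
          by-cases : Dec (Fresh v) → e p q v ≤ (δ s v + δ u v * ⟦ E p q u ⟧) + ⟦ E p q v ∧ does (fresh? v) ⟧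
          by-cases (yes f) = ≤-trans (≤-reflexive (cong ⟦_⟧ (sym (trans (cong (E p q v ∧_) (dec-true (fresh? v) f)) (Bool.∧-identityʳ (E p q v))))))
            (m≤n+m _ (δ s v + δ u v * ⟦ E p q u ⟧))
          by-cases (no ¬f) = ≤-trans (taken v (split ¬f)) (m≤m+n _ _)

      c : Fin 5 → ℕ
      c = assign (deg X Y ∸ 2) (deg X A ∸ (1 + ⟦ E X A B ⟧)) (deg Y A ∸ (1 + ⟦ E Y A B ⟧))
                 (deg X B ∸ (1 + ⟦ E X B A ⟧)) (deg Y B ∸ (1 + ⟦ E Y B A ⟧))

      room : ∀ i → c i ≤ sum (λ v → ⟦ N i v ⟧)
      room xy = subst (λ t → deg X Y ∸ (1 + ⟦ t ⟧) ≤ sum (λ v → ⟦ N xy v ⟧)) EXYB (room-at X Y A B stale)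
      room xa = room-at X A Y B ([ inj₁ , [ inj₂ ∘ inj₂ ∘ inj₁ , [ inj₂ ∘ inj₁ , inj₂ ∘ inj₂ ∘ inj₂ ]′ ]′ ]′ ∘ stale)
      room ya = room-at Y A X B ([ inj₂ ∘ inj₂ ∘ inj₁ , [ inj₁ , [ inj₂ ∘ inj₁ , inj₂ ∘ inj₂ ∘ inj₂ ]′ ]′ ]′ ∘ stale)
      room xb = room-at X B Y A ([ inj₁ , [ inj₂ ∘ inj₂ ∘ inj₁ , [ inj₂ ∘ inj₂ ∘ inj₂ , inj₂ ∘ inj₁ ]′ ]′ ]′ ∘ stale)
      room yb = room-at Y B X A ([ inj₂ ∘ inj₂ ∘ inj₁ , [ inj₁ , [ inj₂ ∘ inj₂ ∘ inj₂ , inj₂ ∘ inj₁ ]′ ]′ ]′ ∘ stale)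

      open Placing {n} {Fin k} N c room

      embed : ∀ os → Covers os → Feasible 0 (map (λ i → c i , length (block leaf-edges i)) os) → Contains G T
      embed os covers feasible = from-placement (run leaf-edges os [] (valid [] λ ()) feasible)
        where
        from-placement : (∃[ st′ ] Valid leaf-edges st′ × (∀ {p} → p ∈ˡ [] → p ∈ˡ st′) × (∀ {ℓ i} → (ℓ , i) ∈ˡ leaf-edges → i ∈ˡ os → ∃[ v ] ((ℓ , i) , v) ∈ˡ st′)) → Contains G T
        from-placement (st , valid distinct allowed , _ , placed) = f , injective , All-resp-↭ shape (trunk₁-image ∷ trunk₂-image ∷ All.tabulate (λ e∈ → let τ , τ∈ , e≡ = ∈-map⁻ edge e∈ in subst (λ e → image f e ∈ˡ edges G) (sym e≡) (leaf-image τ∈)))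
          where
          forget : Task × Fin n → Fin k × Fin n
          forget ((ℓ , _) , v) = ℓ , v

          -- The embedding as an association list. Distinct second components make the lookup `f`
          -- injective, via `unique-value`; `entry` recovers which image each trunk vertex gets.
          full : List (Fin k × Fin n)
          full = (x , X) ∷ (y , Y) ∷ (a , A) ∷ (b , B) ∷ map forget st

          values : ∀ (st : State) → map proj₂ (map forget st) ≡ map proj₂ st
          values []       = refl
          values (_ ∷ st) = cong (_ ∷_) (values st)

          fresh-value : ∀ {v} → v ∈ˡ map proj₂ (map forget st) → Fresh v
          fresh-value v∈ =
            let p , p∈ , v≡ = ∈-map⁻ proj₂ v∈
                ((ℓ , i) , w) , q∈ , p≡ = ∈-map⁻ forget p∈
            in subst Fresh (sym (trans v≡ (cong proj₂ p≡))) (does≡true (fresh? w) (proj₂ (∧-true {E (left X Y A B i) (right X Y A B i) w} (proj₁ (allowed q∈)))))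

          distinct-values : Unique (map proj₂ full)
          distinct-values =
            (X≢Y ∷ X≢A ∷ X≢B ∷ All.tabulate (λ v∈ X≡v → proj₁ (fresh-value v∈) (sym X≡v))) ∷
            (Y≢A ∷ Y≢B ∷ All.tabulate (λ v∈ Y≡v → proj₁ (proj₂ (fresh-value v∈)) (sym Y≡v))) ∷
            ((B≢A ∘ sym) ∷ All.tabulate (λ v∈ A≡v → proj₁ (proj₂ (proj₂ (fresh-value v∈))) (sym A≡v))) ∷
            (All.tabulate (λ v∈ B≡v → proj₂ (proj₂ (proj₂ (fresh-value v∈))) (sym B≡v))) ∷
            subst Unique (sym (values st)) distinct

          in-full : ∀ v → ∃[ w ] (v , w) ∈ˡ full
          in-full v =
            let e , e∈ , v∈e = ∈⋃⁻ (edges T) (spanning v) in in-edge (∈-resp-↭ (↭-sym shape) e∈) v∈e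
            where
            at-x : v ≡ x → ∃[ w ] (v , w) ∈ˡ full
            at-x refl = X , here refl
            at-y : v ≡ y → ∃[ w ] (v , w) ∈ˡ full
            at-y refl = Y , there (here refl)
            at-a : v ≡ a → ∃[ w ] (v , w) ∈ˡ full
            at-a refl = A , there (there (here refl))
            at-b : v ≡ b → ∃[ w ] (v , w) ∈ˡ full
            at-b refl = B , there (there (there (here refl)))
            at-left : ∀ i → v ≡ left x y a b i → ∃[ w ] (v , w) ∈ˡ full
            at-left xy = at-x
            at-left xa = at-x
            at-left ya = at-y
            at-left xb = at-x
            at-left yb = at-y
            at-right : ∀ i → v ≡ right x y a b i → ∃[ w ] (v , w) ∈ˡ full
            at-right xy = at-y
            at-right xa = at-a
            at-right ya = at-a
            at-right xb = at-b
            at-right yb = at-b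
            in-edge : ∀ {e} → e ∈ˡ tri x y a ∷ tri x y b ∷ map edge leaf-edges → v ∈ e → ∃[ w ] (v , w) ∈ˡ full
            in-edge (here refl)         v∈ = [ at-x , [ at-y , at-a ]′ ]′ (∈tri⁻ v∈)
            in-edge (there (here refl)) v∈ = [ at-x , [ at-y , at-b ]′ ]′ (∈tri⁻ v∈)
            in-edge (there (there e∈))  v∈ =
              let (ℓ , i) , τ∈ , e≡ = ∈-map⁻ edge e∈
                  w , w∈ = placed τ∈ (covers i)
              in [ (λ { refl → w , there (there (there (there (∈-map⁺ forget w∈)))) }) , [ at-left i , at-right i ]′ ]′
                   (∈tri⁻ (subst (v ∈_) e≡ v∈))

          f : Fin k → Fin n
          f v = proj₁ (in-full v)

          f∈ : ∀ v → (v , f v) ∈ˡ full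
          f∈ v = proj₂ (in-full v)

          injective : Injective _≡_ _≡_ f
          injective {u} {v} fu≡fv = unique-value distinct-values (f∈ u) (subst (λ w → (v , w) ∈ˡ full) (sym fu≡fv) (f∈ v))

          Leaf-entry : Fin k → Fin n → Set
          Leaf-entry v w = ∃[ i ] N i w ≡ true × (v , i) ∈ˡ leaf-edges

          entry : ∀ {v w} → (v , w) ∈ˡ full →
            (v ≡ x × w ≡ X) ⊎ (v ≡ y × w ≡ Y) ⊎ (v ≡ a × w ≡ A) ⊎ (v ≡ b × w ≡ B) ⊎ Leaf-entry v w
          entry (here refl)                         = inj₁ (refl , refl)
          entry (there (here refl))                 = inj₂ (inj₁ (refl , refl))
          entry (there (there (here refl)))         = inj₂ (inj₂ (inj₁ (refl , refl)))
          entry (there (there (there (here refl)))) = inj₂ (inj₂ (inj₂ (inj₁ (refl , refl))))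
          entry (there (there (there (there p∈))))  = inj₂ (inj₂ (inj₂ (inj₂ (leaf-entry (∈-map⁻ forget p∈)))))
            where
            leaf-entry : ∀ {v w} → (∃[ q ] q ∈ˡ st × (v , w) ≡ forget q) → Leaf-entry v w
            leaf-entry (((ℓ , i) , w) , q∈ , refl) = i , allowed q∈

          not-leaf : ∀ {v w} {P : Set} → v ∈ tri x y a ⊎ v ∈ tri x y b → Leaf-entry v w → P
          not-leaf v∈ (i , _ , τ∈) = ⊥-elim ([ proj₁ (fresh τ∈) , proj₂ (fresh τ∈) ]′ v∈)

          fx : f x ≡ X
          fx with entry (f∈ x)
          ... | inj₁ (_ , eq)                            = eq
          ... | inj₂ (inj₁ (x≡y , _))                    = contradiction x≡y x≢y
          ... | inj₂ (inj₂ (inj₁ (x≡a , _)))             = contradiction (sym x≡a) a≢x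
          ... | inj₂ (inj₂ (inj₂ (inj₁ (x≡b , _))))      = contradiction (sym x≡b) b≢x
          ... | inj₂ (inj₂ (inj₂ (inj₂ leaf)))           = not-leaf (inj₁ tri₁) leaf

          fy : f y ≡ Y
          fy with entry (f∈ y)
          ... | inj₁ (y≡x , _)                           = contradiction (sym y≡x) x≢y
          ... | inj₂ (inj₁ (_ , eq))                     = eq
          ... | inj₂ (inj₂ (inj₁ (y≡a , _)))             = contradiction (sym y≡a) a≢y
          ... | inj₂ (inj₂ (inj₂ (inj₁ (y≡b , _))))      = contradiction (sym y≡b) b≢y
          ... | inj₂ (inj₂ (inj₂ (inj₂ leaf)))           = not-leaf (inj₁ (tri₂ {x = x} {y} {a})) leaf

          fa : f a ≡ A
          fa with entry (f∈ a)
          ... | inj₁ (a≡x , _)                           = contradiction a≡x a≢x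
          ... | inj₂ (inj₁ (a≡y , _))                    = contradiction a≡y a≢y
          ... | inj₂ (inj₂ (inj₁ (_ , eq)))              = eq
          ... | inj₂ (inj₂ (inj₂ (inj₁ (a≡b , _))))      = contradiction (sym a≡b) b≢a
          ... | inj₂ (inj₂ (inj₂ (inj₂ leaf)))           = not-leaf (inj₁ (tri₃ {x = x} {y} {a})) leaf

          fb : f b ≡ B
          fb with entry (f∈ b)
          ... | inj₁ (b≡x , _)                           = contradiction b≡x b≢x
          ... | inj₂ (inj₁ (b≡y , _))                    = contradiction b≡y b≢y
          ... | inj₂ (inj₂ (inj₁ (b≡a , _)))             = contradiction b≡a b≢a
          ... | inj₂ (inj₂ (inj₂ (inj₁ (_ , eq))))       = eq
          ... | inj₂ (inj₂ (inj₂ (inj₂ leaf)))           = not-leaf (inj₂ (tri₃ {x = x} {y} {b})) leaf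

          f-left : ∀ i → f (left x y a b i) ≡ left X Y A B i
          f-left xy = fx
          f-left xa = fx
          f-left ya = fy
          f-left xb = fx
          f-left yb = fy

          f-right : ∀ i → f (right x y a b i) ≡ right X Y A B i
          f-right xy = fy
          f-right xa = fa
          f-right ya = fa
          f-right xb = fb
          f-right yb = fb

          image-edge : ∀ {u v w u′ v′ w′} → f u ≡ u′ → f v ≡ v′ → f w ≡ w′ → E u′ v′ w′ ≡ true → image f (tri u v w) ∈ˡ edges G
          image-edge {u} {v} {w} refl refl refl Efuvw = subst (_∈ˡ edges G) (sym (image-tri f u v w)) (E⇒∈ Efuvw)

          trunk₁-image : image f (tri x y a) ∈ˡ edges G
          trunk₁-image = image-edge fx fy fa EXYA

          trunk₂-image : image f (tri x y b) ∈ˡ edges G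
          trunk₂-image = image-edge fx fy fb EXYB

          leaf-image : ∀ {τ} → τ ∈ˡ leaf-edges → image f (edge τ) ∈ˡ edges G
          leaf-image {v , i} τ∈ = at-entry (entry (f∈ v))
            where
            stray : ∀ {P : Set} → v ∈ tri x y a ⊎ v ∈ tri x y b → P
            stray v∈ = ⊥-elim ([ proj₁ (fresh τ∈) , proj₂ (fresh τ∈) ]′ v∈)
            at-entry : (v ≡ x × f v ≡ X) ⊎ (v ≡ y × f v ≡ Y) ⊎ (v ≡ a × f v ≡ A) ⊎ (v ≡ b × f v ≡ B) ⊎ Leaf-entry v (f v) →
              image f (edge (v , i)) ∈ˡ edges G
            at-entry (inj₁ (v≡x , _))                      = stray (inj₁ (subst (_∈ tri x y a) (sym v≡x) tri₁))
            at-entry (inj₂ (inj₁ (v≡y , _)))               = stray (inj₁ (subst (_∈ tri x y a) (sym v≡y) (tri₂ {x = x} {y} {a})))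
            at-entry (inj₂ (inj₂ (inj₁ (v≡a , _))))        = stray (inj₁ (subst (_∈ tri x y a) (sym v≡a) (tri₃ {x = x} {y} {a})))
            at-entry (inj₂ (inj₂ (inj₂ (inj₁ (v≡b , _))))) = stray (inj₂ (subst (_∈ tri x y b) (sym v≡b) (tri₃ {x = x} {y} {b})))
            -- The image of v may have been chosen for a role j written differently from i; both
            -- describe the one edge of the leaf v.
            at-entry (inj₂ (inj₂ (inj₂ (inj₂ (j , Nj , τ′∈))))) =
              subst (λ e → image f e ∈ˡ edges G) (leaf-edge-unique τ′∈ τ∈)
                (image-edge refl (f-left j) (f-right j)
                  (trans (sym (E-rotate (f v) (left X Y A B j) (right X Y A B j))) (proj₁ (∧-true Nj))))

-- From ordered triples to the number of edges.

module EdgeBound where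

  open import Defs
  open import Data.Nat using (ℕ; zero; suc; _+_; _*_; _∸_; _≤_; _<_; _≥_; z≤n; s≤s)
  open import Data.Nat.Properties hiding (_≟_)
  open import Data.Nat.Combinatorics using (_C_; nC1≡n; nCk+nC[k+1]≡[n+1]C[k+1])
  open import Data.Nat.Tactic.RingSolver using (solve)
  open import Data.Fin using (Fin; zero; suc)
  open import Data.List using ([]; _∷_; length)
  open import Data.List.Properties using (map-cong; length-map)
  open import Data.List.Relation.Binary.Permutation.Propositional.Properties using (↭-length)
  open import Data.Product using (_,_; proj₂)
  open import Relation.Nullary using (¬_)
  open import Relation.Binary.PropositionalEquality
  open Arithmetic
  open Scheduling
  open ThreeGraphs
  open DenseGraphs
  open Triples
  open TightTrees
  open Embeddings

  n*n≡2*nC2+n : ∀ n → n * n ≡ 2 * (n C 2) + n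
  n*n≡2*nC2+n zero    = refl
  n*n≡2*nC2+n (suc n) = begin
    suc n * suc n                  ≡⟨ expand n ⟩
    n * n + (1 + n + n)            ≡⟨ cong (_+ (1 + n + n)) (n*n≡2*nC2+n n) ⟩
    2 * (n C 2) + n + (1 + n + n)  ≡⟨ regroup n (n C 2) ⟩
    2 * (n + n C 2) + suc n        ≡⟨ cong (λ u → 2 * (u + n C 2) + suc n) (sym (nC1≡n n)) ⟩
    2 * (n C 1 + n C 2) + suc n    ≡⟨ cong (λ u → 2 * u + suc n) (nCk+nC[k+1]≡[n+1]C[k+1] n 1) ⟩
    2 * (suc n C 2) + suc n        ∎
    where
    open ≡-Reasoning
    expand : ∀ n → suc n * suc n ≡ n * n + (1 + n + n)
    expand n = solve (n ∷ [])
    regroup : ∀ n c → 2 * c + n + (1 + n + n) ≡ 2 * (n + c) + suc n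
    regroup n c = solve (n ∷ c ∷ [])

  module _ {k : ℕ} (T : RGraph 3 k) (t c : ℕ) (tree : IsTightTree T) (size≡t : size T ≡ t)
    (minimal : IsMinTrunkSize T c) (c≤2 : c ≤ 2) (t≥20 : t ≥ 20) where

    private
      T-broom : Broom T
      T-broom = broom (trunk₂ tree minimal c≤2 (subst (2 ≤_) (sym size≡t) (≤-trans (s≤s (s≤s z≤n)) t≥20)))

      open Broom T-broom using (leaf-edges; edge; shape)

      leaf-count : Fin 5 → ℕ
      leaf-count i = length (block leaf-edges i)

      total : t ∸ 1 ≡ suc (leaf-count xy + (leaf-count xa + leaf-count ya + (leaf-count xb + leaf-count yb)))
      total = cong (_∸ 1) (trans (sym size≡t) (trans (sym (↭-length shape))
        (cong (λ u → suc (suc u)) (trans (length-map edge leaf-edges) (block-total leaf-edges)))))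

      assign-count : ∀ i → assign (leaf-count xy) (leaf-count xa) (leaf-count ya) (leaf-count xb) (leaf-count yb) i ≡ leaf-count i
      assign-count xy = refl
      assign-count xa = refl
      assign-count ya = refl
      assign-count xb = refl
      assign-count yb = refl

    edge-bound : ∀ {n} (G : RGraph 3 n) → ¬ Contains G T → size G * 3 ≤ (t ∸ 1) * (n C 2)
    edge-bound {n} G ¬contains = bound (t ∸ 1) (size G) (n C 2) (Graph.size³ (adjacency G)) (size-adjacency G) (n*n≡2*nC2+n n)
      (Bound.size-bound (adjacency G) (t ∸ 1) (∸-monoˡ-≤ 1 t≥20) _ _ _ _ _ total
        λ x y a b Exya Exyb b≢a os covers feasible →
          ¬contains (Embedding.embed T (proj₂ tree) T-broom G Exya Exyb b≢a os covers
            (subst (Feasible 0) (map-cong (λ i → cong (_ ,_) (assign-count i)) os) feasible)))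
      where
      -- Six ordered triples per edge against m n(n - 1), which is 2m times the binomial
      -- coefficient; halving both sides gives the factor 3.
      bound : ∀ m s c v → 6 * s ≤ v → n * n ≡ 2 * c + n → v + m * n ≤ m * (n * n) → s * 3 ≤ m * c
      bound m s c v s≤ nn v≤ = ≮⇒≥ λ (h : m * c < s * 3) →
        refute 1 (2 ⊗ h ⊕ s≤ ⊕ v≤ ⊕ m ⊗ (eq≤ nn)) (solve (n ∷ m ∷ s ∷ c ∷ v ∷ []))

open import Defs
open import Data.Nat using (ℕ; NonZero; _≤_; _≥_; _∸_)
open import Data.Nat.Combinatorics using (_C_)
open import Data.Integer using (+_)
open import Data.Rational.Unnormalised using (_/_; _*_) renaming (_≤_ to _≤ᵘ_)
open import Relation.Binary.PropositionalEquality using (_≡_)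

import Data.Integer as ℤ
import Data.Integer.Properties as ℤ
import Data.Rational.Unnormalised as ℚᵘ
open import Data.Product using (_,_)
open import Relation.Binary.PropositionalEquality using (refl; sym; trans; subst₂)

theorem1p4 : ∀ {k} (T : RGraph 3 k) (t c : ℕ) →
    IsTightTree T → size T ≡ t →
    IsMinTrunkSize T c → c ≤ 2 →
    t ≥ 20 →
    ∀ (n : ℕ) .{{_ : NonZero n}} (ex : ℕ) → IsTuránNumber 3 n T ex →
    (+ ex / 1) ≤ᵘ (+ (t ∸ 1) / 3) * (+ (n C 2) / 1)
theorem1p4 T t c tree size≡t minimal c≤2 t≥20 n ex ((G , refl , ¬contains) , _) =
  -- The Turán number is attained by `G`, and the comparison of fractions is the cross-multiplied
  -- integer inequality.
  ℚᵘ.*≤* (subst₂ ℤ._≤_ (ℤ.pos-* (size G) 3) (trans (ℤ.pos-* (t ∸ 1) (n C 2)) (sym (ℤ.*-identityʳ _)))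
    (ℤ.+≤+ (EdgeBound.edge-bound T t c tree size≡t minimal c≤2 t≥20 G ¬contains)))
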